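{- Let $\mathbb{K}\in\{\mathbb{R},\mathbb{C}\}$, let $n=3r$, and suppose that $T=\sum_{i=1}^r a_{i1}a_{i2}a_{i3}\in S^3(\mathbb{K}^n)$ where the $3r$ vectors $a_{ik}\in\mathbb{K}^n$ ($i=1,\dots,r$, $k=1,2,3$) are linearly independent. Then the following algorithm, with input $T$, produces the terms $a_{i1}a_{i2}a_{i3}$, $i=1,\dots,r$: (1) Sample generic $f,g,\ell\in\mathbb{K}^n$. (2) Find the $3r$ solutions $\lambda_{ik}\in\mathbb{C}$, $x_{ik}\in\mathbb{C}^n$ (generalized eigenvalues and corresponding generalized eigenvectors) to the generalized eigenvalue problem $\det(T_f-\lambda T_g)=0$, where $i=1,\dots,r$ and $k=1,2,3$. (3) Set $h_{ik}:=f-\lambda_{ik}g$. (4) For each vector $x_{ik}$, find the vectors $x_{i'k'}$ for which $x_{i'k'}^TT_\ell x_{ik}\neq 0$. This partitions the vectors into triples $\{x_{i1},x_{i2},x_{i3}\}$. (5) Let $U_i=\langle T_fx_{i1},T_fx_{i2},T_fx_{i3}\rangle$. (6) Compute nonzero vectors $a_{ik}'\in\langle x_{ik}\rangle^{\perp}\cap\langle h_{ik}\rangle^{\perp}\cap U_i$ for $k=1,2,3$. (7) Solve the system $T_f\,x_{i1}=c_i\,(a_{i1}'a_{i2}'a_{i3}')_f\,x_{i1}$ for $c_i\in\mathbb{C}$, and output $\{c_ia_{i1}'a_{i2}'a_{i3}' : i=1,\dots,r\}$.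
   Context: For vectors $v_1,v_2,v_3$ write $v_1v_2v_3:=\frac{1}{3!}\sum_{\sigma\in\mathfrak{S}_3}v_{\sigma(1)}\otimes v_{\sigma(2)}\otimes v_{\sigma(3)}$. For a symmetric $3$-tensor $S$ and a vector $f$, $S_f$ denotes the contraction of $S$ by $f$ along the first index, i.e. $S_f=(f^T\otimes I\otimes I)S$ regarded as an $n\times n$ matrix. A generalized eigenvector for a solution $\lambda$ of $\det(T_f-\lambda T_g)=0$ is a nonzero $x\in\mathbb{C}^n$ with $(T_f-\lambda T_g)x=0$. Orthogonal complements are taken with respect to the bilinear pairing $\langle a,b\rangle=a^Tb$, $\langle\cdot\rangle$ denotes linear span, and all algorithmic operations (including spans and orthogonal complements) are carried out over $\mathbb{C}$, even if $\mathbb{K}=\mathbb{R}$. "Generic" means outside some proper Zariski closed subset. The labeling of the indices in the output is arbitrary: the output is the set of terms of the decomposition. -}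

module Defs where

open import Algebra.Bundles using (RawRing)
import Algebra.Definitions.RawSemiring as RawSemiringDefinitions
open import Data.Fin.Base using (Fin; zero; suc; toℕ; punchIn)
open import Data.Fin.Patterns using (0F; 1F; 2F)
open import Data.Integer.Base using (+_)
open import Data.Nat.Base as ℕ using (ℕ; zero; suc)
import Data.Nat.Properties as ℕ
open import Data.Product.Base using (Σ-syntax; ∃; _×_; _,_)
open import Data.Rational.Base as ℚ using (ℚ; 0ℚ; 1ℚ; ½)
import Data.Rational.Properties as ℚ
open import Data.Rational.Solver using (module +-*-Solver)
open import Data.Vec.Functional using (Vector; toVec; _++_; _∷_; [])
open import Function.Bundles using (_⇔_; _↔_; module Inverse)
open import Level using (0ℓ)
open import Relation.Binary.PropositionalEquality
  using (_≡_; refl; sym; trans; cong; cong₂; subst; subst₂)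
open import Relation.Nullary.Negation using (¬_)
open import Relation.Unary using (Pred; _∈_; _∉_; _∩_; _≐_)
import Tactic.RingSolver.Core.Expression as Expression

------------------------------------------------------------------------
-- The real numbers, as Cauchy sequences of rationals

-- `a ≈[ ε ] b` says |a - b| < ε.
_≈[_]_ : ℚ → ℚ → ℚ → Set
a ≈[ ε ] b = ℚ.∣ a ℚ.- b ∣ ℚ.< ε

IsCauchy : (ℕ → ℚ) → Set
IsCauchy s = ∀ ε → 0ℚ ℚ.< ε →
  Σ[ N ∈ ℕ ] (∀ m n → N ℕ.≤ m → N ℕ.≤ n → s m ≈[ ε ] s n)

record ℝ : Set where
  constructor real
  field
    seq    : ℕ → ℚ
    cauchy : IsCauchy seq

open ℝ

-- Reals are compared by this equivalence relation, never by _≡_.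
_≈ℝ_ : ℝ → ℝ → Set
x ≈ℝ y = ∀ ε → 0ℚ ℚ.< ε →
  Σ[ N ∈ ℕ ] (∀ n → N ℕ.≤ n → seq x n ≈[ ε ] seq y n)

EventuallyBounded : (ℕ → ℚ) → ℚ → Set
EventuallyBounded s B =
  Σ[ N ∈ ℕ ] (∀ n → N ℕ.≤ n → ℚ.∣ s n ∣ ℚ.≤ B)

Bounded : (ℕ → ℚ) → Set
Bounded s = Σ[ B ∈ ℚ ] (0ℚ ℚ.< B × EventuallyBounded s B)

CloseFrom : ℕ → (ℕ → ℚ) → ℚ → Set
CloseFrom N s ε = ∀ m n → N ℕ.≤ m → N ℕ.≤ n → s m ≈[ ε ] s n

-- Opaque: only the types of these proofs matter, and unfolding them inside
-- a real number is expensive.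
abstract

  self-close : ∀ q {ε} → 0ℚ ℚ.< ε → q ≈[ ε ] q
  self-close q {ε} 0<ε =
    subst (ℚ._< ε) (cong ℚ.∣_∣ (sym (ℚ.+-inverseʳ q))) 0<ε

  half-pos : ∀ {ε} → 0ℚ ℚ.< ε → 0ℚ ℚ.< ½ ℚ.* ε
  half-pos {ε} 0<ε =
    subst (ℚ._< ½ ℚ.* ε) (ℚ.*-zeroʳ ½) (ℚ.*-monoʳ-<-pos ½ 0<ε)

  halves : ∀ ε → ½ ℚ.* ε ℚ.+ ½ ℚ.* ε ≡ ε
  halves ε = trans (sym (ℚ.*-distribʳ-+ ε ½ ½)) (ℚ.*-identityˡ ε)

  +-close : ∀ a a′ b b′ {ε} → a ≈[ ½ ℚ.* ε ] a′ → b ≈[ ½ ℚ.* ε ] b′ →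
            (a ℚ.+ b) ≈[ ε ] (a′ ℚ.+ b′)
  +-close a a′ b b′ {ε} p q =
    subst₂ (λ l u → ℚ.∣ l ∣ ℚ.< u) (sym rearrange) (halves ε)
      (ℚ.≤-<-trans (ℚ.∣p+q∣≤∣p∣+∣q∣ (a ℚ.- a′) (b ℚ.- b′)) (ℚ.+-mono-< p q))
    where
    open +-*-Solver
    rearrange : (a ℚ.+ b) ℚ.- (a′ ℚ.+ b′) ≡ (a ℚ.- a′) ℚ.+ (b ℚ.- b′)
    rearrange = solve 4 (λ a a′ b b′ →
      (a :+ b) :- (a′ :+ b′) := (a :- a′) :+ (b :- b′)) refl a a′ b b′

  neg-close : ∀ a a′ {ε} → a ≈[ ε ] a′ → (ℚ.- a) ≈[ ε ] (ℚ.- a′)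
  neg-close a a′ {ε} p =
    subst (ℚ._< ε)
      (trans (sym (ℚ.∣-p∣≡∣p∣ (a ℚ.- a′)))
             (cong ℚ.∣_∣ (ℚ.neg-distrib-+ a (ℚ.- a′))))
      p

  -- ab - a′b′ = a(b - b′) + (a - a′)b′, with |a| and |b′| at most B
  *-close : ∀ a a′ b b′ {B δ} → 0ℚ ℚ.< B →
            ℚ.∣ a ∣ ℚ.≤ B → ℚ.∣ b′ ∣ ℚ.≤ B →
            a ≈[ δ ] a′ → b ≈[ δ ] b′ →
            (a ℚ.* b) ≈[ B ℚ.* δ ℚ.+ B ℚ.* δ ] (a′ ℚ.* b′)
  *-close a a′ b b′ {B} {δ} 0<B a≤B b′≤B p q =
    subst (λ l → ℚ.∣ l ∣ ℚ.< B ℚ.* δ ℚ.+ B ℚ.* δ) (sym rearrange)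
      (ℚ.≤-<-trans
        (ℚ.∣p+q∣≤∣p∣+∣q∣ (a ℚ.* (b ℚ.- b′)) (b′ ℚ.* (a ℚ.- a′)))
        (ℚ.+-mono-< (bound a (b ℚ.- b′) a≤B q) (bound b′ (a ℚ.- a′) b′≤B p)))
    where
    open +-*-Solver
    factor : ∀ u v w → u ℚ.* v ℚ.- u ℚ.* w ≡ u ℚ.* (v ℚ.- w)
    factor u v w = trans (cong (u ℚ.* v ℚ.+_) (ℚ.neg-distribʳ-* u w))
                         (sym (ℚ.*-distribˡ-+ u v (ℚ.- w)))
    telescope : ∀ p q r → p ℚ.- r ≡ (p ℚ.- q) ℚ.+ (q ℚ.- r)
    telescope = solve 3 (λ p q r → p :- r := (p :- q) :+ (q :- r)) refl
    rearrange : a ℚ.* b ℚ.- a′ ℚ.* b′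
              ≡ a ℚ.* (b ℚ.- b′) ℚ.+ b′ ℚ.* (a ℚ.- a′)
    rearrange = trans (telescope (a ℚ.* b) (a ℚ.* b′) (a′ ℚ.* b′))
      (cong₂ ℚ._+_ (factor a b b′)
        (trans (cong₂ ℚ._-_ (ℚ.*-comm a b′) (ℚ.*-comm a′ b′))
               (factor b′ a a′)))
    bound : ∀ u v → ℚ.∣ u ∣ ℚ.≤ B → ℚ.∣ v ∣ ℚ.< δ → ℚ.∣ u ℚ.* v ∣ ℚ.< B ℚ.* δ
    bound u v u≤B v<δ = subst (ℚ._< B ℚ.* δ) (sym (ℚ.∣p*q∣≡∣p∣*∣q∣ u v))
      (ℚ.≤-<-trans
        (ℚ.*-monoʳ-≤-nonNeg ℚ.∣ v ∣ {{ℚ.nonNegative (ℚ.0≤∣p∣ v)}} u≤B)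
        (ℚ.*-monoʳ-<-pos B {{ℚ.positive 0<B}} v<δ))

  nonNeg<+1 : ∀ {p} → 0ℚ ℚ.≤ p → 0ℚ ℚ.< 1ℚ ℚ.+ p
  nonNeg<+1 0≤p = ℚ.+-mono-<-≤ (ℚ.positive⁻¹ 1ℚ) 0≤p

  cauchy⇒bounded : ∀ {s} → IsCauchy s → Bounded s
  cauchy⇒bounded {s} c with c 1ℚ (ℚ.positive⁻¹ 1ℚ)
  ... | N , close =
    1ℚ ℚ.+ ℚ.∣ s N ∣ , nonNeg<+1 (ℚ.0≤∣p∣ (s N)) , N , λ n N≤n →
      subst (λ l → ℚ.∣ l ∣ ℚ.≤ 1ℚ ℚ.+ ℚ.∣ s N ∣) (split (s n) (s N))
        (ℚ.≤-trans (ℚ.∣p+q∣≤∣p∣+∣q∣ (s n ℚ.- s N) (s N))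
          (ℚ.+-monoˡ-≤ ℚ.∣ s N ∣ (ℚ.<⇒≤ (close n N N≤n ℕ.≤-refl))))
    where
    open +-*-Solver
    split : ∀ a b → (a ℚ.- b) ℚ.+ b ≡ a
    split = solve 2 (λ a b → (a :- b) :+ b := a) refl

  shrink : ∀ B ε → 0ℚ ℚ.< B → 0ℚ ℚ.< ε →
           Σ[ δ ∈ ℚ ] (0ℚ ℚ.< δ × B ℚ.* δ ℚ.+ B ℚ.* δ ≡ ε)
  shrink B ε 0<B 0<ε = B⁻¹ ℚ.* (½ ℚ.* ε) , 0<δ ,
    trans (cong₂ ℚ._+_ cancel cancel) (halves ε)
    where
    instance
      B-pos : ℚ.Positive B
      B-pos = ℚ.positive 0<B
      B-nonZero : ℚ.NonZero B
      B-nonZero = ℚ.pos⇒nonZero B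
    B⁻¹ : ℚ
    B⁻¹ = ℚ.1/ B
    0<δ : 0ℚ ℚ.< B⁻¹ ℚ.* (½ ℚ.* ε)
    0<δ = subst (ℚ._< B⁻¹ ℚ.* (½ ℚ.* ε)) (ℚ.*-zeroʳ B⁻¹)
      (ℚ.*-monoʳ-<-pos B⁻¹ {{ℚ.1/pos⇒pos B}} (half-pos 0<ε))
    cancel : B ℚ.* (B⁻¹ ℚ.* (½ ℚ.* ε)) ≡ ½ ℚ.* ε
    cancel = trans (sym (ℚ.*-assoc B B⁻¹ (½ ℚ.* ε)))
      (trans (cong (ℚ._* (½ ℚ.* ε)) (ℚ.*-inverseʳ B))
             (ℚ.*-identityˡ (½ ℚ.* ε)))

  ⊔₁ : ∀ {m n o} → m ℕ.⊔ n ℕ.≤ o → m ℕ.≤ o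
  ⊔₁ {m} {n} = ℕ.≤-trans (ℕ.m≤m⊔n m n)

  ⊔₂ : ∀ {m n o} → m ℕ.⊔ n ℕ.≤ o → n ℕ.≤ o
  ⊔₂ {m} {n} = ℕ.≤-trans (ℕ.m≤n⊔m m n)

  const-cauchy : ∀ q → IsCauchy (λ _ → q)
  const-cauchy q ε 0<ε = 0 , λ _ _ _ _ → self-close q 0<ε

  +-cauchy : ∀ {s t} → IsCauchy s → IsCauchy t →
             IsCauchy (λ n → s n ℚ.+ t n)
  +-cauchy {s} {t} c d ε 0<ε with c (½ ℚ.* ε) (half-pos 0<ε)
                                | d (½ ℚ.* ε) (half-pos 0<ε)
  ... | M , closeₛ | N , closeₜ = M ℕ.⊔ N , λ m n m≥ n≥ →
    +-close (s m) (s n) (t m) (t n)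
      (closeₛ m n (⊔₁ m≥) (⊔₁ n≥))
      (closeₜ m n (⊔₂ {M} m≥) (⊔₂ {M} n≥))

  neg-cauchy : ∀ {s} → IsCauchy s → IsCauchy (λ n → ℚ.- s n)
  neg-cauchy {s} c ε 0<ε with c ε 0<ε
  ... | N , close = N , λ m n m≥ n≥ → neg-close (s m) (s n) (close m n m≥ n≥)

  weaken : ∀ {s A B} → A ℚ.≤ B → EventuallyBounded s A → EventuallyBounded s B
  weaken A≤B (N , s≤A) = N , λ n N≤n → ℚ.≤-trans (s≤A n N≤n) A≤B

  *-closeFrom : ∀ {s t} B δ → 0ℚ ℚ.< B →
    EventuallyBounded s B → EventuallyBounded t B →
    Σ[ N ∈ ℕ ] CloseFrom N s δ → Σ[ N ∈ ℕ ] CloseFrom N t δ →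
    Σ[ N ∈ ℕ ] CloseFrom N (λ n → s n ℚ.* t n) (B ℚ.* δ ℚ.+ B ℚ.* δ)
  *-closeFrom {s} {t} B δ 0<B (K , s≤B) (L , t≤B) (M , closeₛ) (N , closeₜ) =
    (K ℕ.⊔ L) ℕ.⊔ (M ℕ.⊔ N) , λ m n m≥ n≥ →
      *-close (s m) (s n) (t m) (t n) {B} {δ} 0<B
        (s≤B m (⊔₁ (⊔₁ m≥)))
        (t≤B n (⊔₂ {K} (⊔₁ n≥)))
        (closeₛ m n (⊔₁ (⊔₂ {K ℕ.⊔ L} m≥)) (⊔₁ (⊔₂ {K ℕ.⊔ L} n≥)))
        (closeₜ m n (⊔₂ {M} (⊔₂ {K ℕ.⊔ L} m≥)) (⊔₂ {M} (⊔₂ {K ℕ.⊔ L} n≥)))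

  common-bound : ∀ {s t} → Bounded s → Bounded t →
    Σ[ B ∈ ℚ ] (0ℚ ℚ.< B × EventuallyBounded s B × EventuallyBounded t B)
  common-bound {s} {t} (A , 0<A , s≤A) (B , 0<B , t≤B) =
    A ℚ.+ B , ℚ.+-mono-< 0<A 0<B , weaken {s} A≤A+B s≤A , weaken {t} B≤A+B t≤B
    where
    A≤A+B : A ℚ.≤ A ℚ.+ B
    A≤A+B = subst (ℚ._≤ A ℚ.+ B) (ℚ.+-identityʳ A)
      (ℚ.+-monoʳ-≤ A (ℚ.<⇒≤ 0<B))
    B≤A+B : B ℚ.≤ A ℚ.+ B
    B≤A+B = subst (ℚ._≤ A ℚ.+ B) (ℚ.+-identityˡ B)
      (ℚ.+-monoˡ-≤ B (ℚ.<⇒≤ 0<A))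

  *-cauchy : ∀ {s t} → IsCauchy s → IsCauchy t →
             IsCauchy (λ n → s n ℚ.* t n)
  *-cauchy {s} {t} c d ε 0<ε =
    combine (common-bound {s} {t} (cauchy⇒bounded {s} c) (cauchy⇒bounded {t} d))
    where
    Goal : ℚ → Set
    Goal η = Σ[ N ∈ ℕ ] CloseFrom N (λ n → s n ℚ.* t n) η
    rescale : ∀ B → 0ℚ ℚ.< B → EventuallyBounded s B → EventuallyBounded t B →
      Σ[ δ ∈ ℚ ] (0ℚ ℚ.< δ × B ℚ.* δ ℚ.+ B ℚ.* δ ≡ ε) → Goal ε
    rescale B 0<B s≤B t≤B (δ , 0<δ , total) = subst Goal total
      (*-closeFrom {s} {t} B δ 0<B s≤B t≤B (c δ 0<δ) (d δ 0<δ))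
    combine : Σ[ B ∈ ℚ ]
      (0ℚ ℚ.< B × EventuallyBounded s B × EventuallyBounded t B) → Goal ε
    combine (B , 0<B , s≤B , t≤B) =
      rescale B 0<B s≤B t≤B (shrink B ε 0<B 0<ε)

fromℚℝ : ℚ → ℝ
fromℚℝ q = real (λ _ → q) (const-cauchy q)

_+ℝ_ _*ℝ_ : ℝ → ℝ → ℝ
x +ℝ y = real (λ n → seq x n ℚ.+ seq y n)
              (+-cauchy {seq x} {seq y} (cauchy x) (cauchy y))
x *ℝ y = real (λ n → seq x n ℚ.* seq y n)
              (*-cauchy {seq x} {seq y} (cauchy x) (cauchy y))

-ℝ_ : ℝ → ℝ
-ℝ x = real (λ n → ℚ.- seq x n) (neg-cauchy {seq x} (cauchy x))

ℝ-rawRing : RawRing 0ℓ 0ℓ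
ℝ-rawRing = record
  { Carrier = ℝ
  ; _≈_     = _≈ℝ_
  ; _+_     = _+ℝ_
  ; _*_     = _*ℝ_
  ; -_      = -ℝ_
  ; 0#      = fromℚℝ 0ℚ
  ; 1#      = fromℚℝ 1ℚ
  }

------------------------------------------------------------------------
-- The complex numbers

record ℂ : Set where
  constructor _+i_
  field
    re im : ℝ

open ℂ

fromℝ : ℝ → ℂ
fromℝ x = x +i fromℚℝ 0ℚ

ℂ-rawRing : RawRing 0ℓ 0ℓ
ℂ-rawRing = record
  { Carrier = ℂ
  ; _≈_     = λ z w → re z ≈ℝ re w × im z ≈ℝ im w
  ; _+_     = λ z w → (re z +ℝ re w) +i (im z +ℝ im w)
  ; _*_     = λ z w → ((re z *ℝ re w) +ℝ (-ℝ (im z *ℝ im w)))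
                      +i ((re z *ℝ im w) +ℝ (im z *ℝ re w))
  ; -_      = λ z → (-ℝ re z) +i (-ℝ im z)
  ; 0#      = fromℝ (fromℚℝ 0ℚ)
  ; 1#      = fromℝ (fromℚℝ 1ℚ)
  }

------------------------------------------------------------------------
-- Vectors, matrices and 3-tensors

-- `fromℚ` is only needed for the factor 1/3! in the symmetric product.
module LinearAlgebra
  (R : RawRing 0ℓ 0ℓ) (fromℚ : ℚ → RawRing.Carrier R) where

  open RawRing R
  open RawSemiringDefinitions rawSemiring using (sum; _^_)

  infix  4 _≋ᵥ_ _≋_
  infixr 7 _·_

  Vect : ℕ → Set
  Vect = Vector Carrier

  Matrix : ℕ → Set
  Matrix n = Fin n → Fin n → Carrier

  Tensor : ℕ → Set
  Tensor n = Fin n → Fin n → Fin n → Carrier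

  _≋ᵥ_ : ∀ {n} → Vect n → Vect n → Set
  v ≋ᵥ w = ∀ i → v i ≈ w i

  _≋_ : ∀ {n} → Tensor n → Tensor n → Set
  S ≋ T = ∀ i j k → S i j k ≈ T i j k

  0ᵥ : ∀ {n} → Vect n
  0ᵥ _ = 0#

  NonZero : ∀ {n} → Vect n → Set
  NonZero v = ¬ (v ≋ᵥ 0ᵥ)

  combination : ∀ {m n} → Vector Carrier m → Vector (Vect n) m → Vect n
  combination c v j = sum (λ i → c i * v i j)

  LinearlyIndependent : ∀ {m n} → Vector (Vect n) m → Set
  LinearlyIndependent v = ∀ c → combination c v ≋ᵥ 0ᵥ → ∀ i → c i ≈ 0#

  span : ∀ {m n} → Vector (Vect n) m → Pred (Vect n) 0ℓ
  span v w = ∃ λ c → w ≋ᵥ combination c v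

  -- The bilinear pairing aᵀb: no complex conjugation.
  pairing : ∀ {n} → Vect n → Vect n → Carrier
  pairing a b = sum (λ i → a i * b i)

  infix 8 _⊥
  _⊥ : ∀ {n} → Pred (Vect n) 0ℓ → Pred (Vect n) 0ℓ
  (W ⊥) a = ∀ w → w ∈ W → pairing w a ≈ 0#

  _·_ : ∀ {n} → Matrix n → Vect n → Vect n
  (M · v) i = sum (λ j → M i j * v j)

  -- M - μ N
  pencil : ∀ {n} → Matrix n → Carrier → Matrix n → Matrix n
  pencil M μ N i j = M i j + - (μ * N i j)

  -- Laplace expansion along the first row.
  det : ∀ {n} → Matrix n → Carrier
  det {zero}  M = 1#
  det {suc n} M = sum (λ j →
    ((- 1#) ^ toℕ j) * (M zero j * det (λ i k → M (suc i) (punchIn j k))))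

  -- Adjacent transpositions generate the symmetric group on the indices.
  IsSymmetric : ∀ {n} → Tensor n → Set
  IsSymmetric T =
    ∀ i j k → (T i j k ≈ T j i k) × (T i j k ≈ T i k j)

  _⊗_⊗_ : ∀ {n} → Vect n → Vect n → Vect n → Tensor n
  (u ⊗ v ⊗ w) i j k = u i * v j * w k

  -- The symmetric product v₁v₂v₃, as a function of k ↦ vₖ.
  symProduct : ∀ {n} → (Fin 3 → Vect n) → Tensor n
  symProduct v i j k = fromℚ (+ 1 ℚ./ 6) *
    ( (v 0F ⊗ v 1F ⊗ v 2F) i j k
    + (v 0F ⊗ v 2F ⊗ v 1F) i j k
    + (v 1F ⊗ v 0F ⊗ v 2F) i j k
    + (v 1F ⊗ v 2F ⊗ v 0F) i j k
    + (v 2F ⊗ v 0F ⊗ v 1F) i j k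
    + (v 2F ⊗ v 1F ⊗ v 0F) i j k )

  ∑ₜ : ∀ {r n} → Vector (Tensor n) r → Tensor n
  ∑ₜ S i j k = sum (λ p → S p i j k)

  scale : ∀ {n} → Carrier → Tensor n → Tensor n
  scale c S i j k = c * S i j k

  contract : ∀ {n} → Tensor n → Vect n → Matrix n
  contract S f j k = sum (λ i → f i * S i j k)

  -- The set of members of a family, closed under ≋.
  ⟪_⟫ : ∀ {r n} → Vector (Tensor n) r → Pred (Tensor n) 0ℓ
  ⟪ S ⟫ U = ∃ λ i → U ≋ S i

------------------------------------------------------------------------
-- The Zariski topology and genericity

module Zariski (R : RawRing 0ℓ 0ℓ) where

  open RawRing R
  open Expression using (Expr)

  -- Polynomials in m variables enter only through the functions they
  -- define, so they are given by polynomial expressions.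
  evaluate : ∀ {m} → Expr Carrier m → Vector Carrier m → Carrier
  evaluate p v = Expression.Eval.⟦_⟧ R (λ c → c) p (toVec v)

  ZariskiClosed : ∀ {m} → Pred (Vector Carrier m) 0ℓ → Set₁
  ZariskiClosed {m} Z = Σ[ I ∈ Set ] Σ[ p ∈ (I → Expr Carrier m) ]
    (Z ≐ (λ v → ∀ i → evaluate (p i) v ≈ 0#))

  -- P holds for generic (f , g , ℓ) in the affine space (Rⁿ)³.
  Generic₃ : ∀ {n} → (P : (f g ℓ : Vector Carrier n) → Set) → Set₁
  Generic₃ {n} P = Σ[ Z ∈ Pred (Vector Carrier (n ℕ.+ (n ℕ.+ n))) 0ℓ ]
    ( ZariskiClosed Z
    × (∃ λ v → v ∉ Z)
    × (∀ f g ℓ → (f ++ g ++ ℓ) ∉ Z → P f g ℓ) )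

------------------------------------------------------------------------
-- The decomposition algorithm

-- Several steps leave a choice (the order of the eigenvalues, the scale
-- of an eigenvector, ...).  `perform a ∈ A ⟶ P` says that a step whose admissible
-- results form the type A can be carried out, and that P holds whichever
-- admissible result is picked.
infixr 2 Perform
Perform : (A : Set) → (A → Set) → Set
Perform A P = A × (∀ a → P a)

syntax Perform A (λ a → P) = perform a ∈ A ⟶ P

module Algorithm
  (R : RawRing 0ℓ 0ℓ) (fromℚ : ℚ → RawRing.Carrier R)
  {n} (r : ℕ) (T : LinearAlgebra.Tensor R fromℚ n)
  (f g ℓ : LinearAlgebra.Vect R fromℚ n) where

  open RawRing R
  open LinearAlgebra R fromℚ

  record Eigenpairs : Set where
    field
      value     : Fin (3 ℕ.* r) → Carrier
      vector    : Fin (3 ℕ.* r) → Vect n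
      distinct  : ∀ {p q} → value p ≈ value q → p ≡ q
      solutions : ∀ μ → det (pencil (contract T f) μ (contract T g)) ≈ 0#
                        ⇔ ∃ λ p → μ ≈ value p
      nonzero   : ∀ p → NonZero (vector p)
      kernel    : ∀ p → pencil (contract T f) (value p) (contract T g)
                        · vector p ≋ᵥ 0ᵥ

  -- A relabelling of the eigenpairs by pairs (i , k), such that the
  -- vectors not T_ℓ-orthogonal to x i k are exactly those in triple i.
  record Triples (E : Eigenpairs) : Set where
    open Eigenpairs E
    field
      label : (Fin r × Fin 3) ↔ Fin (3 ℕ.* r)

    x : Fin r → Fin 3 → Vect n
    x i k = vector (Inverse.to label (i , k))

    field
      partition : ∀ i k i′ k′ →
        (¬ (pairing (x i′ k′) (contract T ℓ · x i k) ≈ 0#)) ⇔ (i′ ≡ i)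

    h : Fin r → Fin 3 → Vect n
    h i k j = f j + - (value (Inverse.to label (i , k)) * g j)

    U : Fin r → Pred (Vect n) 0ℓ
    U i = span (λ k → contract T f · x i k)

  record Factors {E : Eigenpairs} (G : Triples E) : Set where
    open Triples G
    field
      a′      : Fin r → Fin 3 → Vect n
      nonzero : ∀ i k → NonZero (a′ i k)
      member  : ∀ i k →
        a′ i k ∈ (span (x i k ∷ []) ⊥ ∩ span (h i k ∷ []) ⊥ ∩ U i)

  record Coefficients {E : Eigenpairs} {G : Triples E} (F : Factors G)
    : Set where
    open Triples G
    open Factors F
    field
      c      : Fin r → Carrier
      system : ∀ i → contract T f · x i 0F
        ≋ᵥ (λ j → c i * (contract (symProduct (a′ i)) f · x i 0F) j)

    output : Fin r → Tensor n
    output i = scale (c i) (symProduct (a′ i))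

  Produces : Pred (Tensor n) 0ℓ → Set
  Produces S =
    perform E ∈ Eigenpairs ⟶
    perform G ∈ Triples E ⟶
    perform F ∈ Factors G ⟶
    perform C ∈ Coefficients F ⟶
    (⟪ Coefficients.output C ⟫ ≐ S)

------------------------------------------------------------------------
-- The base field

data BaseField : Set where
  reals complexes : BaseField

rawRing : BaseField → RawRing 0ℓ 0ℓ
rawRing reals     = ℝ-rawRing
rawRing complexes = ℂ-rawRing

fromℚ : (𝕂 : BaseField) → ℚ → RawRing.Carrier (rawRing 𝕂)
fromℚ reals     q = fromℚℝ q
fromℚ complexes q = fromℝ (fromℚℝ q)

toℂ : (𝕂 : BaseField) → RawRing.Carrier (rawRing 𝕂) → ℂ
toℂ reals     x = fromℝ x
toℂ complexes z = z

module ℂ-Space = LinearAlgebra ℂ-rawRing (fromℚ complexes)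

-- The algorithm is only ever run over ℂ.
ProducesOverℂ : ∀ {n} (r : ℕ) (T : ℂ-Space.Tensor n) (f g ℓ : ℂ-Space.Vect n) →
                Pred (ℂ-Space.Tensor n) 0ℓ → Set
ProducesOverℂ = Algorithm.Produces ℂ-rawRing (fromℚ complexes)

module Over (𝕂 : BaseField) where

  open LinearAlgebra (rawRing 𝕂) (fromℚ 𝕂) public
  open Zariski (rawRing 𝕂) public

  vectToℂ : ∀ {n} → Vect n → ℂ-Space.Vect n
  vectToℂ v i = toℂ 𝕂 (v i)

  tensorToℂ : ∀ {n} → Tensor n → ℂ-Space.Tensor n
  tensorToℂ S i j k = toℂ 𝕂 (S i j k)

module Submission where

-- Write y_ik = ⟨a_ik , x⟩ for a vector x, and φ, γ, ψ for these coordinates of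
-- f, g and ℓ.  The matrix of T_f in the basis a is block diagonal with one
-- 3 × 3 block per term, and the block of h = f - μg is invertible unless one of
-- its three coordinates φ_ik - μγ_ik vanishes.  Hence the eigenvalues are the
-- ratios φ_ik / γ_ik, and the eigenvector belonging to (i , k) is supported on
-- the i-th block, where it is proportional to (0 , P″ , P′) in the positions
-- k, k+1, k+2, the P being the 2 × 2 minors of the i-th blocks of φ and γ.
-- The T_ℓ-pairings of two such vectors vanish across blocks, and within a block
-- they are products of minors with ψ_k or with the 3 × 3 determinant of φ, γ
-- and ψ.  The vectors T_f x_ik span the i-th block, in which orthogonality to
-- x_ik and h_ik leaves only the line of a_ik; the scale is then fixed by T_f.
-- All the quantities that have to be nonzero multiply up to one polynomial in
-- (f , g , ℓ), which is nonzero where γ = 1, φ takes distinct nonzero values,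
-- and ψ = φ².

-- Every step of the algorithm is quantified over all admissible results, so each step has two
-- sides: a result exists, and every result leads to the same terms. An admissible result does not
-- refer to the vectors `a`: a returned labelling may permute the terms, and the factors within each
-- term. Instead of transporting the run, the proof relabels the decomposition to match it, which
-- changes no product; only runs labelled by roots then need analysis. Genericity concerns the base
-- field, while the run takes place over ℂ. The algebra is therefore done over an abstract field,
-- and the polynomial nonvanishing conditions are carried across an injective ring map. The block of
-- h is, up to the factor 1/6, the symmetric 3 × 3 matrix with zero diagonal and the coordinates of
-- h off it, of determinant twice their product. Minors appear because at μ = φ_k / γ_k the other
-- two coordinates of f - μg, multiplied by γ_k, are 2 × 2 minors, one of them negated. Determinants
-- are given by Laplace expansion alone, so the link between a vanishing determinant and a kernel is
-- derived from it through Cramer's rule. Excluded middle decides whether a scalar is zero.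

open import Defs
open import Algebra.Bundles using (CommutativeRing; RawRing)
import Algebra.Solver.Ring as RingSolver
open import Algebra.Solver.Ring.AlmostCommutativeRing
  using (fromCommutativeRing; _-Raw-AlmostCommutative⟶_)
open import Axiom.ExcludedMiddle using (ExcludedMiddle)
open import Data.Fin.Base
  using (Fin; zero; suc; toℕ; inject₁; punchIn; punchOut; remQuot; combine; _↑ˡ_; _↑ʳ_)
open import Data.Fin.Patterns using (0F; 1F; 2F)
open import Data.Fin.Permutation using (Permutation)
open import Data.Fin.Properties
  using (_≟_; suc-injective; punchIn-injective; punchInᵢ≢i; punchIn-punchOut;
         toℕ-inject₁; toℕ-injective; remQuot-combine; combine-remQuot; combine-injective)
open import Data.Integer.Base as ℤ using (ℤ; +_; -[1+_])
import Data.Integer.Properties as ℤ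
open import Data.Maybe.Base using (Maybe; just; nothing)
open import Data.Nat.Base as ℕ using (ℕ; zero; suc)
import Data.Nat.Coprimality as Coprimality
import Data.Nat.Properties as ℕ
open import Data.Product.Base
  using (Σ-syntax; ∃; _×_; _,_; proj₁; proj₂; swap; uncurry)
open import Data.Product.Properties using (≡-dec)
open import Data.Rational.Base as ℚ using (ℚ; 0ℚ; 1ℚ; ½)
import Data.Rational.Properties as ℚ
open import Data.Rational.Solver using (module +-*-Solver)
open import Data.Sum.Base using (_⊎_; inj₁; inj₂)
open import Data.Unit.Base using (⊤; tt)
open import Data.Vec.Functional using (Vector; insertAt; concat; _∷_; []; _++_)
open import Data.Vec.Functional.Properties
  using (insertAt-lookup; insertAt-punchIn; lookup-++ˡ; lookup-++ʳ)
open import Data.Vec.Properties using (lookup∘tabulate)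
open import Function.Base using (_∘_; id)
open import Function.Bundles
  using (_⇔_; mk⇔; mk↔ₛ′; module Equivalence; module Inverse)
open import Level using (0ℓ)
open import Relation.Binary.Definitions using (tri<; tri≈; tri>)
open import Relation.Binary.PropositionalEquality as ≡
  using (_≡_; _≢_; cong; cong₂; subst)
open import Relation.Binary.Structures using (IsEquivalence)
open import Relation.Nullary.Decidable using (yes; no; decidable-stable)
open import Relation.Nullary.Negation using (¬_; contradiction)
open import Relation.Unary using (_∈_; _≐_)

-- Integer coefficients have decidable equality, which lets the solver cancel
-- x - x in an arbitrary commutative ring.
module IntegerSolver (R : CommutativeRing 0ℓ 0ℓ) where

  open CommutativeRing R
  open import Algebra.Properties.Ring ring
  open import Algebra.Properties.AbelianGroup +-abelianGroup using (⁻¹-∙-comm)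
  open import Algebra.Properties.Semiring.Mult.TCOptimised semiring
    using (×1-homo-*) renaming (_×_ to _⋆_)
  open import Algebra.Properties.Monoid.Mult.TCOptimised +-monoid
    using (×-homo-+; 1+×)
  open import Relation.Binary.Reasoning.Setoid setoid

  ⟦_⟧ : ℤ → Carrier
  ⟦ + n      ⟧ = n ⋆ 1#
  ⟦ -[1+ n ] ⟧ = - (suc n ⋆ 1#)

  ⟦-⟧ : ∀ i → ⟦ ℤ.- i ⟧ ≈ - ⟦ i ⟧
  ⟦-⟧ (+ zero)   = sym -0#≈0#
  ⟦-⟧ (+ suc n)  = refl
  ⟦-⟧ -[1+ n ]   = sym (-‿involutive _)

  ⟦⊖⟧ : ∀ m n → ⟦ m ℤ.⊖ n ⟧ ≈ m ⋆ 1# - n ⋆ 1#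
  ⟦⊖⟧ zero    n       = trans (reflexive (cong ⟦_⟧ (ℤ.⊖-≤ {n = n} ℕ.z≤n)))
                          (trans (⟦-⟧ (+ n)) (sym (+-identityˡ _)))
  ⟦⊖⟧ (suc m) zero    = sym (trans (+-congˡ -0#≈0#) (+-identityʳ _))
  ⟦⊖⟧ (suc m) (suc n) = begin
    ⟦ suc m ℤ.⊖ suc n ⟧                    ≈⟨ reflexive (cong ⟦_⟧ (ℤ.[1+m]⊖[1+n]≡m⊖n m n)) ⟩
    ⟦ m ℤ.⊖ n ⟧                            ≈⟨ ⟦⊖⟧ m n ⟩
    m ⋆ 1# - n ⋆ 1#
      ≈⟨ +-congʳ (sym (trans (+-congʳ (-‿inverseʳ 1#)) (+-identityˡ _))) ⟩
    (1# - 1# + m ⋆ 1#) - n ⋆ 1#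
      ≈⟨ +-congʳ (trans (+-congʳ (+-comm _ _)) (trans (+-assoc _ _ _) (+-comm _ _))) ⟩
    (1# + m ⋆ 1# - 1#) - n ⋆ 1#            ≈⟨ +-assoc _ _ _ ⟩
    (1# + m ⋆ 1#) + (- 1# - n ⋆ 1#)        ≈⟨ +-congˡ (⁻¹-∙-comm _ _) ⟩
    (1# + m ⋆ 1#) - (1# + n ⋆ 1#)          ≈⟨ +-cong (1+× m 1#) (-‿cong (1+× n 1#)) ⟨
    suc m ⋆ 1# - suc n ⋆ 1#                ∎

  ⟦+⟧ : ∀ i j → ⟦ i ℤ.+ j ⟧ ≈ ⟦ i ⟧ + ⟦ j ⟧
  ⟦+⟧ (+ m)    (+ n)    = ×-homo-+ 1# m n
  ⟦+⟧ (+ m)    -[1+ n ] = ⟦⊖⟧ m (suc n)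
  ⟦+⟧ -[1+ m ] (+ n)    = trans (⟦⊖⟧ n (suc m)) (+-comm _ _)
  ⟦+⟧ -[1+ m ] -[1+ n ] = begin
    - (suc (suc (m ℕ.+ n)) ⋆ 1#)
      ≈⟨ -‿cong (reflexive (cong (_⋆ 1#) (≡.sym (cong suc (ℕ.+-suc m n))))) ⟩
    - ((suc m ℕ.+ suc n) ⋆ 1#)         ≈⟨ -‿cong (×-homo-+ 1# (suc m) (suc n)) ⟩
    - (suc m ⋆ 1# + suc n ⋆ 1#)        ≈⟨ ⁻¹-∙-comm _ _ ⟨
    - (suc m ⋆ 1#) - suc n ⋆ 1#        ∎

  ⟦+*⟧ : ∀ m j → ⟦ + m ℤ.* j ⟧ ≈ m ⋆ 1# * ⟦ j ⟧
  ⟦+*⟧ m (+ n)    = trans (reflexive (cong ⟦_⟧ (≡.sym (ℤ.pos-* m n)))) (×1-homo-* m n)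
  ⟦+*⟧ m -[1+ n ] = begin
    ⟦ + m ℤ.* -[1+ n ] ⟧        ≈⟨ reflexive (cong ⟦_⟧ (≡.sym (ℤ.neg-distribʳ-* (+ m) (+ suc n)))) ⟩
    ⟦ ℤ.- (+ m ℤ.* + suc n) ⟧   ≈⟨ ⟦-⟧ (+ m ℤ.* + suc n) ⟩
    - ⟦ + m ℤ.* + suc n ⟧       ≈⟨ -‿cong (⟦+*⟧ m (+ suc n)) ⟩
    - (m ⋆ 1# * suc n ⋆ 1#)     ≈⟨ -‿distribʳ-* _ _ ⟩
    m ⋆ 1# * - (suc n ⋆ 1#)     ∎

  ⟦*⟧ : ∀ i j → ⟦ i ℤ.* j ⟧ ≈ ⟦ i ⟧ * ⟦ j ⟧
  ⟦*⟧ (+ m)    j = ⟦+*⟧ m j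
  ⟦*⟧ -[1+ m ] j = begin
    ⟦ -[1+ m ] ℤ.* j ⟧          ≈⟨ reflexive (cong ⟦_⟧ (≡.sym (ℤ.neg-distribˡ-* (+ suc m) j))) ⟩
    ⟦ ℤ.- (+ suc m ℤ.* j) ⟧     ≈⟨ ⟦-⟧ (+ suc m ℤ.* j) ⟩
    - ⟦ + suc m ℤ.* j ⟧         ≈⟨ -‿cong (⟦+*⟧ (suc m) j) ⟩
    - (suc m ⋆ 1# * ⟦ j ⟧)      ≈⟨ -‿distribˡ-* _ _ ⟩
    - (suc m ⋆ 1#) * ⟦ j ⟧      ∎

  ℤ⟶R : ℤ.+-*-rawRing -Raw-AlmostCommutative⟶ fromCommutativeRing R
  ℤ⟶R = record
    { ⟦_⟧    = ⟦_⟧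
    ; +-homo = ⟦+⟧
    ; *-homo = ⟦*⟧
    ; -‿homo = ⟦-⟧
    ; 0-homo = refl
    ; 1-homo = refl
    }

  -- Sound but not complete: distinct integers may have the same image in positive characteristic,
  -- hence a `Maybe` and not a decision.
  same-image? : ∀ i j → Maybe (⟦ i ⟧ ≈ ⟦ j ⟧)
  same-image? i j with i ℤ.≟ j
  ... | yes i≡j = just (reflexive (cong ⟦_⟧ i≡j))
  ... | no  _   = nothing

  open RingSolver ℤ.+-*-rawRing (fromCommutativeRing R) ℤ⟶R same-image? public
    using (solve; con; _:+_; _:*_; _:-_; :-_; _:=_)

-- Determinants and kernels over a field

-- `scalar` is not asked to be a ring homomorphism. Its injectivity supplies enough distinct
-- elements for the generic point, and `six-sixths` ties the constant of the symmetric product to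
-- the ring and excludes characteristic 2.
record ScalarField : Set₁ where
  field
    commutativeRing : CommutativeRing 0ℓ 0ℓ
  open CommutativeRing commutativeRing public
  field
    1≉0              : ¬ (1# ≈ 0#)
    inverse          : ∀ x → ¬ (x ≈ 0#) → ∃ λ y → x * y ≈ 1#
    scalar           : ℚ → Carrier
    scalar-injective : ∀ {p q} → scalar p ≈ scalar q → p ≡ q
    scalar-0         : scalar 0ℚ ≈ 0#
    six-sixths       : (1# + 1# + 1# + 1# + 1# + 1#) * scalar (+ 1 ℚ./ 6) ≈ 1#

module FieldTheory (em : ExcludedMiddle 0ℓ) (K : ScalarField) where

  open ScalarField K public hiding (rawRing; zero)
  open IntegerSolver commutativeRing public
  open LinearAlgebra (ScalarField.rawRing K) scalar public
  open import Algebra.Properties.Ring ring public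
    using (-0#≈0#; -‿distribˡ-*; -‿distribʳ-*; -‿involutive)
  open import Algebra.Properties.Semiring.Sum semiring public
    using (sum; sum-cong-≋; sum-replicate-zero; sum-remove; ∑-distrib-+; ∑-comm;
           sum-permute; *-distribˡ-sum; *-distribʳ-sum)
  open import Algebra.Definitions.RawSemiring (RawRing.rawSemiring (ScalarField.rawRing K)) public
    using (_^_)
  open import Relation.Binary.Reasoning.Setoid setoid public

  stable : ∀ {P : Set} → ¬ ¬ P → P
  stable = decidable-stable em

  *-cancel : ∀ {x y} → x ≉ 0# → x * y ≈ 0# → y ≈ 0#
  *-cancel {x} {y} x≉0 xy≈0 = let x⁻¹ , xx⁻¹≈1 = inverse x x≉0 in begin
    y              ≈⟨ *-identityˡ y ⟨
    1# * y         ≈⟨ *-congʳ xx⁻¹≈1 ⟨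
    x * x⁻¹ * y    ≈⟨ solve 3 (λ x z y → x :* z :* y := z :* (x :* y)) refl x x⁻¹ y ⟩
    x⁻¹ * (x * y)  ≈⟨ *-congˡ xy≈0 ⟩
    x⁻¹ * 0#       ≈⟨ zeroʳ x⁻¹ ⟩
    0#             ∎

  *-nonzero : ∀ {x y} → x ≉ 0# → y ≉ 0# → x * y ≉ 0#
  *-nonzero x≉0 y≉0 xy≈0 = y≉0 (*-cancel x≉0 xy≈0)

  *-zeroˡ-≈ : ∀ {x} y → x ≈ 0# → x * y ≈ 0#
  *-zeroˡ-≈ y x≈0 = trans (*-congʳ x≈0) (zeroˡ y)

  *-zeroʳ-≈ : ∀ x {y} → y ≈ 0# → x * y ≈ 0#
  *-zeroʳ-≈ x y≈0 = trans (*-congˡ y≈0) (zeroʳ x)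

  +-zero-≈ : ∀ {x y} → x ≈ 0# → y ≈ 0# → x + y ≈ 0#
  +-zero-≈ x≈0 y≈0 = trans (+-cong x≈0 y≈0) (+-identityˡ 0#)

  -- Six is a sum of three twos, and six is invertible.
  1+1≉0 : 1# + 1# ≉ 0#
  1+1≉0 2≈0 = 1≉0 (begin
    1#                                    ≈⟨ six-sixths ⟨
    (1# + 1# + 1# + 1# + 1# + 1#) * s
      ≈⟨ *-congʳ (solve 1 (λ t → t :+ t :+ t :+ t :+ t :+ t := (t :+ t) :+ (t :+ t) :+ (t :+ t))
           refl 1#) ⟩
    ((1# + 1#) + (1# + 1#) + (1# + 1#)) * s
                                          ≈⟨ *-zeroˡ-≈ s (+-zero-≈ (+-zero-≈ 2≈0 2≈0) 2≈0) ⟩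
    0#                                    ∎)
    where
    s : Carrier
    s = scalar (+ 1 ℚ./ 6)

  sum-zero : ∀ {n} {f : Vector Carrier n} → (∀ i → f i ≈ 0#) → sum f ≈ 0#
  sum-zero {n} f≈0 = trans (sum-cong-≋ f≈0) (sum-replicate-zero n)

  sum-single : ∀ {n} {f : Vector Carrier n} i →
               (∀ j → j ≢ i → f j ≈ 0#) → sum f ≈ f i
  sum-single {suc n} {f} i f≈0 = begin
    sum f                        ≈⟨ sum-remove {i = i} f ⟩
    f i + sum (f ∘ punchIn i)    ≈⟨ +-congˡ (sum-zero (λ j → f≈0 _ (punchInᵢ≢i i j))) ⟩
    f i + 0#                     ≈⟨ +-identityʳ _ ⟩
    f i                          ∎

  sum-linear : ∀ {n} (f g : Vector Carrier n) α →
               sum (λ i → f i + α * g i) ≈ sum f + α * sum g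
  sum-linear f g α =
    trans (∑-distrib-+ f (λ i → α * g i)) (+-congˡ (sym (*-distribˡ-sum α g)))

  -- The shape of a Laplace expansion with two equal neighbouring columns: all terms vanish except
  -- those two, which cancel.
  sum-adjacent : ∀ {n} {f : Vector Carrier (suc n)} c →
                 (∀ j → j ≢ inject₁ c → j ≢ suc c → f j ≈ 0#) →
                 f (inject₁ c) + f (suc c) ≈ 0# → sum f ≈ 0#
  sum-adjacent {f = f} zero f≈0 pair≈0 = begin
    f zero + (f (suc zero) + _)    ≈⟨ +-assoc _ _ _ ⟨
    f zero + f (suc zero) + _      ≈⟨ +-zero-≈ pair≈0 (sum-zero λ j → f≈0 (suc (suc j)) (λ ()) (λ ())) ⟩
    0#                             ∎
  sum-adjacent (suc c) f≈0 pair≈0 = +-zero-≈ (f≈0 zero (λ ()) (λ ()))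
    (sum-adjacent c
      (λ j j≢c j≢c+1 → f≈0 (suc j) (j≢c ∘ suc-injective) (j≢c+1 ∘ suc-injective))
      pair≈0)

  unit : ∀ {n} → Fin n → Vect n
  unit c k with k ≟ c
  ... | yes _ = 1#
  ... | no  _ = 0#

  unit-same : ∀ {n} (c : Fin n) → unit c c ≈ 1#
  unit-same c with c ≟ c
  ... | yes _   = refl
  ... | no  c≢c = contradiction ≡.refl c≢c

  unit-other : ∀ {n} {c k : Fin n} → k ≢ c → unit c k ≈ 0#
  unit-other {c = c} {k} k≢c with k ≟ c
  ... | yes k≡c = contradiction k≡c k≢c
  ... | no  _   = refl

  -- The determinant as an alternating multilinear function of the columns

  Rectangle : ℕ → ℕ → Set
  Rectangle m n = Fin m → Fin n → Carrier

  minor : ∀ {m n} → Rectangle (suc m) (suc n) → Fin (suc n) → Rectangle m n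
  minor M j i k = M (suc i) (punchIn j k)

  det-cong : ∀ {n} {M N : Matrix n} → (∀ i j → M i j ≈ N i j) → det M ≈ det N
  det-cong {zero}          M≈N = refl
  det-cong {suc n} {M} {N} M≈N =
    sum-cong-≋ {x = λ j → (- 1#) ^ toℕ j * (M zero j * det (minor M j))} λ j →
    *-congˡ {(- 1#) ^ toℕ j} (*-cong (M≈N zero j) (det-cong λ i k → M≈N (suc i) (punchIn j k)))

  -- Stated as a relation between three matrices so that induction reaches the minors: deleting
  -- column `c` leaves equal minors, while any other minor keeps it at position `punchOut j≢c`.
  det-linear : ∀ {n} {M N P : Matrix n} c α →
               (∀ i j → j ≢ c → M i j ≈ N i j) → (∀ i j → j ≢ c → M i j ≈ P i j) →
               (∀ i → M i c ≈ N i c + α * P i c) →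
               det M ≈ det N + α * det P
  det-linear {suc n} {M} {N} {P} c α M≈N M≈P split =
    trans (sum-cong-≋ expand) (sum-linear (term N) (term P) α)
    where
    term : Matrix (suc n) → Fin (suc n) → Carrier
    term M j = (- 1#) ^ toℕ j * (M zero j * det (minor M j))

    expand : ∀ j → term M j ≈ term N j + α * term P j
    expand j with j ≟ c
    ... | yes ≡.refl = begin
      ε * (M zero j * det (minor M j))
        ≈⟨ *-congˡ (*-congʳ (split zero)) ⟩
      ε * ((N zero j + α * P zero j) * det (minor M j))
        ≈⟨ solve 5 (λ ε x α y d → ε :* ((x :+ α :* y) :* d) := ε :* (x :* d) :+ α :* (ε :* (y :* d)))
             refl ε (N zero j) α (P zero j) (det (minor M j)) ⟩
      ε * (N zero j * det (minor M j)) + α * (ε * (P zero j * det (minor M j)))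
        ≈⟨ +-cong (*-congˡ (*-congˡ (det-cong λ i k → M≈N (suc i) _ (punchInᵢ≢i j k))))
                  (*-congˡ (*-congˡ (*-congˡ (det-cong λ i k → M≈P (suc i) _ (punchInᵢ≢i j k))))) ⟩
      term N j + α * term P j ∎
      where
      ε : Carrier
      ε = (- 1#) ^ toℕ j
    ... | no j≢c = begin
      ε * (M zero j * det (minor M j))
        ≈⟨ *-congˡ (*-congˡ (det-linear {M = minor M j} {minor N j} {minor P j} c′ α
             (λ i k k≢c′ → M≈N (suc i) _ (other k k≢c′))
             (λ i k k≢c′ → M≈P (suc i) _ (other k k≢c′))
             (λ i → ≡.subst (λ x → M (suc i) x ≈ N (suc i) x + α * P (suc i) x)
                      (≡.sym (punchIn-punchOut j≢c)) (split (suc i))))) ⟩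
      ε * (M zero j * (det (minor N j) + α * det (minor P j)))
        ≈⟨ solve 5 (λ ε x α d e → ε :* (x :* (d :+ α :* e)) := ε :* (x :* d) :+ α :* (ε :* (x :* e)))
             refl ε (M zero j) α (det (minor N j)) (det (minor P j)) ⟩
      ε * (M zero j * det (minor N j)) + α * (ε * (M zero j * det (minor P j)))
        ≈⟨ +-cong (*-congˡ (*-congʳ (M≈N zero j j≢c)))
                  (*-congˡ (*-congˡ (*-congʳ (M≈P zero j j≢c)))) ⟩
      term N j + α * term P j ∎
      where
      ε : Carrier
      ε = (- 1#) ^ toℕ j
      c′ : Fin n
      c′ = punchOut j≢c
      other : ∀ k → k ≢ c′ → punchIn j k ≢ c
      other k k≢c′ eq = k≢c′ (punchIn-injective j k c′ (≡.trans eq (≡.sym (punchIn-punchOut j≢c))))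

  -- Deleting a third column leaves the two columns adjacent, so a minor again meets the hypothesis
  -- of `det-adjacent`.
  punchIn-adjacent : ∀ {n} (c : Fin (suc n)) j → j ≢ inject₁ c → j ≢ suc c →
    ∃ λ c′ → punchIn j (inject₁ c′) ≡ inject₁ c × punchIn j (suc c′) ≡ suc c
  punchIn-adjacent zero zero j≢c _ = contradiction ≡.refl j≢c
  punchIn-adjacent zero (suc zero) _ j≢c+1 = contradiction ≡.refl j≢c+1
  punchIn-adjacent {suc n} zero (suc (suc j)) _ _ = zero , ≡.refl , ≡.refl
  punchIn-adjacent (suc c) zero _ _ = c , ≡.refl , ≡.refl
  punchIn-adjacent {suc n} (suc c) (suc j) j≢c j≢c+1
    with c′ , eq , eq+1 ← punchIn-adjacent c j (j≢c ∘ cong suc) (j≢c+1 ∘ cong suc)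
    = suc c′ , cong suc eq , cong suc eq+1

  -- The minors at two neighbouring columns differ only in which of the two columns survives, and it
  -- survives at the same position.
  punchIn-inject₁-suc : ∀ {n} (c k : Fin n) →
    punchIn (inject₁ c) k ≡ punchIn (suc c) k ⊎
    (punchIn (inject₁ c) k ≡ suc c × punchIn (suc c) k ≡ inject₁ c)
  punchIn-inject₁-suc zero    zero    = inj₂ (≡.refl , ≡.refl)
  punchIn-inject₁-suc zero    (suc k) = inj₁ ≡.refl
  punchIn-inject₁-suc (suc c) zero    = inj₁ ≡.refl
  punchIn-inject₁-suc (suc c) (suc k) with punchIn-inject₁-suc c k
  ... | inj₁ eq          = inj₁ (cong suc eq)
  ... | inj₂ (eq₁ , eq₂) = inj₂ (cong suc eq₁ , cong suc eq₂)

  -- Other minors still contain both columns and vanish by induction. The remaining two minors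
  -- coincide and carry opposite signs; for columns further apart they would differ by a
  -- permutation, so this case comes before the general one.
  det-adjacent : ∀ {n} (M : Matrix (suc n)) c →
                 (∀ i → M i (inject₁ c) ≈ M i (suc c)) → det M ≈ 0#
  det-adjacent {suc n} M c equal = sum-adjacent c vanish cancel
    where
    vanish : ∀ j → j ≢ inject₁ c → j ≢ suc c →
             (- 1#) ^ toℕ j * (M zero j * det (minor M j)) ≈ 0#
    vanish j j≢c j≢c+1 with c′ , eq , eq+1 ← punchIn-adjacent c j j≢c j≢c+1 =
      *-zeroʳ-≈ _ (*-zeroʳ-≈ _ (det-adjacent (minor M j) c′ λ i →
        trans (reflexive (cong (M (suc i)) eq))
          (trans (equal (suc i)) (reflexive (cong (M (suc i)) (≡.sym eq+1))))))

    same-minor : ∀ i k → minor M (inject₁ c) i k ≈ minor M (suc c) i k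
    same-minor i k with punchIn-inject₁-suc c k
    ... | inj₁ eq = reflexive (cong (M (suc i)) eq)
    ... | inj₂ (eq₁ , eq₂) = trans (reflexive (cong (M (suc i)) eq₁))
      (trans (sym (equal (suc i))) (reflexive (cong (M (suc i)) (≡.sym eq₂))))

    cancel : (- 1#) ^ toℕ (inject₁ c) * (M zero (inject₁ c) * det (minor M (inject₁ c)))
           + (- 1#) ^ toℕ (suc c) * (M zero (suc c) * det (minor M (suc c))) ≈ 0#
    cancel = begin
      (- 1#) ^ toℕ (inject₁ c) * (M zero (inject₁ c) * det (minor M (inject₁ c))) + z
        ≈⟨ +-congʳ (*-cong (reflexive (cong ((- 1#) ^_) (toℕ-inject₁ c)))
             (*-cong (equal zero) (det-cong same-minor))) ⟩
      (- 1#) ^ toℕ c * x + (- 1#) * (- 1#) ^ toℕ c * x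
        ≈⟨ solve 2 (λ ε x → ε :* x :+ :- con (+ 1) :* ε :* x := con (+ 0)) refl ((- 1#) ^ toℕ c) x ⟩
      0# ∎
      where
      x z : Carrier
      x = M zero (suc c) * det (minor M (suc c))
      z = (- 1#) ^ toℕ (suc c) * x

  setColumn : ∀ {m n} → Rectangle m n → Fin n → Vect m → Rectangle m n
  setColumn M c u i j with j ≟ c
  ... | yes _ = u i
  ... | no  _ = M i j

  setColumn-same : ∀ {m n} (M : Rectangle m n) c u i → setColumn M c u i c ≈ u i
  setColumn-same M c u i with c ≟ c
  ... | yes _   = refl
  ... | no  c≢c = contradiction ≡.refl c≢c

  setColumn-other : ∀ {m n} (M : Rectangle m n) {c} u i {j} → j ≢ c → setColumn M c u i j ≈ M i j
  setColumn-other M {c} u i {j} j≢c with j ≟ c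
  ... | yes j≡c = contradiction j≡c j≢c
  ... | no  _   = refl

  setColumn-self : ∀ {m n} (M : Rectangle m n) c i j → setColumn M c (λ i → M i c) i j ≈ M i j
  setColumn-self M c i j with j ≟ c
  ... | yes ≡.refl = refl
  ... | no  _      = refl

  det-setColumn : ∀ {n} (M : Matrix n) c {u v w} α → (∀ i → u i ≈ v i + α * w i) →
    det (setColumn M c u) ≈ det (setColumn M c v) + α * det (setColumn M c w)
  det-setColumn M c {u} {v} {w} α split = det-linear c α
    (λ i j j≢c → trans (setColumn-other M u i j≢c) (sym (setColumn-other M v i j≢c)))
    (λ i j j≢c → trans (setColumn-other M u i j≢c) (sym (setColumn-other M w i j≢c)))
    (λ i → trans (setColumn-same M c u i) (trans (split i)
      (sym (+-cong (setColumn-same M c v i) (*-congˡ (setColumn-same M c w i))))))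

  -- A zero column `u` equals `u + (- 1#) * u`, so linearity gives d = d - d.
  det-setColumn-0 : ∀ {n} (M : Matrix n) c {u} → (∀ i → u i ≈ 0#) → det (setColumn M c u) ≈ 0#
  det-setColumn-0 M c {u} u≈0 = begin
    d
      ≈⟨ det-setColumn M c {u} {u} {u} (- 1#)
          (λ i → trans (u≈0 i) (sym (+-zero-≈ (u≈0 i) (*-zeroʳ-≈ _ (u≈0 i))))) ⟩
    d + (- 1#) * d  ≈⟨ solve 1 (λ d → d :+ (:- con (+ 1)) :* d := con (+ 0)) refl d ⟩
    0#              ∎
    where
    d : Carrier
    d = det (setColumn M c u)

  inject₁≢suc : ∀ {n} {c : Fin n} → inject₁ c ≢ suc c
  inject₁≢suc {c = suc c} eq = inject₁≢suc (suc-injective eq)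

  setPair : ∀ {n} → Matrix (suc n) → Fin n → (u v : Vect (suc n)) → Matrix (suc n)
  setPair M c u v = setColumn (setColumn M (suc c) v) (inject₁ c) u

  module _ {n} (M : Matrix (suc n)) (c : Fin n) where

    setPair-left : ∀ u v i → setPair M c u v i (inject₁ c) ≈ u i
    setPair-left u v = setColumn-same (setColumn M (suc c) v) (inject₁ c) u

    setPair-right : ∀ u v i → setPair M c u v i (suc c) ≈ v i
    setPair-right u v i =
      trans (setColumn-other (setColumn M (suc c) v) u i (inject₁≢suc {c = c} ∘ ≡.sym))
        (setColumn-same M (suc c) v i)

    setPair-other : ∀ u v i {j} → j ≢ inject₁ c → j ≢ suc c → setPair M c u v i j ≈ M i j
    setPair-other u v i j≢c j≢c+1 =
      trans (setColumn-other (setColumn M (suc c) v) u i j≢c) (setColumn-other M v i j≢c+1)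

    setPair-equal : ∀ u → det (setPair M c u u) ≈ 0#
    setPair-equal u =
      det-adjacent (setPair M c u u) c λ i → trans (setPair-left u u i) (sym (setPair-right u u i))

    det-setPairʳ : ∀ u v w → det (setPair M c u (λ i → v i + 1# * w i))
                             ≈ det (setPair M c u v) + 1# * det (setPair M c u w)
    det-setPairʳ u v w = det-linear (suc c) 1# (same _ v) (same _ w)
      λ i → trans (setPair-right u _ i)
              (sym (+-cong (setPair-right u v i) (*-congˡ (setPair-right u w i))))
      where
      same : ∀ v w i j → j ≢ suc c → setPair M c u v i j ≈ setPair M c u w i j
      same v w i j j≢c+1 with j ≟ inject₁ c
      ... | yes ≡.refl = refl
      ... | no  j≢c    = trans (setColumn-other M v i j≢c+1) (sym (setColumn-other M w i j≢c+1))

    -- Polarisation: the determinant with u + v in both columns vanishes, as do those with `u` twice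
    -- or `v` twice, and expanding it leaves the two mixed ones.
    det-setPair-swap : ∀ u v → det (setPair M c u v) ≈ - det (setPair M c v u)
    det-setPair-swap u v = begin
      p
        ≈⟨ solve 2 (λ p q → p
               := ((con (+ 0) :+ con (+ 1) :* p) :+ con (+ 1) :* (q :+ con (+ 1) :* con (+ 0))) :- q)
             refl p q ⟩
      ((0# + 1# * p) + 1# * (q + 1# * 0#)) - q
        ≈⟨ +-congʳ (+-cong (+-congʳ (setPair-equal u)) (*-congˡ (+-congˡ (*-congˡ (setPair-equal v))))) ⟨
      ((det (setPair M c u u) + 1# * p) + 1# * (q + 1# * det (setPair M c v v))) - q
        ≈⟨ +-congʳ (+-cong (det-setPairʳ u u v) (*-congˡ (det-setPairʳ v u v))) ⟨
      (det (setPair M c u u+v) + 1# * det (setPair M c v u+v)) - q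
        ≈⟨ +-congʳ (det-setColumn (setColumn M (suc c) u+v) (inject₁ c) 1# (λ _ → refl)) ⟨
      det (setPair M c u+v u+v) - q            ≈⟨ +-congʳ (setPair-equal u+v) ⟩
      0# - q                                   ≈⟨ +-identityˡ _ ⟩
      - q                                      ∎
      where
      p q : Carrier
      p = det (setPair M c u v)
      q = det (setPair M c v u)
      u+v : Vect (suc n)
      u+v i = u i + 1# * v i

  -- Induction on the number `d` of columns strictly between: an adjacent swap moves the right-hand
  -- column one place to the left and changes only the sign.
  det-equal-columns-< : ∀ {n} d {M : Matrix n} p q → toℕ q ≡ suc (d ℕ.+ toℕ p) →
                        (∀ i → M i p ≈ M i q) → det M ≈ 0#
  det-equal-columns-< d {M} p zero () _
  det-equal-columns-< {suc n} zero {M} p (suc c) q≡p+1 equal = det-adjacent M c λ i →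
    trans (reflexive (cong (M i) (≡.sym p≡c))) (equal i)
    where
    p≡c : p ≡ inject₁ c
    p≡c = toℕ-injective (≡.trans (≡.sym (ℕ.suc-injective q≡p+1)) (≡.sym (toℕ-inject₁ c)))
  det-equal-columns-< {suc n} (suc d) {M} p (suc c) q≡p+d+2 equal = begin
    det M                                                     ≈⟨ det-cong unchanged ⟨
    det (setPair M c (λ i → M i (inject₁ c)) λ i → M i (suc c))  ≈⟨ det-setPair-swap M c _ _ ⟩
    - det swapped
      ≈⟨ -‿cong (det-equal-columns-< d p (inject₁ c) (≡.trans (toℕ-inject₁ c) c≡p+d+1) equal′) ⟩
    - 0#                                                      ≈⟨ -0#≈0# ⟩
    0#                                                        ∎
    where
    swapped : Matrix (suc n)
    swapped = setPair M c (λ i → M i (suc c)) λ i → M i (inject₁ c)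
    c≡p+d+1 : toℕ c ≡ suc (d ℕ.+ toℕ p)
    c≡p+d+1 = ℕ.suc-injective q≡p+d+2
    p<c : toℕ p ℕ.< toℕ c
    p<c = ≡.subst (toℕ p ℕ.<_) (≡.sym c≡p+d+1) (ℕ.s≤s (ℕ.m≤n+m (toℕ p) d))
    unchanged : ∀ i j → setPair M c (λ i → M i (inject₁ c)) (λ i → M i (suc c)) i j ≈ M i j
    unchanged i j with j ≟ inject₁ c
    ... | yes ≡.refl = refl
    ... | no  _      = setColumn-self M (suc c) i j
    equal′ : ∀ i → swapped i p ≈ swapped i (inject₁ c)
    equal′ i = trans
      (setPair-other M c _ _ i
        (λ p≡c → ℕ.<⇒≢ p<c (≡.trans (cong toℕ p≡c) (toℕ-inject₁ c)))
        (λ p≡c+1 → ℕ.<⇒≢ (ℕ.m<n⇒m<1+n p<c) (cong toℕ p≡c+1)))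
      (trans (equal i) (sym (setPair-left M c _ _ i)))

  det-equal-columns : ∀ {n} {M : Matrix n} {p q} → p ≢ q →
                      (∀ i → M i p ≈ M i q) → det M ≈ 0#
  det-equal-columns {p = p} {q} p≢q equal with ℕ.<-cmp (toℕ p) (toℕ q)
  ... | tri< p<q _ _ = let d , eq = ℕ.m≤n⇒∃[o]m+o≡n p<q in
    det-equal-columns-< d p q (≡.trans (≡.sym eq) (cong suc (ℕ.+-comm (toℕ p) d))) equal
  ... | tri≈ _ p≡q _ = contradiction (toℕ-injective p≡q) p≢q
  ... | tri> _ _ q<p = let d , eq = ℕ.m≤n⇒∃[o]m+o≡n q<p in
    det-equal-columns-< d q p (≡.trans (≡.sym eq) (cong suc (ℕ.+-comm (toℕ q) d))) (sym ∘ equal)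

  det-setColumn-sum : ∀ {n m} (M : Matrix n) c (v : Fin m → Vect n) (y : Fin m → Carrier) →
    det (setColumn M c (λ i → sum λ j → v j i * y j)) ≈ sum (λ j → y j * det (setColumn M c (v j)))
  det-setColumn-sum {m = zero}  M c v y = det-setColumn-0 M c (λ _ → refl)
  det-setColumn-sum {m = suc m} M c v y = begin
    det (setColumn M c (λ i → sum λ j → v j i * y j))
      ≈⟨ det-setColumn M c {v = λ i → sum λ j → v (suc j) i * y (suc j)} {w = v zero} (y zero)
           (λ i → trans (+-comm _ _) (+-congˡ (*-comm _ _))) ⟩
    det (setColumn M c (λ i → sum λ j → v (suc j) i * y (suc j))) + y zero * det (setColumn M c (v zero))
      ≈⟨ +-comm _ _ ⟩
    y zero * det (setColumn M c (v zero)) + det (setColumn M c (λ i → sum λ j → v (suc j) i * y (suc j)))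
      ≈⟨ +-congˡ (det-setColumn-sum M c (v ∘ suc) (y ∘ suc)) ⟩
    sum (λ j → y j * det (setColumn M c (v j))) ∎

  -- M y is a combination of the columns of M. Put into column `c`, each column but the c-th
  -- produces a repetition.
  cramer : ∀ {n} (M : Matrix n) c y → det (setColumn M c (M · y)) ≈ y c * det M
  cramer M c y = begin
    det (setColumn M c (M · y))
      ≈⟨ det-setColumn-sum M c (λ j i → M i j) y ⟩
    sum (λ j → y j * det (setColumn M c (λ i → M i j)))
      ≈⟨ sum-single c (λ j j≢c → *-zeroʳ-≈ (y j) (repeated j j≢c)) ⟩
    y c * det (setColumn M c (λ i → M i c))
      ≈⟨ *-congˡ (det-cong (setColumn-self M c)) ⟩
    y c * det M                                                 ∎
    where
    repeated : ∀ j → j ≢ c → det (setColumn M c (λ i → M i j)) ≈ 0#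
    repeated j j≢c = det-equal-columns j≢c λ i →
      trans (setColumn-other M _ i j≢c) (sym (setColumn-same M c _ i))

  -- Kernels of singular and of wide matrices, and spanning

  Kernel : ∀ {m n} → Rectangle m n → Set
  Kernel {m} {n} M = Σ[ x ∈ Vect n ] ((∃ λ c → x c ≉ 0#) × (∀ i → sum (λ j → M i j * x j) ≈ 0#))

  -- Cramer's rule divides by a coordinate of the kernel vector, which is why `Kernel` names a
  -- nonzero one.
  kernel⇒det≈0 : ∀ {n} {M : Matrix n} → Kernel M → det M ≈ 0#
  kernel⇒det≈0 {M = M} (x , (c , x≉0) , Mx≈0) =
    *-cancel x≉0 (trans (sym (cramer M c x)) (det-setColumn-0 M c Mx≈0))

  sum-insert : ∀ {m n} (M : Rectangle m (suc n)) p (z : Vect n) i →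
    sum (λ j → M i j * insertAt z p 0# j) ≈ sum (λ k → M i (punchIn p k) * z k)
  sum-insert M p z i = begin
    sum (λ j → M i j * insertAt z p 0# j)
      ≈⟨ sum-remove {i = p} (λ j → M i j * insertAt z p 0# j) ⟩
    M i p * insertAt z p 0# p + sum (λ k → M i (punchIn p k) * insertAt z p 0# (punchIn p k))
      ≈⟨ +-cong (*-zeroʳ-≈ _ (reflexive (insertAt-lookup z p 0#)))
                (sum-cong-≋ λ k → *-congˡ (reflexive (insertAt-punchIn z p 0# k))) ⟩
    0# + sum (λ k → M i (punchIn p k) * z k)
      ≈⟨ +-identityˡ _ ⟩
    sum (λ k → M i (punchIn p k) * z k) ∎

  -- Two kernel vectors of the lower rows, one of them vanishing at p and the
  -- other not, have a nonzero combination orthogonal to the first row.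
  minor-kernels⇒kernel : ∀ {m n} (M : Rectangle (suc m) (suc (suc n))) →
                         (∀ j → Kernel (minor M j)) → Kernel M
  minor-kernels⇒kernel M kernels with kernels zero
  -- The second deleted column is the one where `y`, padded by a zero in front, is nonzero; the
  -- other kernel vector is padded by zero exactly there.
  ... | y , (c , y≉0) , My≈0 with kernels (suc c)
  ... | z , (d , z≉0) , Mz≈0 = choose em
    where
    p : Fin _
    p = suc c
    ŷ ẑ : Vect _
    ŷ = insertAt y zero 0#
    ẑ = insertAt z p 0#
    ẑd≉0 : ẑ (punchIn p d) ≉ 0#
    ẑd≉0 eq = z≉0 (trans (reflexive (≡.sym (insertAt-punchIn z p 0# d))) eq)
    α β : Carrier
    α = sum (λ j → M zero j * ẑ j)
    β = - sum (λ j → M zero j * ŷ j)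
    Mẑ≈0 : ∀ i → sum (λ j → M (suc i) j * ẑ j) ≈ 0#
    Mẑ≈0 i = trans (sum-insert M p z (suc i)) (Mz≈0 i)
    Mŷ≈0 : ∀ i → sum (λ j → M (suc i) j * ŷ j) ≈ 0#
    Mŷ≈0 i = trans (sum-insert M zero y (suc i)) (My≈0 i)
    w : Vect _
    w j = α * ŷ j + β * ẑ j
    row : ∀ i → sum (λ j → M i j * w j)
              ≈ α * sum (λ j → M i j * ŷ j) + β * sum (λ j → M i j * ẑ j)
    row i = begin
      sum (λ j → M i j * w j)
        ≈⟨ sum-cong-≋ (λ j → solve 5 (λ m α y β z → m :* (α :* y :+ β :* z)
               := α :* (m :* y) :+ β :* (m :* z))
             refl (M i j) α (ŷ j) β (ẑ j)) ⟩
      sum (λ j → α * (M i j * ŷ j) + β * (M i j * ẑ j))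
        ≈⟨ sum-linear (λ j → α * (M i j * ŷ j)) (λ j → M i j * ẑ j) β ⟩
      sum (λ j → α * (M i j * ŷ j)) + β * sum (λ j → M i j * ẑ j)
        ≈⟨ +-congʳ (sym (*-distribˡ-sum α (λ j → M i j * ŷ j))) ⟩
      α * sum (λ j → M i j * ŷ j) + β * sum (λ j → M i j * ẑ j) ∎
    choose : _ → Kernel M
    choose (yes α≈0) = ẑ , (punchIn p d , ẑd≉0) , λ where
      zero    → α≈0
      (suc i) → Mẑ≈0 i
    choose (no α≉0) = w , (p , wp≉0) , λ where
        zero    → trans (row zero) (solve 2 (λ a s → a :* s :+ (:- s) :* a
               := con (+ 0)) refl α (sum (λ j → M zero j * ŷ j)))
        (suc i) → trans (row (suc i)) (+-zero-≈ (*-zeroʳ-≈ α (Mŷ≈0 i)) (*-zeroʳ-≈ β (Mẑ≈0 i)))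
      where
      wp≉0 : w p ≉ 0#
      wp≉0 eq = *-nonzero α≉0 y≉0 (begin
        α * y c                 ≈⟨ +-identityʳ _ ⟨
        α * y c + 0#            ≈⟨ +-congˡ (*-zeroʳ-≈ β (reflexive (insertAt-lookup z p 0#))) ⟨
        α * y c + β * ẑ p       ≈⟨ eq ⟩
        0#                      ∎)

  -- Deleting a row and any column preserves the excess of one column, so every minor has a kernel
  -- by induction.
  wide⇒kernel : ∀ m (M : Rectangle m (suc m)) → Kernel M
  wide⇒kernel zero    M = (λ _ → 1#) , (zero , 1≉0) , λ ()
  wide⇒kernel (suc m) M = minor-kernels⇒kernel M (λ j → wide⇒kernel m (minor M j))

  -- Let x be in the kernel of the lower rows, and replace column c by M x: the
  -- determinant becomes ± (M x)₀ times the minor at c, and by Cramer's rule it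
  -- is x_c times det M.
  det≈0⇒kernel : ∀ {n} (M : Matrix n) → det M ≈ 0# → Kernel M
  det≈0⇒kernel {zero}  M det≈0 = contradiction det≈0 1≉0
  det≈0⇒kernel {suc n} M det≈0 with em {∃ λ c → det (minor M c) ≉ 0#}
  -- The empty minor has determinant 1, so a 1 × 1 matrix always has a nonvanishing minor.
  det≈0⇒kernel {suc zero}    M det≈0 | no none = contradiction (zero , 1≉0) none
  det≈0⇒kernel {suc (suc n)} M det≈0 | no none =
    minor-kernels⇒kernel M λ j → det≈0⇒kernel (minor M j) (stable λ d≉0 → none (j , d≉0))
  ... | yes (c , d≉0) with x , nonzero , lower ← wide⇒kernel n (λ i → M (suc i)) =
    x , nonzero , λ where
        zero    → *-cancel (*-nonzero (sign≉0 (toℕ c)) d≉0)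
            (trans (sym top) (trans (cramer M c x) (*-zeroʳ-≈ (x c) det≈0)))
        (suc i) → lower i
    where
    sign≉0 : ∀ k → (- 1#) ^ k ≉ 0#
    sign≉0 zero    = 1≉0
    sign≉0 (suc k) =
      *-nonzero (λ -1≈0 → 1≉0 (trans (sym (-‿involutive 1#)) (trans (-‿cong -1≈0) -0#≈0#))) (sign≉0 k)
    N : Matrix (suc n)
    N = setColumn M c (M · x)
    -- Below the first row, column `c` of `N` is zero, so a minor that retains it has a unit vector
    -- in its kernel.
    vanish : ∀ j → j ≢ c → (- 1#) ^ toℕ j * (N zero j * det (minor N j)) ≈ 0#
    vanish j j≢c =
      *-zeroʳ-≈ _ (*-zeroʳ-≈ _
          (kernel⇒det≈0 (unit c′ , (c′ , λ eq → 1≉0 (trans (sym (unit-same c′)) eq)) , λ i →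
      trans (sum-single c′ (λ k k≢c′ → *-zeroʳ-≈ _ (unit-other k≢c′)))
        (*-zeroˡ-≈ _ (trans (reflexive (cong (N (suc i)) (punchIn-punchOut j≢c)))
          (trans (setColumn-same M c (M · x) (suc i)) (lower i)))))))
      where
      c′ : Fin n
      c′ = punchOut j≢c
    top : det N ≈ (- 1#) ^ toℕ c * det (minor M c) * (M · x) zero
    top = begin
      det N
        ≈⟨ sum-single c vanish ⟩
      (- 1#) ^ toℕ c * (N zero c * det (minor N c))
        ≈⟨ *-congˡ (*-cong (setColumn-same M c (M · x) zero)
             (det-cong λ i k → setColumn-other M (M · x) (suc i) (punchInᵢ≢i c k))) ⟩
      (- 1#) ^ toℕ c * ((M · x) zero * det (minor M c))
        ≈⟨ solve 3 (λ ε m d → ε :* (m :* d) := ε :* d :* m)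
             refl ((- 1#) ^ toℕ c) ((M · x) zero) (det (minor M c)) ⟩
      (- 1#) ^ toℕ c * det (minor M c) * (M · x) zero ∎

  -- Placing `w` beside the n vectors gives a wide matrix, hence a nontrivial relation. Independence
  -- forces the coefficient of `w` to be nonzero, and dividing by it solves for `w`.
  independent⇒spanning : ∀ {n} (v : Vector (Vect n) n) → LinearlyIndependent v →
                         ∀ w → span v w
  independent⇒spanning {n} v independent w
    with x , (c , x≉0) , relation ← wide⇒kernel n (λ i j → (w ∷ v) j i)
    with em {x zero ≈ 0#}
  ... | yes x₀≈0 = contradiction (x≈0 c) x≉0
    where
    x≈0 : ∀ j → x j ≈ 0#
    x≈0 zero    = x₀≈0
    x≈0 (suc j) = independent (x ∘ suc) (λ i → begin
      sum (λ j → x (suc j) * v j i)              ≈⟨ sum-cong-≋ {n} (λ j → *-comm (x (suc j)) (v j i)) ⟩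
      sum (λ j → v j i * x (suc j))              ≈⟨ +-identityˡ _ ⟨
      0# + sum (λ j → v j i * x (suc j))         ≈⟨ +-congʳ (*-zeroʳ-≈ (w i) x₀≈0) ⟨
      w i * x zero + sum (λ j → v j i * x (suc j)) ≈⟨ relation i ⟩
      0#                                         ∎) j
  ... | no x₀≉0 with y , x₀y≈1 ← inverse (x zero) x₀≉0 =
    (λ j → - y * x (suc j)) , λ i → begin
      w i
        ≈⟨ *-identityʳ _ ⟨
      w i * 1#
        ≈⟨ *-congˡ x₀y≈1 ⟨
      w i * (x zero * y)
        ≈⟨ solve 4 (λ w x y s → w :* (x :* y)
               := y :* (w :* x :+ s) :+ (:- y) :* s) refl (w i) (x zero) y (sum λ j → v j i * x (suc j)) ⟩
      y * (w i * x zero + sum (λ j → v j i * x (suc j))) + - y * sum (λ j → v j i * x (suc j))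
        ≈⟨ +-cong (*-zeroʳ-≈ y (relation i)) (*-distribˡ-sum (- y) (λ j → v j i * x (suc j))) ⟩
      0# + sum (λ j → - y * (v j i * x (suc j)))
        ≈⟨ +-identityˡ _ ⟩
      sum (λ j → - y * (v j i * x (suc j)))
        ≈⟨ sum-cong-≋ (λ j → solve 3 (λ y v x → y :* (v :* x) := y :* x :* v)
             refl (- y) (v j i) (x (suc j))) ⟩
      sum (λ j → - y * x (suc j) * v j i) ∎

-- Symmetric products of three vectors

-- The cyclic order of the three factors. Formulas are written at `k`, `next k` and `prev k`, so one
-- identity covers all three positions, signs of minors included.
next prev : Fin 3 → Fin 3
next 0F = 1F
next 1F = 2F
next 2F = 0F
prev 0F = 2F
prev 1F = 0F
prev 2F = 1F

next-next : ∀ k → next (next k) ≡ prev k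
next-next 0F = ≡.refl
next-next 1F = ≡.refl
next-next 2F = ≡.refl

next-prev : ∀ k → next (prev k) ≡ k
next-prev 0F = ≡.refl
next-prev 1F = ≡.refl
next-prev 2F = ≡.refl

prev-next : ∀ k → prev (next k) ≡ k
prev-next 0F = ≡.refl
prev-next 1F = ≡.refl
prev-next 2F = ≡.refl

prev-prev : ∀ k → prev (prev k) ≡ next k
prev-prev 0F = ≡.refl
prev-prev 1F = ≡.refl
prev-prev 2F = ≡.refl

next≢ : ∀ k → next k ≢ k
next≢ 0F ()
next≢ 1F ()
next≢ 2F ()

prev≢ : ∀ k → prev k ≢ k
prev≢ 0F ()
prev≢ 1F ()
prev≢ 2F ()

prev≢next : ∀ k → prev k ≢ next k
prev≢next 0F ()
prev≢next 1F ()
prev≢next 2F ()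

rotations : ∀ k l → l ≡ k ⊎ (l ≡ next k ⊎ l ≡ prev k)
rotations 0F 0F = inj₁ ≡.refl
rotations 0F 1F = inj₂ (inj₁ ≡.refl)
rotations 0F 2F = inj₂ (inj₂ ≡.refl)
rotations 1F 0F = inj₂ (inj₂ ≡.refl)
rotations 1F 1F = inj₁ ≡.refl
rotations 1F 2F = inj₂ (inj₁ ≡.refl)
rotations 2F 0F = inj₂ (inj₁ ≡.refl)
rotations 2F 1F = inj₂ (inj₂ ≡.refl)
rotations 2F 2F = inj₁ ≡.refl

module TensorTheory (em : ExcludedMiddle 0ℓ) (K : ScalarField) where

  open FieldTheory em K public

  pairing-comm : ∀ {n} (u v : Vect n) → pairing u v ≈ pairing v u
  pairing-comm u v = sum-cong-≋ λ i → *-comm (u i) (v i)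

  pairing-congʳ : ∀ {n} (u : Vect n) {v w} → v ≋ᵥ w → pairing u v ≈ pairing u w
  pairing-congʳ u v≋w = sum-cong-≋ λ i → *-congˡ {u i} (v≋w i)

  pairing-zeroʳ : ∀ {n} (u : Vect n) {v} → v ≋ᵥ 0ᵥ → pairing u v ≈ 0#
  pairing-zeroʳ u v≋0 = sum-zero λ i → *-zeroʳ-≈ (u i) (v≋0 i)

  pairing-linearʳ : ∀ {n} (u v w : Vect n) α →
    pairing u (λ i → v i + α * w i) ≈ pairing u v + α * pairing u w
  pairing-linearʳ u v w α = trans
    (sum-cong-≋ λ i → solve 4 (λ u v α w → u :* (v :+ α :* w) := u :* v :+ α :* (u :* w))
         refl (u i) (v i) α (w i))
    (sum-linear (λ i → u i * v i) (λ i → u i * w i) α)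

  pairing-sumʳ : ∀ {m n} (u : Vect n) (c : Fin m → Carrier) (v : Fin m → Vect n) →
    pairing u (combination c v) ≈ sum (λ k → c k * pairing u (v k))
  pairing-sumʳ u c v = begin
    sum (λ i → u i * sum (λ k → c k * v k i))
      ≈⟨ sum-cong-≋ (λ i → *-distribˡ-sum (u i) (λ k → c k * v k i)) ⟩
    sum (λ i → sum (λ k → u i * (c k * v k i)))
      ≈⟨ ∑-comm (λ i k → u i * (c k * v k i)) ⟩
    sum (λ k → sum (λ i → u i * (c k * v k i)))
      ≈⟨ sum-cong-≋ (λ k → trans
           (sum-cong-≋ λ i → solve 3 (λ u c v → u :* (c :* v) := c :* (u :* v)) refl (u i) (c k) (v k i))
           (sym (*-distribˡ-sum (c k) (λ i → u i * v k i)))) ⟩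
    sum (λ k → c k * pairing u (v k)) ∎

  scalarMultiple : ∀ {n} → Carrier → Vect n → Vect n
  scalarMultiple α v i = α * v i

  pairing-scaleʳ : ∀ {n} (u : Vect n) α (v : Vect n) → pairing u (scalarMultiple α v) ≈ α * pairing u v
  pairing-scaleʳ u α v = trans
    (sum-cong-≋ λ i → solve 3 (λ u c v → u :* (c :* v) := c :* (u :* v)) refl (u i) α (v i))
    (sym (*-distribˡ-sum α (λ i → u i * v i)))

  sum₃ : ∀ k (F : Fin 3 → Carrier) → sum F ≈ F k + F (next k) + F (prev k)
  sum₃ 0F F = solve 3 (λ x y z → x :+ (y :+ (z :+ con (+ 0))) := x :+ y :+ z) refl (F 0F) (F 1F) (F 2F)
  sum₃ 1F F = solve 3 (λ x y z → x :+ (y :+ (z :+ con (+ 0))) := y :+ z :+ x) refl (F 0F) (F 1F) (F 2F)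
  sum₃ 2F F = solve 3 (λ x y z → x :+ (y :+ (z :+ con (+ 0))) := z :+ x :+ y) refl (F 0F) (F 1F) (F 2F)

  infixl 6 _⊞_
  _⊞_ : ∀ {n} → Tensor n → Tensor n → Tensor n
  (S ⊞ T) p q r = S p q r + T p q r

  module _ {n} (f x : Vect n) (j : Fin n) where

    -- With `f`, `x` and `j` fixed this is a linear functional of the tensor, so a sum of terms can
    -- be evaluated term by term.
    action : Tensor n → Carrier
    action S = (contract S f · x) j

    action-cong : ∀ {S T} → S ≋ T → action S ≈ action T
    action-cong S≋T = sum-cong-≋ λ q → *-congʳ {x q} (sum-cong-≋ λ p → *-congˡ {f p} (S≋T p j q))

    action-+ : ∀ S T → action (S ⊞ T) ≈ action S + action T
    action-+ S T = trans
      (sum-cong-≋ λ q → trans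
        (*-congʳ {x q} (trans
          (sum-cong-≋ λ p → distribˡ (f p) (S p j q) (T p j q))
          (∑-distrib-+ (λ p → f p * S p j q) (λ p → f p * T p j q))))
        (distribʳ (x q) (sum λ p → f p * S p j q) (sum λ p → f p * T p j q)))
      (∑-distrib-+ (λ q → contract S f j q * x q) (λ q → contract T f j q * x q))

    action-scale : ∀ c S → action (scale c S) ≈ c * action S
    action-scale c S = trans
      (sum-cong-≋ λ q → trans
        (*-congʳ {x q} (trans
          (sum-cong-≋ λ p → solve 3 (λ f c s → f :* (c :* s) := c :* (f :* s)) refl (f p) c (S p j q))
          (sym (*-distribˡ-sum c (λ p → f p * S p j q)))))
        (*-assoc c (contract S f j q) (x q)))
      (sym (*-distribˡ-sum c (λ q → contract S f j q * x q)))

    action-0 : ∀ {S} → (∀ p q r → S p q r ≈ 0#) → action S ≈ 0#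
    action-0 S≈0 = sum-zero λ q → *-zeroˡ-≈ (x q) (sum-zero λ p → *-zeroʳ-≈ (f p) (S≈0 p j q))

    action-∑ₜ : ∀ {r} (S : Fin r → Tensor n) → action (∑ₜ S) ≈ sum (λ i → action (S i))
    action-∑ₜ {zero}  S = action-0 λ p q r → refl
    action-∑ₜ {suc r} S = trans (action-+ (S zero) (∑ₜ (S ∘ suc))) (+-congˡ (action-∑ₜ (S ∘ suc)))

    action-⊗ : ∀ u v w → action (u ⊗ v ⊗ w) ≈ pairing u f * v j * pairing w x
    action-⊗ u v w = trans
      (sum-cong-≋ λ q → trans
        (*-congʳ {x q} (trans
          (sum-cong-≋ λ p → solve 4 (λ f u v w → f :* (u :* v :* w) := (v :* w) :* (u :* f))
               refl (f p) (u p) (v j) (w q))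
          (sym (*-distribˡ-sum (v j * w q) (λ p → u p * f p)))))
        (solve 4 (λ v w s x → v :* w :* s :* x := s :* v :* (w :* x))
             refl (v j) (w q) (pairing u f) (x q)))
      (sym (*-distribˡ-sum (pairing u f * v j) (λ q → w q * x q)))

  1/6 : Carrier
  1/6 = scalar (+ 1 ℚ./ 6)

  1/6≉0 : 1/6 ≉ 0#
  1/6≉0 s≈0 = 1≉0 (trans (sym six-sixths) (*-zeroʳ-≈ _ s≈0))

  -- Up to the factor 1/6, the matrix of (v₀v₁v₂)_f with respect to v₀, v₁, v₂,
  -- when h holds the coordinates of f.
  block : (h y : Fin 3 → Carrier) → Fin 3 → Carrier
  block h y m = h (next m) * y (prev m) + h (prev m) * y (next m)

  block-next : ∀ h y k → block h y (next k) ≡ h (prev k) * y k + h k * y (prev k)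
  block-next h y k rewrite next-next k | prev-next k = ≡.refl

  block-prev : ∀ h y k → block h y (prev k) ≡ h k * y (next k) + h (next k) * y k
  block-prev h y k rewrite next-prev k | prev-prev k = ≡.refl

  -- Elimination: writing B for the block and primes for `next` and `prev`, h′B′ + h″B″ - hB =
  -- 2h′h″y. Besides coordinates of f and of f - μg, the role of `h` is later taken by the minors
  -- `P`.
  block-injective : ∀ {h y} → (∀ k → h k ≉ 0#) → (∀ k → block h y k ≈ 0#) → ∀ k → y k ≈ 0#
  block-injective {h} {y} h≉0 B≈0 k =
    *-cancel 1+1≉0 (*-cancel (h≉0 (next k)) (*-cancel (h≉0 (prev k)) (begin
      h″ * (h′ * ((1# + 1#) * y k))
        ≈⟨ solve 6 (λ h h′ h″ y y′ y″ → h″ :* (h′ :* ((con (+ 1) :+ con (+ 1)) :* y))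
             := h′ :* (h″ :* y :+ h :* y″) :+ h″ :* (h :* y′ :+ h′ :* y) :+ (:- h) :*
                 (h′ :* y″ :+ h″ :* y′))
             refl (h k) h′ h″ (y k) (y (next k)) (y (prev k)) ⟩
      h′ * (h″ * y k + h k * y (prev k)) + h″ * (h k * y (next k) + h′ * y k) + - h k * block h y k
        ≈⟨ +-cong (+-cong (*-congˡ (reflexive (≡.sym (block-next h y k))))
            (*-congˡ (reflexive (≡.sym (block-prev h y k))))) refl ⟩
      h′ * block h y (next k) + h″ * block h y (prev k) + - h k * block h y k
        ≈⟨ +-zero-≈ (+-zero-≈ (*-zeroʳ-≈ h′ (B≈0 (next k))) (*-zeroʳ-≈ h″ (B≈0 (prev k))))
            (*-zeroʳ-≈ (- h k) (B≈0 k)) ⟩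
      0# ∎)))
    where
    h′ h″ : Carrier
    h′ = h (next k)
    h″ = h (prev k)

  block-zeroʳ : ∀ h {y} → (∀ k → y k ≈ 0#) → ∀ m → block h y m ≈ 0#
  block-zeroʳ h y≈0 m = +-zero-≈ (*-zeroʳ-≈ _ (y≈0 (prev m))) (*-zeroʳ-≈ _ (y≈0 (next m)))

  -- In each of the six products the first factor is paired with `f` and the last with `x`; the
  -- middle one keeps the free index. Grouping by middle factor gives the three coefficients.
  action-symProduct : ∀ {n} (v : Fin 3 → Vect n) (f x : Vect n) j →
    (contract (symProduct v) f · x) j
      ≈ combination (λ m → 1/6 * block (λ k → pairing (v k) f) (λ k → pairing (v k) x) m) v j
  action-symProduct v f x j = begin
    L (symProduct v)
      ≈⟨ action-scale f x j 1/6
          (t 0F 1F 2F ⊞ t 0F 2F 1F ⊞ t 1F 0F 2F ⊞ t 1F 2F 0F ⊞ t 2F 0F 1F ⊞ t 2F 1F 0F) ⟩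
    1/6 * L (t 0F 1F 2F ⊞ t 0F 2F 1F ⊞ t 1F 0F 2F ⊞ t 1F 2F 0F ⊞ t 2F 0F 1F ⊞ t 2F 1F 0F)
      ≈⟨ *-congˡ (split (t 0F 1F 2F ⊞ t 0F 2F 1F ⊞ t 1F 0F 2F ⊞ t 1F 2F 0F ⊞ t 2F 0F 1F) (t 2F 1F 0F)
                 (split (t 0F 1F 2F ⊞ t 0F 2F 1F ⊞ t 1F 0F 2F ⊞ t 1F 2F 0F) (t 2F 0F 1F)
                 (split (t 0F 1F 2F ⊞ t 0F 2F 1F ⊞ t 1F 0F 2F) (t 1F 2F 0F)
                 (split (t 0F 1F 2F ⊞ t 0F 2F 1F) (t 1F 0F 2F)
                 (split (t 0F 1F 2F) (t 0F 2F 1F) refl))))) ⟩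
    1/6 * (L (v 0F ⊗ v 1F ⊗ v 2F) + L (v 0F ⊗ v 2F ⊗ v 1F) + L (v 1F ⊗ v 0F ⊗ v 2F)
         + L (v 1F ⊗ v 2F ⊗ v 0F) + L (v 2F ⊗ v 0F ⊗ v 1F) + L (v 2F ⊗ v 1F ⊗ v 0F))
      ≈⟨ *-congˡ (+-cong (+-cong (+-cong (+-cong (+-cong
           (action-⊗ f x j (v 0F) (v 1F) (v 2F)) (action-⊗ f x j (v 0F) (v 2F) (v 1F)))
           (action-⊗ f x j (v 1F) (v 0F) (v 2F))) (action-⊗ f x j (v 1F) (v 2F) (v 0F)))
           (action-⊗ f x j (v 2F) (v 0F) (v 1F))) (action-⊗ f x j (v 2F) (v 1F) (v 0F))) ⟩
    1/6 * (h 0F * v 1F j * y 2F + h 0F * v 2F j * y 1F + h 1F * v 0F j * y 2F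
         + h 1F * v 2F j * y 0F + h 2F * v 0F j * y 1F + h 2F * v 1F j * y 0F)
      ≈⟨ solve 10 (λ s h₀ h₁ h₂ y₀ y₁ y₂ v₀ v₁ v₂ →
           s :* (h₀ :* v₁ :* y₂ :+ h₀ :* v₂ :* y₁ :+ h₁ :* v₀ :* y₂
                 :+ h₁ :* v₂ :* y₀ :+ h₂ :* v₀ :* y₁ :+ h₂ :* v₁ :* y₀)
           := (s :* (h₁ :* y₂ :+ h₂ :* y₁)) :* v₀
              :+ ((s :* (h₂ :* y₀ :+ h₀ :* y₂)) :* v₁
              :+ ((s :* (h₀ :* y₁ :+ h₁ :* y₀)) :* v₂ :+ con (+ 0))))
           refl 1/6 (h 0F) (h 1F) (h 2F) (y 0F) (y 1F) (y 2F) (v 0F j) (v 1F j) (v 2F j) ⟩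
    combination (λ m → 1/6 * block h y m) v j ∎
    where
    h y : Fin 3 → Carrier
    h k = pairing (v k) f
    y k = pairing (v k) x
    L : Tensor _ → Carrier
    L = action f x j
    t : (a b c : Fin 3) → Tensor _
    t a b c = v a ⊗ v b ⊗ v c
    split : ∀ S U {z} → L S ≈ z → L (S ⊞ U) ≈ z + L U
    split S U LS≈z = trans (action-+ f x j S U) (+-congʳ LS≈z)

  symProduct-cong : ∀ {n} {v w : Fin 3 → Vect n} → (∀ k → v k ≋ᵥ w k) → symProduct v ≋ symProduct w
  symProduct-cong v≋w p q r = *-congˡ (+-cong (+-cong (+-cong (+-cong (+-cong
    (term 0F 1F 2F) (term 0F 2F 1F)) (term 1F 0F 2F)) (term 1F 2F 0F)) (term 2F 0F 1F)) (term 2F 1F 0F))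
    where
    term : ∀ a b c → _
    term a b c = *-cong (*-cong (v≋w a p) (v≋w b q)) (v≋w c r)

  symProduct-scale : ∀ {n} (α : Fin 3 → Carrier) (v : Fin 3 → Vect n) →
    symProduct (λ k → scalarMultiple (α k) (v k)) ≋ scale (α 0F * α 1F * α 2F) (symProduct v)
  symProduct-scale α v p q r =
    trans (*-congˡ (+-cong (+-cong (+-cong (+-cong (+-cong
      (term 0F 1F 2F)
      (trans (term 0F 2F 1F) (*-congʳ (solve 3 (λ a b c → a :* c :* b := a :* b :* c)
           refl (α 0F) (α 1F) (α 2F)))))
      (trans (term 1F 0F 2F) (*-congʳ (solve 3 (λ a b c → b :* a :* c := a :* b :* c)
           refl (α 0F) (α 1F) (α 2F)))))
      (trans (term 1F 2F 0F) (*-congʳ (solve 3 (λ a b c → b :* c :* a := a :* b :* c)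
           refl (α 0F) (α 1F) (α 2F)))))
      (trans (term 2F 0F 1F) (*-congʳ (solve 3 (λ a b c → c :* a :* b := a :* b :* c)
           refl (α 0F) (α 1F) (α 2F)))))
      (trans (term 2F 1F 0F) (*-congʳ (solve 3 (λ a b c → c :* b :* a := a :* b :* c)
           refl (α 0F) (α 1F) (α 2F))))))
    (solve 8 (λ s A a b c d e f → s :* (A :* a :+ A :* b :+ A :* c :+ A :* d :+ A :* e :+ A :* f)
                 := A :* (s :* (a :+ b :+ c :+ d :+ e :+ f)))
       refl 1/6 (α 0F * α 1F * α 2F) ((v 0F ⊗ v 1F ⊗ v 2F) p q r) ((v 0F ⊗ v 2F ⊗ v 1F) p q r)
         ((v 1F ⊗ v 0F ⊗ v 2F) p q r) ((v 1F ⊗ v 2F ⊗ v 0F) p q r) ((v 2F ⊗ v 0F ⊗ v 1F) p q r)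
             ((v 2F ⊗ v 1F ⊗ v 0F) p q r))
    where
    term : ∀ a b c →
        (scalarMultiple (α a) (v a) ⊗ scalarMultiple (α b) (v b) ⊗ scalarMultiple (α c) (v c)) p q r
                   ≈ (α a * α b * α c) * (v a ⊗ v b ⊗ v c) p q r
    term a b c = solve 6 (λ α β γ u v w → (α :* u) :* (β :* v) :* (γ :* w)
           := (α :* β :* γ) :* (u :* v :* w))
      refl (α a) (α b) (α c) (v a p) (v b q) (v c r)

  -- Needed because a returned triple may list the factors in any order. The first nine clauses
  -- discard the tables of values that are not injective.
  symProduct-permute : ∀ {n} (v : Fin 3 → Vect n) (κ : Fin 3 → Fin 3) →
    (∀ {k l} → κ k ≡ κ l → k ≡ l) → symProduct (v ∘ κ) ≋ symProduct v
  symProduct-permute v κ inj p q r with κ 0F in κ₀ | κ 1F in κ₁ | κ 2F in κ₂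
  ... | 0F | 0F | _  with () ← inj (≡.trans κ₀ (≡.sym κ₁))
  ... | 1F | 1F | _  with () ← inj (≡.trans κ₀ (≡.sym κ₁))
  ... | 2F | 2F | _  with () ← inj (≡.trans κ₀ (≡.sym κ₁))
  ... | 0F | _  | 0F with () ← inj (≡.trans κ₀ (≡.sym κ₂))
  ... | 1F | _  | 1F with () ← inj (≡.trans κ₀ (≡.sym κ₂))
  ... | 2F | _  | 2F with () ← inj (≡.trans κ₀ (≡.sym κ₂))
  ... | _  | 0F | 0F with () ← inj (≡.trans κ₁ (≡.sym κ₂))
  ... | _  | 1F | 1F with () ← inj (≡.trans κ₁ (≡.sym κ₂))
  ... | _  | 2F | 2F with () ← inj (≡.trans κ₁ (≡.sym κ₂))
  ... | 0F | 1F | 2F = refl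
  ... | 0F | 2F | 1F = *-congˡ (solve 6
    (λ a b c d e f → b :+ a :+ e :+ f :+ c :+ d := a :+ b :+ c :+ d :+ e :+ f) refl _ _ _ _ _ _)
  ... | 1F | 0F | 2F = *-congˡ (solve 6
    (λ a b c d e f → c :+ d :+ a :+ b :+ f :+ e := a :+ b :+ c :+ d :+ e :+ f) refl _ _ _ _ _ _)
  ... | 1F | 2F | 0F = *-congˡ (solve 6
    (λ a b c d e f → d :+ c :+ f :+ e :+ a :+ b := a :+ b :+ c :+ d :+ e :+ f) refl _ _ _ _ _ _)
  ... | 2F | 0F | 1F = *-congˡ (solve 6
    (λ a b c d e f → e :+ f :+ b :+ a :+ d :+ c := a :+ b :+ c :+ d :+ e :+ f) refl _ _ _ _ _ _)
  ... | 2F | 1F | 0F = *-congˡ (solve 6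
    (λ a b c d e f → f :+ e :+ d :+ c :+ b :+ a := a :+ b :+ c :+ d :+ e :+ f) refl _ _ _ _ _ _)

-- The spectrum of the pencil

module EigenTheory (em : ExcludedMiddle 0ℓ) (K : ScalarField) where

  open TensorTheory em K public

  pairing-∑ʳ : ∀ {m n} (u : Vect n) (v : Fin m → Vect n) →
    pairing u (λ j → sum (λ i → v i j)) ≈ sum (λ i → pairing u (v i))
  pairing-∑ʳ u v = trans
    (sum-cong-≋ λ j → *-distribˡ-sum (u j) (λ i → v i j))
    (∑-comm (λ j i → u j * v i j))

  -- `NonZero` is a bare negation; excluded middle extracts from it a coordinate that can be divided
  -- by.
  nonzero-entry : ∀ {n} {x : Vect n} → NonZero x → ∃ λ c → x c ≉ 0#
  nonzero-entry x≉0 = stable λ none → x≉0 λ c → stable λ xc≉0 → none (c , xc≉0)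

  -- The basis property in terms of coordinates, which are pairings with the `a i k`: `b` realises
  -- prescribed coordinates, and `faithful` says that they determine the vector. This form passes
  -- readily to a relabelled family.
  record DualBasis {n r} (a : Fin r → Fin 3 → Vect n) : Set where
    field
      b          : Fin r → Fin 3 → Vect n
      dual-same  : ∀ i k → pairing (a i k) (b i k) ≈ 1#
      dual-other : ∀ {i k j l} → (i , k) ≢ (j , l) → pairing (a i k) (b j l) ≈ 0#
      faithful   : ∀ x → (∀ i k → pairing (a i k) x ≈ 0#) → x ≋ᵥ 0ᵥ

  -- `separated` compares the ratios φ / γ without dividing, which keeps the condition polynomial.
  -- `γ≉0` makes every ratio a finite eigenvalue, and `φ≉0` makes T_f injective.
  record Generic {r} (φ γ : Fin r → Fin 3 → Carrier) : Set where
    field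
      φ≉0       : ∀ i k → φ i k ≉ 0#
      γ≉0       : ∀ i k → γ i k ≉ 0#
      separated : ∀ {i k j l} → (i , k) ≢ (j , l) →
                  φ i k * γ j l + - (φ j l * γ i k) ≉ 0#

    P : Fin r → Fin 3 → Carrier
    P i m = φ i (next m) * γ i (prev m) + - (φ i (prev m) * γ i (next m))

    P≉0 : ∀ i m → P i m ≉ 0#
    P≉0 i m = separated λ eq → prev≢next m (≡.sym (cong proj₂ eq))

    P-prev : ∀ i k → P i (prev k) ≈ φ i k * γ i (next k) + - (φ i (next k) * γ i k)
    P-prev i k rewrite next-prev k | prev-prev k = refl

    P-next : ∀ i k → P i (next k) ≈ φ i (prev k) * γ i k + - (φ i k * γ i (prev k))
    P-next i k rewrite next-next k | prev-next k = refl

  module Spectrum {n r} (a : Fin r → Fin 3 → Vect n) (D : DualBasis a)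
    (T : Tensor n) (T≋∑ : T ≋ ∑ₜ (λ i → symProduct (a i)))
    (f g : Vect n)
    (generic : Generic (λ i k → pairing (a i k) f) (λ i k → pairing (a i k) g)) where

    open DualBasis D public
    open Generic generic public

    φ γ : Fin r → Fin 3 → Carrier
    φ i k = pairing (a i k) f
    γ i k = pairing (a i k) g

    coord : Vect n → Fin r → Fin 3 → Carrier
    coord x i k = pairing (a i k) x

    act : ∀ f x j → (contract T f · x) j ≈
      sum (λ i → combination (λ m → 1/6 * block (coord f i) (coord x i) m) (a i) j)
    act f x j = trans (action-cong f x j T≋∑)
      (trans (action-∑ₜ f x j (λ i → symProduct (a i)))
        (sum-cong-≋ λ i → action-symProduct (a i) f x j))

    pairing-act : ∀ w f x → pairing w (contract T f · x) ≈
      sum (λ i → sum (λ m → 1/6 * block (coord f i) (coord x i) m * coord w i m))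
    pairing-act w f x = begin
      pairing w (contract T f · x)
        ≈⟨ pairing-congʳ w (act f x) ⟩
      pairing w (λ j → sum (λ i → combination (c i) (a i) j))
        ≈⟨ pairing-∑ʳ w (λ i → combination (c i) (a i)) ⟩
      sum (λ i → pairing w (combination (c i) (a i)))
        ≈⟨ sum-cong-≋ (λ i → trans (pairing-sumʳ w (c i) (a i))
             (sum-cong-≋ λ m → *-congˡ {c i m} (pairing-comm w (a i m)))) ⟩
      sum (λ i → sum (λ m → c i m * coord w i m)) ∎
      where
      c : Fin r → Fin 3 → Carrier
      c i m = 1/6 * block (coord f i) (coord x i) m

    -- Pairing with the dual vector `b i m` isolates one entry of one block.
    act≈0⇒block≈0 : ∀ f x → contract T f · x ≋ᵥ 0ᵥ → ∀ i m → block (coord f i) (coord x i) m ≈ 0#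
    act≈0⇒block≈0 f x act≈0 i m = *-cancel 1/6≉0 (begin
      B i m
        ≈⟨ *-identityʳ _ ⟨
      B i m * 1#
        ≈⟨ *-congˡ (dual-same i m) ⟨
      B i m * coord (b i m) i m
        ≈⟨ sum-single m (λ l l≢m → *-zeroʳ-≈ (B i l) (dual-other (l≢m ∘ cong proj₂))) ⟨
      sum (λ l → B i l * coord (b i m) i l)
        ≈⟨ sum-single i
            (λ j j≢i → sum-zero λ l → *-zeroʳ-≈ (B j l) (dual-other {k = l} {l = m} (j≢i ∘ cong proj₁))) ⟨
      sum (λ j → sum (λ l → B j l * coord (b i m) j l))
        ≈⟨ pairing-act (b i m) f x ⟨
      pairing (b i m) (contract T f · x)
        ≈⟨ pairing-zeroʳ (b i m) act≈0 ⟩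
      0# ∎)
      where
      B : Fin r → Fin 3 → Carrier
      B i m = 1/6 * block (coord f i) (coord x i) m

    block≈0⇒act≈0 : ∀ f x → (∀ i m → block (coord f i) (coord x i) m ≈ 0#) → contract T f · x ≋ᵥ 0ᵥ
    block≈0⇒act≈0 f x block≈0 j = trans (act f x j)
      (sum-zero λ i → sum-zero λ m → *-zeroˡ-≈ (a i m j) (*-zeroʳ-≈ 1/6 (block≈0 i m)))

    h : Carrier → Vect n
    h μ j = f j + - (μ * g j)

    η : Carrier → Fin r → Fin 3 → Carrier
    η μ = coord (h μ)

    -- Contraction is linear in the contracting vector, so the pencil is itself the contraction by f
    -- - μg. One block description then serves T_f, T_ℓ and every member of the pencil.
    pencil-act : ∀ μ x j → (pencil (contract T f) μ (contract T g) · x) j ≈ (contract T (h μ) · x) j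
    pencil-act μ x j = sum-cong-≋ λ k → *-congʳ {x k} (begin
      contract T f j k + - (μ * contract T g j k)
        ≈⟨ +-congˡ (-‿distribˡ-* μ _) ⟩
      contract T f j k + - μ * contract T g j k
        ≈⟨ sum-linear (λ i → f i * T i j k) (λ i → g i * T i j k) (- μ) ⟨
      sum (λ i → f i * T i j k + - μ * (g i * T i j k))
        ≈⟨ sum-cong-≋ (λ i → solve 4 (λ f μ g t → f :* t :+ (:- μ) :* (g :* t) := (f :- μ :* g) :* t)
             refl (f i) μ (g i) (T i j k)) ⟩
      contract T (h μ) j k ∎)

    η≈ : ∀ μ i k → η μ i k ≈ φ i k + - (μ * γ i k)
    η≈ μ i k = begin
      pairing (a i k) (h μ)
        ≈⟨ pairing-congʳ (a i k) (λ j → +-congˡ (-‿distribˡ-* μ (g j))) ⟩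
      pairing (a i k) (λ j → f j + - μ * g j)   ≈⟨ pairing-linearʳ (a i k) f g (- μ) ⟩
      φ i k + - μ * γ i k                       ≈⟨ +-congˡ (-‿distribˡ-* μ (γ i k)) ⟨
      φ i k + - (μ * γ i k)                     ∎

    root⇒φ≈ : ∀ {μ i k} → η μ i k ≈ 0# → φ i k ≈ μ * γ i k
    root⇒φ≈ {μ} {i} {k} η≈0 = begin
      φ i k
        ≈⟨ solve 2 (λ p q → p := (p :- q) :+ q) refl (φ i k) (μ * γ i k) ⟩
      φ i k + - (μ * γ i k) + μ * γ i k       ≈⟨ +-congʳ (trans (sym (η≈ μ i k)) η≈0) ⟩
      0# + μ * γ i k                          ≈⟨ +-identityˡ _ ⟩
      μ * γ i k                               ∎

    φ≈⇒root : ∀ {μ i k} → φ i k ≈ μ * γ i k → η μ i k ≈ 0#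
    φ≈⇒root {μ} {i} {k} eq = trans (η≈ μ i k) (trans (+-congʳ eq) (-‿inverseʳ _))

    -- Multiplying by γ_k clears the denominator of μ = φ_k / γ_k. The sign here, opposite to that
    -- in `γη-prev`, is what later makes orthogonality to h independent of orthogonality to x.
    γη-next : ∀ {μ i k} → η μ i k ≈ 0# → γ i k * η μ i (next k) ≈ - P i (prev k)
    γη-next {μ} {i} {k} root = begin
      γ i k * η μ i (next k)
        ≈⟨ *-congˡ (η≈ μ i (next k)) ⟩
      γ i k * (φ i (next k) + - (μ * γ i (next k)))
        ≈⟨ solve 4 (λ p q μ r → p :* (q :- μ :* r) := :- (μ :* p :* r :- q :* p))
             refl (γ i k) (φ i (next k)) μ (γ i (next k)) ⟩
      - (μ * γ i k * γ i (next k) + - (φ i (next k) * γ i k))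
        ≈⟨ -‿cong (+-congʳ (*-congʳ (sym (root⇒φ≈ root)))) ⟩
      - (φ i k * γ i (next k) + - (φ i (next k) * γ i k))
        ≈⟨ -‿cong (P-prev i k) ⟨
      - P i (prev k) ∎

    γη-prev : ∀ {μ i k} → η μ i k ≈ 0# → γ i k * η μ i (prev k) ≈ P i (next k)
    γη-prev {μ} {i} {k} root = begin
      γ i k * η μ i (prev k)
        ≈⟨ *-congˡ (η≈ μ i (prev k)) ⟩
      γ i k * (φ i (prev k) + - (μ * γ i (prev k)))
        ≈⟨ solve 4 (λ p q μ r → p :* (q :- μ :* r) := q :* p :- μ :* p :* r)
             refl (γ i k) (φ i (prev k)) μ (γ i (prev k)) ⟩
      φ i (prev k) * γ i k + - (μ * γ i k * γ i (prev k))
        ≈⟨ +-congˡ (-‿cong (*-congʳ (sym (root⇒φ≈ root)))) ⟩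
      φ i (prev k) * γ i k + - (φ i k * γ i (prev k))
        ≈⟨ P-next i k ⟨
      P i (next k) ∎

    root-unique : ∀ {μ i k j l} → η μ i k ≈ 0# → η μ j l ≈ 0# → (i , k) ≡ (j , l)
    root-unique {μ} {i} {k} {j} {l} ik jl = stable λ ik≢jl → separated ik≢jl (begin
      φ i k * γ j l + - (φ j l * γ i k)
        ≈⟨ +-cong (*-congʳ (root⇒φ≈ ik)) (-‿cong (*-congʳ (root⇒φ≈ jl))) ⟩
      μ * γ i k * γ j l + - (μ * γ j l * γ i k)
        ≈⟨ solve 3 (λ μ p q → μ :* p :* q :- μ :* q :* p := con (+ 0)) refl μ (γ i k) (γ j l) ⟩
      0# ∎)

    other-root : ∀ {μ i k j l} → η μ i k ≈ 0# → (i , k) ≢ (j , l) → η μ j l ≉ 0#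
    other-root ik ik≢jl jl = ik≢jl (root-unique ik jl)

    eigenvalue : Fin r → Fin 3 → Carrier
    eigenvalue i k = φ i k * proj₁ (inverse (γ i k) (γ≉0 i k))

    eigenvalue-root : ∀ i k → η (eigenvalue i k) i k ≈ 0#
    eigenvalue-root i k = φ≈⇒root (begin
      φ i k               ≈⟨ *-identityʳ _ ⟨
      φ i k * 1#          ≈⟨ *-congˡ (proj₂ (inverse (γ i k) (γ≉0 i k))) ⟨
      φ i k * (γ i k * w) ≈⟨ solve 3 (λ p q w → p :* (q :* w) := p :* w :* q) refl (φ i k) (γ i k) w ⟩
      φ i k * w * γ i k   ∎)
      where
      w : Carrier
      w = proj₁ (inverse (γ i k) (γ≉0 i k))

    η-cong : ∀ {μ ν} i k → μ ≈ ν → η μ i k ≈ η ν i k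
    η-cong i k μ≈ν = pairing-congʳ (a i k) λ j → +-congˡ (-‿cong (*-congʳ μ≈ν))

    root-value : ∀ {μ ν i k} → η μ i k ≈ 0# → η ν i k ≈ 0# → μ ≈ ν
    root-value {μ} {ν} {i} {k} root-μ root-ν = begin
      μ              ≈⟨ solve 2 (λ p q → p := (p :- q) :+ q) refl μ ν ⟩
      μ + - ν + ν    ≈⟨ +-congʳ (*-cancel (γ≉0 i k) (begin
        γ i k * (μ + - ν)
          ≈⟨ solve 3 (λ p q r → r :* (p :- q) := p :* r :- q :* r) refl μ ν (γ i k) ⟩
        μ * γ i k + - (ν * γ i k)      ≈⟨ +-cong (sym (root⇒φ≈ root-μ)) (-‿cong (sym (root⇒φ≈ root-ν))) ⟩
        φ i k + - φ i k                ≈⟨ -‿inverseʳ (φ i k) ⟩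
        0#                             ∎)) ⟩
      0# + ν         ≈⟨ +-identityˡ ν ⟩
      ν              ∎

    module _ {μ i k} (root : η μ i k ≈ 0#) where

      private
        η′ η″ : Carrier
        η′ = η μ i (next k)
        η″ = η μ i (prev k)

      -- Where η_k = 0 and y_k = 0, only the block equation η′y″ + η″y′ = 0 remains. Its solution y′
      -- = η′, y″ = -η″ is realised through the dual basis.
      eigenvector : Vect n
      eigenvector j = scalarMultiple η′ (b i (next k)) j + - η″ * b i (prev k) j

      eigenvector-coord : ∀ j l → coord eigenvector j l ≈
        η′ * coord (b i (next k)) j l + - η″ * coord (b i (prev k)) j l
      eigenvector-coord j l =
        trans (pairing-linearʳ (a j l) (scalarMultiple η′ (b i (next k))) (b i (prev k)) (- η″))
        (+-congʳ (pairing-scaleʳ (a j l) η′ (b i (next k))))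

      eigenvector-zero : ∀ {j l} → (j , l) ≢ (i , next k) → (j , l) ≢ (i , prev k) →
        coord eigenvector j l ≈ 0#
      eigenvector-zero {j} {l} ≢next ≢prev = trans (eigenvector-coord j l)
        (+-zero-≈ (*-zeroʳ-≈ _ (dual-other ≢next)) (*-zeroʳ-≈ _ (dual-other ≢prev)))

      eigenvector-next : coord eigenvector i (next k) ≈ η′
      eigenvector-next = trans (eigenvector-coord i (next k)) (trans
        (+-cong (*-congˡ (dual-same i (next k)))
                (*-congˡ (dual-other (prev≢next k ∘ ≡.sym ∘ cong proj₂))))
        (solve 2 (λ x y → x :* con (+ 1) :+ (:- y) :* con (+ 0) := x) refl η′ η″))

      eigenvector-prev : coord eigenvector i (prev k) ≈ - η″
      eigenvector-prev = trans (eigenvector-coord i (prev k)) (trans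
        (+-cong (*-congˡ (dual-other (prev≢next k ∘ cong proj₂)))
                (*-congˡ (dual-same i (prev k))))
        (solve 2 (λ x y → x :* con (+ 0) :+ (:- y) :* con (+ 1) := :- y) refl η′ η″))

      eigenvector-nonzero : NonZero eigenvector
      eigenvector-nonzero x≋0 = other-root root (next≢ k ∘ ≡.sym ∘ cong proj₂)
        (trans (sym eigenvector-next) (pairing-zeroʳ (a i (next k)) x≋0))

      eigenvector-here : coord eigenvector i k ≈ 0#
      eigenvector-here = eigenvector-zero (next≢ k ∘ ≡.sym ∘ cong proj₂) (prev≢ k ∘ ≡.sym ∘ cong proj₂)

      eigenvector-block : ∀ j m → block (η μ j) (coord eigenvector j) m ≈ 0#
      eigenvector-block j m with j ≟ i
      ... | no j≢i =
        block-zeroʳ (η μ j) (λ l → eigenvector-zero {l = l} (j≢i ∘ cong proj₁) (j≢i ∘ cong proj₁)) m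
      ... | yes ≡.refl with rotations k m
      ... | inj₁ ≡.refl = trans (+-cong (*-congˡ eigenvector-prev) (*-congˡ eigenvector-next))
        (solve 2 (λ x y → x :* :- y :+ y :* x := con (+ 0)) refl η′ η″)
      ... | inj₂ (inj₁ ≡.refl) = trans (reflexive (block-next (η μ i) (coord eigenvector i) k))
        (+-zero-≈ (*-zeroʳ-≈ _ eigenvector-here) (*-zeroˡ-≈ _ root))
      ... | inj₂ (inj₂ ≡.refl) = trans (reflexive (block-prev (η μ i) (coord eigenvector i) k))
        (+-zero-≈ (*-zeroˡ-≈ _ root) (*-zeroʳ-≈ _ eigenvector-here))

      eigenvector-kernel : pencil (contract T f) μ (contract T g) · eigenvector ≋ᵥ 0ᵥ
      eigenvector-kernel j = trans (pencil-act μ eigenvector j)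
        (block≈0⇒act≈0 (h μ) eigenvector eigenvector-block j)

      root⇒singular : det (pencil (contract T f) μ (contract T g)) ≈ 0#
      root⇒singular = kernel⇒det≈0 (eigenvector , nonzero-entry eigenvector-nonzero , eigenvector-kernel)

    kernel-block : ∀ {μ x} → pencil (contract T f) μ (contract T g) · x ≋ᵥ 0ᵥ →
                   ∀ i m → block (η μ i) (coord x i) m ≈ 0#
    kernel-block {μ} {x} kernel = act≈0⇒block≈0 (h μ) x λ j → trans (sym (pencil-act μ x j)) (kernel j)

    singular⇒root : ∀ {μ} → det (pencil (contract T f) μ (contract T g)) ≈ 0# →
                    ∃ λ ((i , k) : Fin r × Fin 3) → η μ i k ≈ 0#
    singular⇒root {μ} det≈0 with x , (c , xc≉0) , kernel ← det≈0⇒kernel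
        (pencil (contract T f) μ (contract T g)) det≈0 =
      stable λ none → xc≉0 (faithful x
        (λ i → block-injective (λ k η≈0 → none ((i , k) , η≈0)) (kernel-block {x = x} kernel i)) c)

    -- A normal form in which the eigenvalue no longer occurs: eigenvectors of the three different
    -- eigenvalues of one term are all expressed by the same minors, so their pairings can be
    -- compared.
    record IsEigenvector (i : Fin r) (k : Fin 3) (x : Vect n) : Set where
      field
        τ         : Carrier
        τ≉0       : τ ≉ 0#
        elsewhere : ∀ {j} → j ≢ i → ∀ m → coord x j m ≈ 0#
        here      : coord x i k ≈ 0#
        at-next   : coord x i (next k) ≈ τ * P i (prev k)
        at-prev   : coord x i (prev k) ≈ τ * P i (next k)

    isEigenvector : ∀ {μ i k x} → η μ i k ≈ 0# → NonZero x →
      pencil (contract T f) μ (contract T g) · x ≋ᵥ 0ᵥ → IsEigenvector i k x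
    isEigenvector {μ} {i} {k} {x} root x≉0 kernel = record
      -- Chosen to make `at-next` hold by construction; `at-prev` then comes from the block equation
      -- at `k` multiplied by γ_k.
      { τ         = y (next k) * w
      ; τ≉0       = λ τ≈0 → x≉0 (faithful x (vanish τ≈0))
      ; elsewhere = elsewhere
      ; here      = here
      ; at-next   = at-next
      ; at-prev   = at-prev
      }
      where
      y : Fin 3 → Carrier
      y = coord x i
      w : Carrier
      w = proj₁ (inverse (P i (prev k)) (P≉0 i (prev k)))
      Pw≈1 : P i (prev k) * w ≈ 1#
      Pw≈1 = proj₂ (inverse (P i (prev k)) (P≉0 i (prev k)))
      elsewhere : ∀ {j} → j ≢ i → ∀ m → coord x j m ≈ 0#
      elsewhere {j} j≢i =
        block-injective (λ l → other-root {l =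
          l} root (j≢i ∘ ≡.sym ∘ cong proj₁)) (kernel-block {x = x} kernel j)
      here : y k ≈ 0#
      here = *-cancel (other-root root (prev≢ k ∘ ≡.sym ∘ cong proj₂)) (begin
        η μ i (prev k) * y k                          ≈⟨ +-identityʳ _ ⟨
        η μ i (prev k) * y k + 0#                     ≈⟨ +-congˡ (*-zeroˡ-≈ (y (prev k)) root) ⟨
        η μ i (prev k) * y k + η μ i k * y (prev k)   ≈⟨ reflexive (block-next (η μ i) y k) ⟨
        block (η μ i) y (next k)                      ≈⟨ kernel-block {x = x} kernel i (next k) ⟩
        0#                                            ∎)
      at-next : y (next k) ≈ y (next k) * w * P i (prev k)
      at-next = begin
        y (next k)                        ≈⟨ *-identityʳ _ ⟨
        y (next k) * 1#                   ≈⟨ *-congˡ Pw≈1 ⟨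
        y (next k) * (P i (prev k) * w)
          ≈⟨ solve 3 (λ y p w → y :* (p :* w) := y :* w :* p) refl (y (next k)) (P i (prev k)) w ⟩
        y (next k) * w * P i (prev k)     ∎
      at-prev : y (prev k) ≈ y (next k) * w * P i (next k)
      at-prev = begin
        y (prev k)
          ≈⟨ *-identityʳ _ ⟨
        y (prev k) * 1#
          ≈⟨ *-congˡ Pw≈1 ⟨
        y (prev k) * (P i (prev k) * w)
          ≈⟨ solve 5 (λ y″ y′ p w q → y″ :* (p :* w)
                 := y′ :* w :* q :+ (:- w) :* ((:- p) :* y″ :+ q :* y′))
               refl (y (prev k)) (y (next k)) (P i (prev k)) w (P i (next k)) ⟩
        y (next k) * w * P i (next k) + - w * (- P i (prev k) * y (prev k) + P i (next k) * y (next k))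
          ≈⟨ +-congˡ (*-zeroʳ-≈ (- w) (begin
               - P i (prev k) * y (prev k) + P i (next k) * y (next k)
                 ≈⟨ +-cong (*-congʳ (γη-next root)) (*-congʳ (γη-prev root)) ⟨
               γ i k * η μ i (next k) * y (prev k) + γ i k * η μ i (prev k) * y (next k)
                 ≈⟨ solve 5 (λ c p q r s → c :* p :* q :+ c :* r :* s := c :* (p :* q :+ r :* s))
                      refl (γ i k) (η μ i (next k)) (y (prev k)) (η μ i (prev k)) (y (next k)) ⟩
               γ i k * block (η μ i) y k
                 ≈⟨ *-zeroʳ-≈ (γ i k) (kernel-block {x = x} kernel i k) ⟩
               0# ∎)) ⟩
        y (next k) * w * P i (next k) + 0#
          ≈⟨ +-identityʳ _ ⟩
        y (next k) * w * P i (next k) ∎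
      vanish : y (next k) * w ≈ 0# → ∀ j l → coord x j l ≈ 0#
      vanish τ≈0 j l with j ≟ i
      ... | no j≢i = elsewhere j≢i l
      ... | yes ≡.refl with rotations k l
      ... | inj₁ ≡.refl        = here
      ... | inj₂ (inj₁ ≡.refl) = trans at-next (*-zeroˡ-≈ _ τ≈0)
      ... | inj₂ (inj₂ ≡.refl) = trans at-prev (*-zeroˡ-≈ _ τ≈0)

    module _ (ℓ : Vect n) where

      pairing-elsewhere : ∀ {i k j l x z} → IsEigenvector i k x → IsEigenvector j l z → j ≢ i →
                          pairing z (contract T ℓ · x) ≈ 0#
      pairing-elsewhere {i} {k} {j} {l} {x} {z} X Z j≢i = trans (pairing-act z ℓ x) (sum-zero vanish)
        where
        vanish : ∀ p → sum (λ m → 1/6 * block (coord ℓ p) (coord x p) m * coord z p m) ≈ 0#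
        vanish p with p ≟ i
        ... | no p≢i     = sum-zero λ m → *-zeroˡ-≈ (coord z p m)
          (*-zeroʳ-≈ 1/6 (block-zeroʳ (coord ℓ p) (IsEigenvector.elsewhere X p≢i) m))
        ... | yes ≡.refl = sum-zero λ m → *-zeroʳ-≈ (1/6 * block (coord ℓ p) (coord x p) m)
          (IsEigenvector.elsewhere Z (j≢i ∘ ≡.sym) m)

      pairing-here : ∀ {i k l x z} → (∀ m → coord ℓ i m ≉ 0#) →
        sum (λ m → coord ℓ i m * P i m) ≉ 0# → IsEigenvector i k x → IsEigenvector i l z →
        pairing z (contract T ℓ · x) ≉ 0#
      pairing-here {i} {k} {l} {x} {z} ψ≉0 triple≉0 X Z eq =
        *-nonzero (*-nonzero 1/6≉0 (*-nonzero X.τ≉0 Z.τ≉0)) (Q≉0 (rotations k l)) (begin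
          1/6 * (X.τ * Z.τ) * Q (rotations k l)
            ≈⟨ *-assoc _ _ _ ⟩
          1/6 * (X.τ * Z.τ * Q (rotations k l))
            ≈⟨ *-congˡ (value (rotations k l)) ⟨
          1/6 * sum (λ m → block ψ y m * v m)
            ≈⟨ *-distribˡ-sum 1/6 (λ m → block ψ y m * v m) ⟩
          sum (λ m → 1/6 * (block ψ y m * v m))
            ≈⟨ sum-cong-≋ (λ m → *-assoc 1/6 (block ψ y m) (v m)) ⟨
          sum (λ m → 1/6 * block ψ y m * v m)
            ≈⟨ sum-single i
                (λ j j≢i → sum-zero λ m →
                  *-zeroʳ-≈ (1/6 * block (coord ℓ j) (coord x j) m) (Z.elsewhere j≢i m)) ⟨
          sum (λ j → sum (λ m → 1/6 * block (coord ℓ j) (coord x j) m * coord z j m))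
            ≈⟨ pairing-act z ℓ x ⟨
          pairing z (contract T ℓ · x)
            ≈⟨ eq ⟩
          0# ∎)
        where
        module X = IsEigenvector X
        module Z = IsEigenvector Z
        ψ y v : Fin 3 → Carrier
        ψ = coord ℓ i
        y = coord x i
        v = coord z i
        p p′ p″ : Carrier
        p  = P i k
        p′ = P i (next k)
        p″ = P i (prev k)

        -- The pairing with the factor 1/6 and the two scales removed. For l = k both vectors vanish
        -- at `k`, and the two surviving terms are equal, whence the factor 2. Otherwise one minor
        -- factors out and leaves the determinant of ψ, φ, γ expanded along ψ.
        Q : l ≡ k ⊎ (l ≡ next k ⊎ l ≡ prev k) → Carrier
        Q (inj₁ _)        = (1# + 1#) * (ψ k * (p′ * p″))
        Q (inj₂ (inj₁ _)) = p″ * sum (λ m → ψ m * P i m)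
        Q (inj₂ (inj₂ _)) = p′ * sum (λ m → ψ m * P i m)

        Q≉0 : ∀ rot → Q rot ≉ 0#
        Q≉0 (inj₁ _)        =
          *-nonzero 1+1≉0 (*-nonzero (ψ≉0 k) (*-nonzero (P≉0 i (next k)) (P≉0 i (prev k))))
        Q≉0 (inj₂ (inj₁ _)) = *-nonzero (P≉0 i (prev k)) triple≉0
        Q≉0 (inj₂ (inj₂ _)) = *-nonzero (P≉0 i (next k)) triple≉0

        block-k : block ψ y k ≈ ψ (next k) * (X.τ * p′) + ψ (prev k) * (X.τ * p″)
        block-k = +-cong (*-congˡ X.at-prev) (*-congˡ X.at-next)
        block-k′ : block ψ y (next k) ≈ ψ (prev k) * 0# + ψ k * (X.τ * p′)
        block-k′ = trans (reflexive (block-next ψ y k)) (+-cong (*-congˡ X.here) (*-congˡ X.at-prev))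
        block-k″ : block ψ y (prev k) ≈ ψ k * (X.τ * p″) + ψ (next k) * 0#
        block-k″ = trans (reflexive (block-prev ψ y k)) (+-cong (*-congˡ X.at-next) (*-congˡ X.here))

        expand : ∀ {v₀ v₁ v₂} → v k ≈ v₀ → v (next k) ≈ v₁ → v (prev k) ≈ v₂ →
          sum (λ m → block ψ y m * v m) ≈
            (ψ (next k) * (X.τ * p′) + ψ (prev k) * (X.τ * p″)) * v₀
            + (ψ (prev k) * 0# + ψ k * (X.τ * p′)) * v₁
            + (ψ k * (X.τ * p″) + ψ (next k) * 0#) * v₂
        expand eq₀ eq₁ eq₂ = trans (sum₃ k (λ m → block ψ y m * v m))
          (+-cong (+-cong (*-cong block-k eq₀) (*-cong block-k′ eq₁)) (*-cong block-k″ eq₂))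

        value : ∀ rot → sum (λ m → block ψ y m * v m) ≈ X.τ * Z.τ * Q rot
        value (inj₁ ≡.refl) = trans (expand Z.here Z.at-next Z.at-prev)
          (solve 7 (λ τ σ ψ ψ′ ψ″ p′ p″ →
            (ψ′ :* (τ :* p′) :+ ψ″ :* (τ :* p″)) :* con (+ 0)
            :+ (ψ″ :* con (+ 0) :+ ψ :* (τ :* p′)) :* (σ :* p″)
            :+ (ψ :* (τ :* p″) :+ ψ′ :* con (+ 0)) :* (σ :* p′)
            := τ :* σ :* ((con (+ 1) :+ con (+ 1)) :* (ψ :* (p′ :* p″))))
            refl X.τ Z.τ (ψ k) (ψ (next k)) (ψ (prev k)) p′ p″)
        value (inj₂ (inj₁ ≡.refl)) = trans
          (expand
            (trans (reflexive (cong v (≡.sym (prev-next k))))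
                (trans Z.at-prev (*-congˡ (reflexive (cong (P i) (next-next k))))))
            Z.here
            (trans (reflexive (cong v (≡.sym (next-next k))))
                (trans Z.at-next (*-congˡ (reflexive (cong (P i) (prev-next k)))))))
          (trans
            (solve 8 (λ τ σ ψ ψ′ ψ″ p p′ p″ →
              (ψ′ :* (τ :* p′) :+ ψ″ :* (τ :* p″)) :* (σ :* p″)
              :+ (ψ″ :* con (+ 0) :+ ψ :* (τ :* p′)) :* con (+ 0)
              :+ (ψ :* (τ :* p″) :+ ψ′ :* con (+ 0)) :* (σ :* p)
              := τ :* σ :* (p″ :* (ψ :* p :+ ψ′ :* p′ :+ ψ″ :* p″)))
              refl X.τ Z.τ (ψ k) (ψ (next k)) (ψ (prev k)) p p′ p″)
            (*-congˡ (*-congˡ (sym (sum₃ k (λ m → ψ m * P i m))))))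
        value (inj₂ (inj₂ ≡.refl)) = trans
          (expand
            (trans (reflexive (cong v (≡.sym (next-prev k))))
                (trans Z.at-next (*-congˡ (reflexive (cong (P i) (prev-prev k))))))
            (trans (reflexive (cong v (≡.sym (prev-prev k))))
                (trans Z.at-prev (*-congˡ (reflexive (cong (P i) (next-prev k))))))
            Z.here)
          (trans
            (solve 8 (λ τ σ ψ ψ′ ψ″ p p′ p″ →
              (ψ′ :* (τ :* p′) :+ ψ″ :* (τ :* p″)) :* (σ :* p′)
              :+ (ψ″ :* con (+ 0) :+ ψ :* (τ :* p′)) :* (σ :* p)
              :+ (ψ :* (τ :* p″) :+ ψ′ :* con (+ 0)) :* con (+ 0)
              := τ :* σ :* (p′ :* (ψ :* p :+ ψ′ :* p′ :+ ψ″ :* p″)))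
              refl X.τ Z.τ (ψ k) (ψ (next k)) (ψ (prev k)) p p′ p″)
            (*-congˡ (*-congˡ (sym (sum₃ k (λ m → ψ m * P i m))))))

-- From the spectrum to the terms

module AlgorithmTheory (em : ExcludedMiddle 0ℓ) (K : ScalarField) where

  open EigenTheory em K public

  combination-assoc : ∀ {l m n} (c : Fin l → Carrier) (v : Fin l → Vect m) (w : Fin m → Vect n) →
    combination (combination c v) w ≋ᵥ combination c (λ k → combination (v k) w)
  combination-assoc c v w j = begin
    sum (λ m → sum (λ k → c k * v k m) * w m j)
      ≈⟨ sum-cong-≋ (λ m → *-distribʳ-sum (w m j) (λ k → c k * v k m)) ⟩
    sum (λ m → sum (λ k → c k * v k m * w m j))
      ≈⟨ ∑-comm (λ m k → c k * v k m * w m j) ⟩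
    sum (λ k → sum (λ m → c k * v k m * w m j))
      ≈⟨ sum-cong-≋ (λ k → trans (sum-cong-≋ λ m → *-assoc (c k) (v k m) (w m j))
           (sym (*-distribˡ-sum (c k) (λ m → v k m * w m j)))) ⟩
    sum (λ k → c k * sum (λ m → v k m * w m j)) ∎

  combination-unit : ∀ {m n} (k : Fin m) (w : Fin m → Vect n) → combination (unit k) w ≋ᵥ w k
  combination-unit k w j = trans
    (sum-single k λ m m≢k → *-zeroˡ-≈ (w m j) (unit-other m≢k))
    (trans (*-congʳ (unit-same k)) (*-identityˡ _))

  line⊥ : ∀ {n} {u w : Vect n} → pairing u w ≈ 0# → w ∈ span (u ∷ []) ⊥
  line⊥ {u = u} {w} u⊥w v (c , v≋cu) = begin
    pairing v w
      ≈⟨ trans (pairing-comm v w) (pairing-congʳ w v≋cu) ⟩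
    pairing w (combination c (u ∷ []))
      ≈⟨ pairing-sumʳ w c (u ∷ []) ⟩
    c zero * pairing w u + 0#
      ≈⟨ +-zero-≈ (*-zeroʳ-≈ (c zero) (trans (pairing-comm w u) u⊥w)) refl ⟩
    0# ∎

  ⊥line : ∀ {n} {u w : Vect n} → w ∈ span (u ∷ []) ⊥ → pairing u w ≈ 0#
  ⊥line {u = u} w∈u⊥ = w∈u⊥ u ((λ _ → 1#) , λ j →
    sym (trans (+-identityʳ (1# * u j)) (*-identityˡ (u j))))

  block-combination : ∀ h (c : Fin 3 → Carrier) (y : Fin 3 → Fin 3 → Carrier) m →
    block h (combination c y) m ≈ sum (λ l → c l * block h (y l) m)
  block-combination h c y m = begin
    h′ * sum (λ l → c l * y l m″) + h″ * sum (λ l → c l * y l m′)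
      ≈⟨ +-congʳ (*-distribˡ-sum h′ (λ l → c l * y l m″)) ⟩
    sum (λ l → h′ * (c l * y l m″)) + h″ * sum (λ l → c l * y l m′)
      ≈⟨ sum-linear (λ l → h′ * (c l * y l m″)) (λ l → c l * y l m′) h″ ⟨
    sum (λ l → h′ * (c l * y l m″) + h″ * (c l * y l m′))
      ≈⟨ sum-cong-≋ (λ l → solve 5 (λ h′ h″ c y″ y′ → h′ :* (c :* y″) :+ h″ :* (c :* y′)
             := c :* (h′ :* y″ :+ h″ :* y′))
           refl h′ h″ (c l) (y l m″) (y l m′)) ⟩
    sum (λ l → c l * block h (y l) m) ∎
    where
    m′ m″ : Fin 3
    m′ = next m
    m″ = prev m
    h′ h″ : Carrier
    h′ = h m′
    h″ = h m″

  -- The eigenpairs are labelled so that (i , k) is the root of the k-th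
  -- linear form of the i-th term.
  module LabelledRun {n r} (a : Fin r → Fin 3 → Vect n) (D : DualBasis a)
    (T : Tensor n) (T≋∑ : T ≋ ∑ₜ (λ i → symProduct (a i))) (f g ℓ : Vect n)
    (generic : Generic (λ i k → pairing (a i k) f) (λ i k → pairing (a i k) g))
    (E : Algorithm.Eigenpairs (ScalarField.rawRing K) scalar r T f g ℓ)
    (G : Algorithm.Triples (ScalarField.rawRing K) scalar r T f g ℓ E)
    (labelled : ∀ i k → Spectrum.η a D T T≋∑ f g generic
      (Algorithm.Eigenpairs.value E (Inverse.to (Algorithm.Triples.label G) (i , k))) i k ≈ 0#)
    where

    open Spectrum a D T T≋∑ f g generic hiding (h)
    open Algorithm (ScalarField.rawRing K) scalar r T f g ℓ
    module E = Eigenpairs E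
    open Triples G using (label; x; h; U)

    module X i k = IsEigenvector (isEigenvector (labelled i k)
      (E.nonzero (Inverse.to label (i , k))) (E.kernel (Inverse.to label (i , k))))

    image : Fin r → Fin 3 → Vect 3
    image i k m = 1/6 * block (φ i) (coord (x i k) i) m

    act-x : ∀ i k → contract T f · x i k ≋ᵥ combination (image i k) (a i)
    act-x i k j = trans (act f (x i k) j)
      (sum-single i λ p p≢i → sum-zero λ m → *-zeroˡ-≈ (a p m j)
        (*-zeroʳ-≈ 1/6 (block-zeroʳ (φ p) (X.elsewhere i k p≢i) m)))

    -- Block injectivity is used twice. With `φ` it strips T_f off a vanishing combination. What is
    -- left is again a block, with the minors `P` in the role of `h` and the unknowns c_l τ_l: the
    -- vector x_il vanishes at l and has the minors at the two other places.
    image-independent : ∀ i → LinearlyIndependent (image i)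
    image-independent i c comb≈0 l =
      *-cancel (X.τ≉0 i l) (trans (*-comm _ _) (block-injective (P≉0 i) d-block l))
      where
      d : Fin 3 → Carrier
      d l = c l * X.τ i l
      y : Fin 3 → Fin 3 → Carrier
      y l = coord (x i l) i
      z≈0 : ∀ m → combination c y m ≈ 0#
      z≈0 = block-injective (φ≉0 i) λ m → *-cancel 1/6≉0 (begin
        1/6 * block (φ i) (combination c y) m
          ≈⟨ *-congˡ (block-combination (φ i) c y m) ⟩
        1/6 * sum (λ l → c l * block (φ i) (y l) m)
          ≈⟨ *-distribˡ-sum 1/6 (λ l → c l * block (φ i) (y l) m) ⟩
        sum (λ l → 1/6 * (c l * block (φ i) (y l) m))
          ≈⟨ sum-cong-≋ (λ l → solve 3 (λ s c b → s :* (c :* b) := c :* (s :* b))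
               refl 1/6 (c l) (block (φ i) (y l) m)) ⟩
        combination c (image i) m
          ≈⟨ comb≈0 m ⟩
        0# ∎)
      d-block : ∀ m → block (P i) d m ≈ 0#
      d-block m = begin
        P i (next m) * (c m″ * X.τ i m″) + P i m″ * (c m′ * X.τ i m′)
          ≈⟨ solve 7 (λ p p′ c c′ c″ t t′ → p :* (c″ :* t) :+ p′ :* (c′ :* t′)
                 := c :* con (+ 0) :+ c′ :* (t′ :* p′) :+ c″ :* (t :* p))
               refl (P i (next m)) (P i m″) (c m) (c m′) (c m″) (X.τ i m″) (X.τ i m′) ⟩
        c m * 0# + c m′ * (X.τ i m′ * P i m″) + c m″ * (X.τ i m″ * P i m′)
          ≈⟨ +-cong (+-cong (*-congˡ (X.here i m)) (*-congˡ at-m′)) (*-congˡ at-m″) ⟨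
        c m * y m m + c m′ * y m′ m + c m″ * y m″ m
          ≈⟨ sum₃ m (λ l → c l * y l m) ⟨
        combination c y m
          ≈⟨ z≈0 m ⟩
        0# ∎
        where
        m′ m″ : Fin 3
        m′ = next m
        m″ = prev m
        at-m′ : y m′ m ≈ X.τ i m′ * P i m″
        at-m′ = trans (reflexive (cong (y m′) (≡.sym (prev-next m))))
          (trans (X.at-prev i m′) (*-congˡ (reflexive (cong (P i) (next-next m)))))
        at-m″ : y m″ m ≈ X.τ i m″ * P i m′
        at-m″ = trans (reflexive (cong (y m″) (≡.sym (next-prev m))))
          (trans (X.at-next i m″) (*-congˡ (reflexive (cong (P i) (prev-prev m)))))

    image-combination : ∀ i c → combination c (λ k → contract T f · x i k) ≋ᵥ
                                combination (combination c (image i)) (a i)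
    image-combination i c j = trans
      (sum-cong-≋ λ k → *-congˡ {c k} (act-x i k j))
      (sym (combination-assoc c (image i) (a i) j))

    a-nonzero : ∀ i k → NonZero (a i k)
    a-nonzero i k a≋0 = 1≉0 (trans (sym (dual-same i k))
      (trans (pairing-comm (a i k) (b i k)) (pairing-zeroʳ (b i k) a≋0)))

    a-⊥x : ∀ i k → a i k ∈ span (x i k ∷ []) ⊥
    a-⊥x i k = line⊥ {u = x i k} {a i k} (trans (pairing-comm (x i k) (a i k)) (X.here i k))

    a-⊥h : ∀ i k → a i k ∈ span (h i k ∷ []) ⊥
    a-⊥h i k = line⊥ {u = h i k} {a i k} (trans (pairing-comm (h i k) (a i k)) (labelled i k))

    -- Three independent coordinate vectors span K³, so they produce the unit vector at `k`, which
    -- is the coordinate vector of `a i k`.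
    a∈U : ∀ i k → a i k ∈ U i
    a∈U i k = let c , unit≋ = independent⇒spanning (image i) (image-independent i) (unit k) in
      c , λ j → begin
        a i k j                                       ≈⟨ combination-unit k (a i) j ⟨
        combination (unit k) (a i) j                  ≈⟨ sum-cong-≋ (λ m → *-congʳ {a i m j} (unit≋ m)) ⟩
        combination (combination c (image i)) (a i) j ≈⟨ image-combination i c j ⟨
        combination c (λ k → contract T f · x i k) j  ∎

    -- Existence of an admissible choice: the vectors of the decomposition themselves qualify.
    factors : Factors G
    factors = record
      { a′      = a
      ; nonzero = a-nonzero
      ; member  = λ i k → a-⊥x i k , a-⊥h i k , a∈U i k
      }

    module _ (F : Factors G) where

      open Factors F

      -- Membership in `U i` leaves coefficients α, α′, α″ on the block. Orthogonality gives α′P″ +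
      -- α″P′ = 0 from x and -α′P″ + α″P′ = 0 from h; their difference and sum kill α′ and α″, as 2
      -- is invertible.
      recover : ∀ i k → ∃ λ α → a′ i k ≋ᵥ scalarMultiple α (a i k)
      recover i k = α k , λ j → begin
        a′ i k j
          ≈⟨ a′≋α j ⟩
        combination α (a i) j
          ≈⟨ sum₃ k (λ m → α m * a i m j) ⟩
        α k * a i k j + α k′ * a i k′ j + α k″ * a i k″ j
          ≈⟨ trans (+-cong (trans (+-congˡ (*-zeroˡ-≈ _ α′≈0)) (+-identityʳ _)) (*-zeroˡ-≈ _ α″≈0))
              (+-identityʳ _) ⟩
        α k * a i k j ∎
        where
        ⊥x : a′ i k ∈ span (x i k ∷ []) ⊥
        ⊥x = proj₁ (member i k)
        ⊥h : a′ i k ∈ span (h i k ∷ []) ⊥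
        ⊥h = proj₁ (proj₂ (member i k))
        c : Fin 3 → Carrier
        c = proj₁ (proj₂ (proj₂ (member i k)))
        a′≋ : a′ i k ≋ᵥ combination c (λ k → contract T f · x i k)
        a′≋ = proj₂ (proj₂ (proj₂ (member i k)))
        k′ k″ : Fin 3
        k′ = next k
        k″ = prev k
        α : Fin 3 → Carrier
        α = combination c (image i)
        a′≋α : a′ i k ≋ᵥ combination α (a i)
        a′≋α j = trans (a′≋ j) (image-combination i c j)
        annihilate : ∀ u → pairing u (a′ i k) ≈ 0# → coord u i k ≈ 0# →
                     α k′ * coord u i k′ + α k″ * coord u i k″ ≈ 0#
        annihilate u u⊥a′ uₖ≈0 = begin
          α k′ * coord u i k′ + α k″ * coord u i k″
            ≈⟨ +-congʳ (trans (+-congʳ (*-zeroʳ-≈ (α k) uₖ≈0)) (+-identityˡ _)) ⟨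
          α k * coord u i k + α k′ * coord u i k′ + α k″ * coord u i k″
            ≈⟨ sum₃ k (λ m → α m * coord u i m) ⟨
          sum (λ m → α m * coord u i m)
            ≈⟨ sum-cong-≋ (λ m → *-congˡ {α m} (pairing-comm (a i m) u)) ⟩
          sum (λ m → α m * pairing u (a i m))
            ≈⟨ pairing-sumʳ u α (a i) ⟨
          pairing u (combination α (a i))
            ≈⟨ pairing-congʳ u a′≋α ⟨
          pairing u (a′ i k)
            ≈⟨ u⊥a′ ⟩
          0# ∎
        by-x : α k′ * P i k″ + α k″ * P i k′ ≈ 0#
        by-x = *-cancel (X.τ≉0 i k) (begin
          τ * (α k′ * P i k″ + α k″ * P i k′)
            ≈⟨ solve 5 (λ t p q r s → t :* (p :* q :+ r :* s) := p :* (t :* q) :+ r :* (t :* s))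
                 refl τ (α k′) (P i k″) (α k″) (P i k′) ⟩
          α k′ * (τ * P i k″) + α k″ * (τ * P i k′)
            ≈⟨ +-cong (*-congˡ (X.at-next i k)) (*-congˡ (X.at-prev i k)) ⟨
          α k′ * coord (x i k) i k′ + α k″ * coord (x i k) i k″
            ≈⟨ annihilate (x i k) (⊥line {u = x i k} {a′ i k} ⊥x) (X.here i k) ⟩
          0# ∎)
          where
          τ : Carrier
          τ = X.τ i k
        by-h : - P i k″ * α k′ + P i k′ * α k″ ≈ 0#
        by-h = begin
          - P i k″ * α k′ + P i k′ * α k″
            ≈⟨ +-cong (*-congʳ (γη-next (labelled i k))) (*-congʳ (γη-prev (labelled i k))) ⟨
          γ i k * η μ i k′ * α k′ + γ i k * η μ i k″ * α k″
            ≈⟨ solve 5 (λ c p q r s → c :* p :* q :+ c :* r :* s := c :* (q :* p :+ s :* r))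
                 refl (γ i k) (η μ i k′) (α k′) (η μ i k″) (α k″) ⟩
          γ i k * (α k′ * η μ i k′ + α k″ * η μ i k″)
            ≈⟨ *-zeroʳ-≈ (γ i k) (annihilate (h i k) (⊥line {u = h i k} {a′ i k} ⊥h) (labelled i k)) ⟩
          0# ∎
          where
          μ : Carrier
          μ = E.value (Inverse.to label (i , k))
        α′≈0 : α k′ ≈ 0#
        α′≈0 = *-cancel (P≉0 i k″) (*-cancel 1+1≉0 (begin
          (1# + 1#) * (P i k″ * α k′)
            ≈⟨ solve 4 (λ p q r s → (con (+ 1) :+ con (+ 1)) :* (p :* q)
                   := (q :* p :+ s :* r) :- ((:- p) :* q :+ r :* s))
                 refl (P i k″) (α k′) (P i k′) (α k″) ⟩
          α k′ * P i k″ + α k″ * P i k′ + - (- P i k″ * α k′ + P i k′ * α k″)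
            ≈⟨ +-zero-≈ by-x (trans (-‿cong by-h) -0#≈0#) ⟩
          0# ∎))
        α″≈0 : α k″ ≈ 0#
        α″≈0 = *-cancel (P≉0 i k′) (*-cancel 1+1≉0 (begin
          (1# + 1#) * (P i k′ * α k″)
            ≈⟨ solve 4 (λ p q r s → (con (+ 1) :+ con (+ 1)) :* (r :* s)
                   := (q :* p :+ s :* r) :+ ((:- p) :* q :+ r :* s))
                 refl (P i k″) (α k′) (P i k′) (α k″) ⟩
          α k′ * P i k″ + α k″ * P i k′ + (- P i k″ * α k′ + P i k′ * α k″)
            ≈⟨ +-zero-≈ by-x by-h ⟩
          0# ∎))

      α : Fin r → Fin 3 → Carrier
      α i k = proj₁ (recover i k)

      α≉0 : ∀ i k → α i k ≉ 0#
      α≉0 i k α≈0 = nonzero i k λ j → trans (proj₂ (recover i k) j) (*-zeroˡ-≈ (a i k j) α≈0)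

      A : Fin r → Carrier
      A i = α i 0F * α i 1F * α i 2F

      A≉0 : ∀ i → A i ≉ 0#
      A≉0 i = *-nonzero (*-nonzero (α≉0 i 0F) (α≉0 i 1F)) (α≉0 i 2F)

      symProduct-a′ : ∀ i → symProduct (a′ i) ≋ scale (A i) (symProduct (a i))
      symProduct-a′ i p q s = trans
        (symProduct-cong (λ k → proj₂ (recover i k)) p q s)
        (symProduct-scale (α i) (a i) p q s)

      act-a′ : ∀ i j → (contract (symProduct (a′ i)) f · x i 0F) j ≈ A i * (contract T f · x i 0F) j
      act-a′ i j = begin
        (contract (symProduct (a′ i)) f · x i 0F) j
          ≈⟨ action-cong f (x i 0F) j (symProduct-a′ i) ⟩
        (contract (scale (A i) (symProduct (a i))) f · x i 0F) j
          ≈⟨ action-scale f (x i 0F) j (A i) (symProduct (a i)) ⟩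
        A i * (contract (symProduct (a i)) f · x i 0F) j
          ≈⟨ *-congˡ (trans (action-symProduct (a i) f (x i 0F) j) (sym (act-x i 0F j))) ⟩
        A i * (contract T f · x i 0F) j ∎

      coefficients : Coefficients F
      coefficients = record { c = A⁻¹ ; system = system }
        where
        A⁻¹ : Fin r → Carrier
        A⁻¹ i = proj₁ (inverse (A i) (A≉0 i))
        system : ∀ i j → (contract T f · x i 0F) j ≈ A⁻¹ i * (contract (symProduct (a′ i)) f · x i 0F) j
        system i j = begin
          t                    ≈⟨ *-identityˡ t ⟨
          1# * t               ≈⟨ *-congʳ (proj₂ (inverse (A i) (A≉0 i))) ⟨
          A i * A⁻¹ i * t      ≈⟨ solve 3 (λ a w t → a :* w :* t := w :* (a :* t)) refl (A i) (A⁻¹ i) t ⟩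
          A⁻¹ i * (A i * t)    ≈⟨ *-congˡ (act-a′ i j) ⟨
          A⁻¹ i * (contract (symProduct (a′ i)) f · x i 0F) j ∎
          where
          t : Carrier
          t = (contract T f · x i 0F) j

      -- T_f is injective because all φ are nonzero. Hence the last system has a coordinate with
      -- nonzero left side, and that coordinate determines `c`.
      act-x≉0 : ∀ i → NonZero (contract T f · x i 0F)
      act-x≉0 i act≈0 = E.nonzero (Inverse.to label (i , 0F)) (faithful (x i 0F) λ j →
        block-injective (φ≉0 j) (act≈0⇒block≈0 f (x i 0F) act≈0 j))

      output≋ : (C : Coefficients F) → ∀ i → Coefficients.output C i ≋ symProduct (a i)
      output≋ C i p q s = begin
        c i * symProduct (a′ i) p q s         ≈⟨ *-congˡ (symProduct-a′ i p q s) ⟩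
        c i * (A i * symProduct (a i) p q s)
          ≈⟨ solve 3 (λ c a s → c :* (a :* s) := s :- s :* (con (+ 1) :- c :* a))
               refl (c i) (A i) (symProduct (a i) p q s) ⟩
        S + - (S * (1# + - (c i * A i)))      ≈⟨ +-congˡ (trans (-‿cong (*-zeroʳ-≈ S 1-cA≈0)) -0#≈0#) ⟩
        S + 0#                                ≈⟨ +-identityʳ S ⟩
        S                                     ∎
        where
        open Coefficients C using (c; system)
        j : Fin n
        j = proj₁ (nonzero-entry (act-x≉0 i))
        S t : Carrier
        S = symProduct (a i) p q s
        t = (contract T f · x i 0F) j
        1-cA≈0 : 1# + - (c i * A i) ≈ 0#
        1-cA≈0 = *-cancel (proj₂ (nonzero-entry (act-x≉0 i))) (begin
          t * (1# + - (c i * A i))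
            ≈⟨ solve 3 (λ t c a → t :* (con (+ 1) :- c :* a) := t :- c :* (a :* t)) refl t (c i) (A i) ⟩
          t + - (c i * (A i * t))    ≈⟨ +-congˡ (-‿cong (*-congˡ (act-a′ i j))) ⟨
          t + - (c i * (contract (symProduct (a′ i)) f · x i 0F) j) ≈⟨ +-congʳ (system i j) ⟩
          c i * (contract (symProduct (a′ i)) f · x i 0F) j + -
              (c i * (contract (symProduct (a′ i)) f · x i 0F) j)
                                     ≈⟨ -‿inverseʳ _ ⟩
          0#                         ∎)

-- Correctness for every admissible choice

module Correctness (em : ExcludedMiddle 0ℓ) (K : ScalarField) where

  open AlgorithmTheory em K public

  module _ {n r} (a : Fin r → Fin 3 → Vect n) (D : DualBasis a)
    (T : Tensor n) (T≋∑ : T ≋ ∑ₜ (λ i → symProduct (a i))) (f g ℓ : Vect n)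
    (generic : Generic (λ i k → pairing (a i k) f) (λ i k → pairing (a i k) g))
    (ψ≉0 : ∀ i k → pairing (a i k) ℓ ≉ 0#)
    (triple≉0 : ∀ i → sum (λ m → pairing (a i m) ℓ * Generic.P generic i m) ≉ 0#)
    where

    open Spectrum a D T T≋∑ f g generic hiding (h)
    open Algorithm (ScalarField.rawRing K) scalar r T f g ℓ

    private
      -- `Fin (3 * r)` splits as `Fin 3 × Fin r`, hence the `swap`; `concat a` is indexed by
      -- `Fin (r * 3)`, in the other order.
      index : Fin (3 ℕ.* r) → Fin r × Fin 3
      index p = swap (remQuot {3} r p)

      index-combine : ∀ i k → index (combine k i) ≡ (i , k)
      index-combine i k = cong swap (remQuot-combine k i)

      index-injective : ∀ {p q} → index p ≡ index q → p ≡ q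
      index-injective {p} {q} eq = ≡.trans (≡.sym (combine-remQuot {3} r p))
        (≡.trans (cong (λ (i , k) → combine k i) eq) (combine-remQuot {3} r q))

      λ-at : Fin r × Fin 3 → Carrier
      λ-at (i , k) = eigenvalue i k

      is-root : Carrier → Fin r × Fin 3 → Set
      is-root μ (i , k) = η μ i k ≈ 0#

    eigenpairs : Eigenpairs
    eigenpairs = record
      { value     = λ p → λ-at (index p)
      ; vector    = λ p → eigenvector (root p)
      ; distinct  = λ {p} {q} eq → index-injective
          (root-unique (root p) (trans (η-cong (proj₁ (index q)) (proj₂ (index q)) eq) (root q)))
      ; solutions = λ μ → mk⇔ (to μ) (from μ)
      ; nonzero   = λ p → eigenvector-nonzero (root p)
      ; kernel    = λ p → eigenvector-kernel (root p)
      }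
      where
      root : ∀ p → is-root (λ-at (index p)) (index p)
      root p = eigenvalue-root (proj₁ (index p)) (proj₂ (index p))
      to : ∀ μ → det (pencil (contract T f) μ (contract T g)) ≈ 0# → ∃ λ p → μ ≈ λ-at (index p)
      to μ det≈0 = combine k i , trans μ≈λ (reflexive (cong λ-at (≡.sym (index-combine i k))))
        where
        ik-root : ∃ λ ((i , k) : Fin r × Fin 3) → η μ i k ≈ 0#
        ik-root = singular⇒root det≈0
        i : Fin r
        i = proj₁ (proj₁ ik-root)
        k : Fin 3
        k = proj₂ (proj₁ ik-root)
        μ≈λ : μ ≈ eigenvalue i k
        μ≈λ = root-value (proj₂ ik-root) (eigenvalue-root i k)
      from : ∀ μ → (∃ λ p → μ ≈ λ-at (index p)) → det (pencil (contract T f) μ (contract T g)) ≈ 0#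
      from μ (p , μ≈λ) = root⇒singular (trans (η-cong (proj₁ (index p)) (proj₂ (index p)) μ≈λ) (root p))

    module _ (E : Eigenpairs) where

      open Eigenpairs E

      private
        located : ∀ p → ∃ (is-root (value p))
        located p = singular⇒root (Equivalence.from (solutions (value p)) (p , refl))

      -- Given eigenpairs mention only values and vectors; this recovers the linear form whose root
      -- each value is. It is a bijection since the values are distinct and exhaust the spectrum.
      locate : Fin (3 ℕ.* r) → Fin r × Fin 3
      locate p = proj₁ (located p)

      locate-root : ∀ p → is-root (value p) (locate p)
      locate-root p = proj₂ (located p)

      unlocate : Fin r × Fin 3 → Fin (3 ℕ.* r)
      unlocate (i , k) =
        proj₁ (Equivalence.to (solutions (eigenvalue i k)) (root⇒singular (eigenvalue-root i k)))

      locate-unlocate : ∀ ik → locate (unlocate ik) ≡ ik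
      locate-unlocate (i , k) = root-unique (locate-root (unlocate (i , k)))
        (trans (sym (η-cong i k
            (proj₂ (Equivalence.to (solutions (eigenvalue i k)) (root⇒singular (eigenvalue-root i k))))))
          (eigenvalue-root i k))

      locate-injective : ∀ {p q} → locate p ≡ locate q → p ≡ q
      locate-injective {p} {q} eq = distinct (root-value (locate-root p)
        (≡.subst (is-root (value q)) (≡.sym eq) (locate-root q)))

      unlocate-locate : ∀ p → unlocate (locate p) ≡ p
      unlocate-locate p = locate-injective (locate-unlocate (locate p))

      located-eigenvector : ∀ p → IsEigenvector (proj₁ (locate p)) (proj₂ (locate p)) (vector p)
      located-eigenvector p = isEigenvector (locate-root p) (nonzero p) (kernel p)

      same-term : ∀ p q → (¬ (pairing (vector q) (contract T ℓ · vector p) ≈ 0#)) ⇔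
                          (proj₁ (locate q) ≡ proj₁ (locate p))
      same-term p q = mk⇔
        (λ ≉0 → stable λ other →
          ≉0 (pairing-elsewhere ℓ (located-eigenvector p) (located-eigenvector q) other))
        (λ eq → pairing-here ℓ (ψ≉0 (proj₁ (locate p))) (triple≉0 (proj₁ (locate p)))
          (located-eigenvector p)
          (≡.subst (λ j → IsEigenvector j (proj₂ (locate q)) (vector q)) eq (located-eigenvector q)))

      triples : Triples E
      triples = record
        { label     = mk↔ₛ′ unlocate locate unlocate-locate locate-unlocate
        ; partition = λ i k i′ k′ → ≡.subst₂
            (λ j j′ → (¬
                (pairing (vector (unlocate (i′ , k′))) (contract T ℓ · vector (unlocate (i , k)))
                    ≈ 0#)) ⇔ (j′ ≡ j))
            (cong proj₁ (locate-unlocate (i , k))) (cong proj₁ (locate-unlocate (i′ , k′)))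
            (same-term (unlocate (i , k)) (unlocate (i′ , k′)))
        }

      module _ (G : Triples E) where

        open Triples G

        -- ρ compares the given labelling with the one by roots, and the two agree
        -- once the decomposition is relabelled by ρ.
        private
          ρ ρ⁻¹ : Fin r × Fin 3 → Fin r × Fin 3
          ρ   ik = locate (Inverse.to label ik)
          ρ⁻¹ jl = Inverse.from label (unlocate jl)

          ρ-ρ⁻¹ : ∀ jl → ρ (ρ⁻¹ jl) ≡ jl
          ρ-ρ⁻¹ jl =
            ≡.trans (cong locate (Inverse.strictlyInverseˡ label (unlocate jl))) (locate-unlocate jl)

          ρ-injective : ∀ {ik jl} → ρ ik ≡ ρ jl → ik ≡ jl
          ρ-injective {ik} {jl} eq = ≡.trans (≡.sym (Inverse.strictlyInverseʳ label ik))
            (≡.trans (cong (Inverse.from label) (locate-injective eq))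
                (Inverse.strictlyInverseʳ label jl))

          -- The given partition and `same-term` both characterise the nonvanishing of the same
          -- pairing, so `ρ` carries triples to whole terms. It therefore splits into a permutation
          -- `σ` of the terms and bijections `κ i` of the factors.
          ρ-term : ∀ i k i′ k′ → (proj₁ (ρ (i′ , k′)) ≡ proj₁ (ρ (i , k))) ⇔ (i′ ≡ i)
          ρ-term i k i′ k′ = mk⇔
            (Equivalence.to (partition i k i′ k′) ∘ Equivalence.from (same-term _ _))
            (Equivalence.to (same-term _ _) ∘ Equivalence.from (partition i k i′ k′))

          σ : Fin r → Fin r
          σ i = proj₁ (ρ (i , 0F))

          κ : Fin r → Fin 3 → Fin 3
          κ i k = proj₂ (ρ (i , k))

          ρ≡ : ∀ i k → proj₁ (ρ (i , k)) ≡ σ i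
          ρ≡ i k = Equivalence.from (ρ-term i 0F i k) ≡.refl

          σ-injective : ∀ {i j} → σ i ≡ σ j → i ≡ j
          σ-injective {i} {j} = Equivalence.to (ρ-term j 0F i 0F)

          κ-injective : ∀ i {k l} → κ i k ≡ κ i l → k ≡ l
          κ-injective i {k} {l} eq = cong proj₂ (ρ-injective {i , k} {i , l}
            (≡.cong₂ _,_ (≡.trans (ρ≡ i k) (≡.sym (ρ≡ i l))) eq))

          σ⁻¹ : Fin r → Fin r
          σ⁻¹ j = proj₁ (ρ⁻¹ (j , 0F))

          σ-σ⁻¹ : ∀ j → σ (σ⁻¹ j) ≡ j
          σ-σ⁻¹ j = ≡.trans (≡.sym (ρ≡ (σ⁻¹ j) (proj₂ (ρ⁻¹ (j , 0F))))) (cong proj₁ (ρ-ρ⁻¹ (j , 0F)))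

          σ-permutation : Permutation r r
          σ-permutation = mk↔ₛ′ σ σ⁻¹ σ-σ⁻¹ (λ i → σ-injective (σ-σ⁻¹ (σ i)))

          -- Defined through `ρ` and not through `σ` and `κ`, so that `locate-root` is by definition
          -- the hypothesis `labelled`.
          ã : Fin r → Fin 3 → Vect n
          ã i k = a (proj₁ (ρ (i , k))) (proj₂ (ρ (i , k)))

          symProduct-ã : ∀ i → symProduct (ã i) ≋ symProduct (a (σ i))
          symProduct-ã i p q s = trans
            (symProduct-cong {v = ã i} {w = a (σ i) ∘ κ i} (λ k j → reflexive (cong (λ t →
              a t (κ i k) j) (ρ≡ i k))) p q s)
            (symProduct-permute (a (σ i)) (κ i) (κ-injective i) p q s)

          T≋∑ã : T ≋ ∑ₜ (λ i → symProduct (ã i))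
          T≋∑ã p q s = trans (T≋∑ p q s)
            (trans (sum-permute (λ i → symProduct (a i) p q s) σ-permutation)
              (sum-cong-≋ λ i → sym (symProduct-ã i p q s)))

          D̃ : DualBasis ã
          D̃ = record
            { b          = λ i k → b (proj₁ (ρ (i , k))) (proj₂ (ρ (i , k)))
            ; dual-same  = λ i k → dual-same (proj₁ (ρ (i , k))) (proj₂ (ρ (i , k)))
            ; dual-other = λ {i} {k} {j} {l} ik≢jl → dual-other (ik≢jl ∘ ρ-injective {i , k} {j , l})
            ; faithful   = λ x x⊥ã → faithful x λ j l →
                ≡.subst (λ (j , l) → pairing (a j l) x ≈ 0#) (ρ-ρ⁻¹ (j , l))
                  (x⊥ã (proj₁ (ρ⁻¹ (j , l))) (proj₂ (ρ⁻¹ (j , l))))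
            }

          generic̃ : Generic (λ i k → pairing (ã i k) f) (λ i k → pairing (ã i k) g)
          generic̃ = record
            { φ≉0       = λ i k → φ≉0 (proj₁ (ρ (i , k))) (proj₂ (ρ (i , k)))
            ; γ≉0       = λ i k → γ≉0 (proj₁ (ρ (i , k))) (proj₂ (ρ (i , k)))
            ; separated = λ {i} {k} {j} {l} ik≢jl → separated (ik≢jl ∘ ρ-injective {i , k} {j , l})
            }

          module Run = LabelledRun ã D̃ T T≋∑ã f g ℓ generic̃ E G
            (λ i k → locate-root (Inverse.to label (i , k)))

        factors : Factors G
        factors = Run.factors

        coefficients : (F : Factors G) → Coefficients F
        coefficients = Run.coefficients

        -- The target family is any `S` equivalent to the products, because in the application it is
        -- the image of products formed over the base field.
        output≐ : (F : Factors G) (C : Coefficients F) {S : Vector (Tensor n) r} →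
                  (∀ i → S i ≋ symProduct (a i)) → ⟪ Coefficients.output C ⟫ ≐ ⟪ S ⟫
        output≐ F C {S} S≋ = (λ (i , V≋) → σ i , λ p q s → trans (V≋ p q s) (output≋S i p q s))
                      , (λ {V} (j , V≋) → σ⁻¹ j , λ p q s → trans (V≋ p q s)
                          (trans (reflexive (cong (λ t → S t p q s) (≡.sym (σ-σ⁻¹ j))))
                            (sym (output≋S (σ⁻¹ j) p q s))))
          where
          output≋S : ∀ i → Coefficients.output C i ≋ S (σ i)
          output≋S i p q s = trans (Run.output≋ F C i p q s)
            (trans (symProduct-ã i p q s) (sym (S≋ (σ i) p q s)))

    produces : {S : Vector (Tensor n) r} → (∀ i → S i ≋ symProduct (a i)) → Produces ⟪ S ⟫
    produces S≋ = eigenpairs , λ E → triples E , λ G → factors E G , λ F →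
      coefficients E G F , λ C → output≐ E G F C S≋

-- Genericity

open import Tactic.RingSolver.Core.Expression using (Expr; Κ; Ι; _⊕_; _⊗_; ⊝_)

module Genericity (em : ExcludedMiddle 0ℓ) (K : ScalarField) where

  open AlgorithmTheory em K public
  open Zariski (ScalarField.rawRing K) using (evaluate)

  -- The matrices of `v` and `b` are inverse to each other on both sides. Being finitely many
  -- equations, this passes to a larger field, unlike independence or `faithful`, which quantify
  -- over scalars or vectors.
  record BiorthogonalBasis {m n} (v : Fin m → Vect n) : Set where
    field
      b          : Fin m → Vect n
      dual       : ∀ p q → pairing (v p) (b q) ≈ unit p q
      resolution : ∀ j → unit j ≋ᵥ combination (λ p → b p j) v

  -- `B j` holds the coordinates of the j-th unit vector, so `resolution` holds by construction.
  -- Expanding `v p` through the unit vectors must return the trivial expansion by independence, and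
  -- this is `dual`.
  biorthogonalBasis : ∀ {m n} → m ≡ n → (v : Fin m → Vect n) → LinearlyIndependent v → BiorthogonalBasis v
  biorthogonalBasis {n = n} ≡.refl v independent = record
    { b          = λ q j → B j q
    ; dual       = dual
    ; resolution = resolution
    }
    where
    B : Fin n → Vect n
    B j = proj₁ (independent⇒spanning v independent (unit j))
    resolution : ∀ j → unit j ≋ᵥ combination (B j) v
    resolution j = proj₂ (independent⇒spanning v independent (unit j))
    expansion : ∀ p → combination (combination (v p) B) v ≋ᵥ v p
    expansion p i = begin
      combination (combination (v p) B) v i        ≈⟨ combination-assoc (v p) B v i ⟩
      sum (λ j → v p j * combination (B j) v i)
        ≈⟨ sum-cong-≋ (λ j → *-congˡ {v p j} (resolution j i)) ⟨
      sum (λ j → v p j * unit j i)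
        ≈⟨ sum-single i (λ j j≢i → *-zeroʳ-≈ (v p j) (unit-other (j≢i ∘ ≡.sym))) ⟩
      v p i * unit i i
        ≈⟨ trans (*-congˡ (unit-same i)) (*-identityʳ (v p i)) ⟩
      v p i                                        ∎
    dual : ∀ p q → combination (v p) B q ≈ unit p q
    dual p q = begin
      x q                               ≈⟨ solve 2 (λ x y → x := (x :- y) :+ y) refl (x q) (unit p q) ⟩
      x q + - unit p q + unit p q       ≈⟨ +-congʳ (independent (λ q → x q + - unit p q) relation q) ⟩
      0# + unit p q                     ≈⟨ +-identityˡ (unit p q) ⟩
      unit p q                          ∎
      where
      x : Vect n
      x = combination (v p) B
      relation : combination (λ q → x q + - unit p q) v ≋ᵥ 0ᵥ
      relation i = begin
        sum (λ q → (x q + - unit p q) * v q i)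
          ≈⟨ sum-cong-≋ (λ q → solve 3 (λ x u v → (x :- u) :* v := x :* v :+ (:- con (+ 1)) :* (u :* v))
               refl (x q) (unit p q) (v q i)) ⟩
        sum (λ q → x q * v q i + - 1# * (unit p q * v q i))
          ≈⟨ sum-linear (λ q → x q * v q i) (λ q → unit p q * v q i) (- 1#) ⟩
        combination x v i + - 1# * combination (unit p) v i
          ≈⟨ +-cong (expansion p i) (*-congˡ (combination-unit p v i)) ⟩
        v p i + - 1# * v p i
          ≈⟨ solve 1 (λ x → x :+ (:- con (+ 1)) :* x := con (+ 0)) refl (v p i) ⟩
        0# ∎

  concat-combine : ∀ {n r} (a : Fin r → Fin 3 → Vect n) i k → concat a (combine i k) ≡ a i k
  concat-combine a i k = cong (λ (j , l) → a j l) (remQuot-combine i k)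

  dualBasis : ∀ {n r} (a : Fin r → Fin 3 → Vect n) → BiorthogonalBasis (concat a) → DualBasis a
  dualBasis {n} {r} a basis = record
    { b          = λ i k → b (combine i k)
    ; dual-same  = λ i k → trans (dual-at i k i k) (unit-same (combine i k))
    ; dual-other = λ {i} {k} {j} {l} ik≢jl → trans (dual-at i k j l)
        (unit-other λ eq → ik≢jl (let j≡i , l≡k = combine-injective j l i k eq in
          ≡.sym (≡.cong₂ _,_ j≡i l≡k)))
    ; faithful   = faithful
    }
    where
    open BiorthogonalBasis basis
    dual-at : ∀ i k j l → pairing (a i k) (b (combine j l)) ≈ unit (combine i k) (combine j l)
    dual-at i k j l = trans
      (reflexive (cong (λ u → pairing u (b (combine j l))) (≡.sym (concat-combine a i k))))
      (dual (combine i k) (combine j l))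
    faithful : ∀ x → (∀ i k → pairing (a i k) x ≈ 0#) → x ≋ᵥ 0ᵥ
    faithful x x⊥a j = begin
      x j
        ≈⟨ trans (*-congˡ (unit-same j)) (*-identityʳ (x j)) ⟨
      x j * unit j j
        ≈⟨ sum-single j (λ i i≢j → *-zeroʳ-≈ (x i) (unit-other i≢j)) ⟨
      pairing x (unit j)
        ≈⟨ pairing-congʳ x (resolution j) ⟩
      pairing x (combination (λ p → b p j) (concat a))
        ≈⟨ pairing-sumʳ x (λ p → b p j) (concat a) ⟩
      sum (λ p → b p j * pairing x (concat a p))
        ≈⟨ sum-zero (λ p → *-zeroʳ-≈ (b p j) (trans (pairing-comm x (concat a p)) (x⊥a _ _))) ⟩
      0# ∎

  record Nondegenerate {r} (φ γ ψ : Fin r → Fin 3 → Carrier) : Set where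
    field
      generic : Generic φ γ
      ψ≉0     : ∀ i k → ψ i k ≉ 0#
      triple≉0 : ∀ i → sum (λ m →
        ψ i m * (φ i (next m) * γ i (prev m) + - (φ i (prev m) * γ i (next m)))) ≉ 0#
    open Generic generic public using (φ≉0; γ≉0; separated)

  module _ {m : ℕ} where

    ∑ₑ ∏ₑ : ∀ {k} → (Fin k → Expr Carrier m) → Expr Carrier m
    ∑ₑ {zero}  e = Κ 0#
    ∑ₑ {suc k} e = e zero ⊕ ∑ₑ (e ∘ suc)
    ∏ₑ {zero}  e = Κ 1#
    ∏ₑ {suc k} e = e zero ⊗ ∏ₑ (e ∘ suc)

    evaluate-∑ₑ : ∀ {k} (e : Fin k → Expr Carrier m) w → evaluate (∑ₑ e) w ≡ sum (λ i → evaluate (e i) w)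
    evaluate-∑ₑ {zero}  e w = ≡.refl
    evaluate-∑ₑ {suc k} e w = cong (λ s → evaluate (e zero) w + s) (evaluate-∑ₑ (e ∘ suc) w)

    ∏ₑ-nonzero : ∀ {k} (e : Fin k → Expr Carrier m) w → (∀ i → evaluate (e i) w ≉ 0#) →
      evaluate (∏ₑ e) w ≉ 0#
    ∏ₑ-nonzero {zero}  e w e≉0 = 1≉0
    ∏ₑ-nonzero {suc k} e w e≉0 = *-nonzero (e≉0 zero) (∏ₑ-nonzero (e ∘ suc) w (e≉0 ∘ suc))

    ∏ₑ-factor : ∀ {k} (e : Fin k → Expr Carrier m) w → evaluate (∏ₑ e) w ≉ 0# → ∀ i →
      evaluate (e i) w ≉ 0#
    ∏ₑ-factor e w ∏≉0 zero    eq = ∏≉0 (*-zeroˡ-≈ _ eq)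
    ∏ₑ-factor e w ∏≉0 (suc i) = ∏ₑ-factor (e ∘ suc) w (λ eq → ∏≉0 (*-zeroʳ-≈ _ eq)) i

  factorˡ : ∀ {x y} → x * y ≉ 0# → x ≉ 0#
  factorˡ xy≉0 x≈0 = xy≉0 (*-zeroˡ-≈ _ x≈0)

  factorʳ : ∀ {x y} → x * y ≉ 0# → y ≉ 0#
  factorʳ xy≉0 y≈0 = xy≉0 (*-zeroʳ-≈ _ y≈0)

  module Discriminant {n r} (a : Fin r → Fin 3 → Vect n) where

    Point : Set
    Point = Vect (n ℕ.+ (n ℕ.+ n))

    linear : (Fin n → Fin (n ℕ.+ (n ℕ.+ n))) → Fin r → Fin 3 → Expr Carrier (n ℕ.+ (n ℕ.+ n))
    linear position i k = ∑ₑ (λ j → Κ (a i k j) ⊗ Ι (position j))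

    Φ Γ Ψ : Fin r → Fin 3 → Expr Carrier (n ℕ.+ (n ℕ.+ n))
    Φ = linear (_↑ˡ (n ℕ.+ n))
    Γ = linear (λ j → n ↑ʳ (j ↑ˡ n))
    Ψ = linear (λ j → n ↑ʳ (n ↑ʳ j))

    evaluate-linear : ∀ position w {f} → (∀ j → w (position j) ≡ f j) → ∀ i k →
                      evaluate (linear position i k) w ≈ pairing (a i k) f
    evaluate-linear position w w≡f i k = trans
      (reflexive (evaluate-∑ₑ (λ j → Κ (a i k j) ⊗ Ι (position j)) w))
      (sum-cong-≋ λ j → *-congˡ {a i k j} (reflexive (≡.trans (lookup∘tabulate w (position j)) (w≡f j))))

    module _ (f g ℓ : Vect n) where

      evaluate-Φ : ∀ i k → evaluate (Φ i k) (f ++ g ++ ℓ) ≈ pairing (a i k) f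
      evaluate-Φ = evaluate-linear _ (f ++ g ++ ℓ) (lookup-++ˡ f (g ++ ℓ))

      evaluate-Γ : ∀ i k → evaluate (Γ i k) (f ++ g ++ ℓ) ≈ pairing (a i k) g
      evaluate-Γ = evaluate-linear _ (f ++ g ++ ℓ) λ j →
        ≡.trans (lookup-++ʳ f (g ++ ℓ) (j ↑ˡ n)) (lookup-++ˡ g ℓ j)

      evaluate-Ψ : ∀ i k → evaluate (Ψ i k) (f ++ g ++ ℓ) ≈ pairing (a i k) ℓ
      evaluate-Ψ = evaluate-linear _ (f ++ g ++ ℓ) λ j →
        ≡.trans (lookup-++ʳ f (g ++ ℓ) (n ↑ʳ j)) (lookup-++ʳ g ℓ j)

    -- An index paired with itself contributes the factor 1, which lets the products run over all
    -- pairs.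
    separation : (i : Fin r) (k : Fin 3) (j : Fin r) (l : Fin 3) → Expr Carrier (n ℕ.+ (n ℕ.+ n))
    separation i k j l with ≡-dec _≟_ _≟_ (i , k) (j , l)
    ... | yes _ = Κ 1#
    ... | no  _ = Φ i k ⊗ Γ j l ⊕ ⊝ (Φ j l ⊗ Γ i k)

    nonzeros separations entries : Fin r → Fin 3 → Expr Carrier (n ℕ.+ (n ℕ.+ n))
    nonzeros    i k = Φ i k ⊗ (Γ i k ⊗ Ψ i k)
    separations i k = ∏ₑ (λ j → ∏ₑ (separation i k j))
    entries     i k = nonzeros i k ⊗ separations i k

    tripleTerm : Fin r → Fin 3 → Expr Carrier (n ℕ.+ (n ℕ.+ n))
    tripleTerm i m = Ψ i m ⊗ (Φ i (next m) ⊗ Γ i (prev m) ⊕ ⊝ (Φ i (prev m) ⊗ Γ i (next m)))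

    blocks : Fin r → Expr Carrier (n ℕ.+ (n ℕ.+ n))
    blocks i = ∑ₑ (tripleTerm i) ⊗ ∏ₑ (entries i)

    discriminant : Expr Carrier (n ℕ.+ (n ℕ.+ n))
    discriminant = ∏ₑ blocks

    module _ (w : Point) where

      φ γ ψ : Fin r → Fin 3 → Carrier
      φ i k = evaluate (Φ i k) w
      γ i k = evaluate (Γ i k) w
      ψ i k = evaluate (Ψ i k) w

      nondegenerate⇒discriminant≉0 : Nondegenerate φ γ ψ → evaluate discriminant w ≉ 0#
      nondegenerate⇒discriminant≉0 nondegenerate = ∏ₑ-nonzero blocks w λ i → *-nonzero (triple-value i)
        (∏ₑ-nonzero (entries i) w λ k → *-nonzero (*-nonzero (φ≉0 i k) (*-nonzero (γ≉0 i k) (ψ≉0 i k)))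
          (∏ₑ-nonzero (λ j → ∏ₑ (separation i k j)) w λ j →
            ∏ₑ-nonzero (separation i k j) w λ l → separation≉0 i k j l))
        where
        open Nondegenerate nondegenerate
        triple-value : ∀ i → evaluate (∑ₑ (tripleTerm i)) w ≉ 0#
        triple-value i eq = triple≉0 i (trans (reflexive (≡.sym (evaluate-∑ₑ (tripleTerm i) w))) eq)
        separation≉0 : ∀ i k j l → evaluate (separation i k j l) w ≉ 0#
        separation≉0 i k j l with ≡-dec _≟_ _≟_ (i , k) (j , l)
        ... | yes _     = 1≉0
        ... | no  ik≢jl = separated ik≢jl

      separation-value : ∀ {i k j l} → (i , k) ≢ (j , l) →
        evaluate (separation i k j l) w ≡ φ i k * γ j l + - (φ j l * γ i k)
      separation-value {i} {k} {j} {l} ik≢jl with ≡-dec _≟_ _≟_ (i , k) (j , l)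
      ... | yes ik≡jl = contradiction ik≡jl ik≢jl
      ... | no  _     = ≡.refl

      discriminant≉0⇒nondegenerate : evaluate discriminant w ≉ 0# → Nondegenerate φ γ ψ
      discriminant≉0⇒nondegenerate P≉0 = record
        { generic  = record
          { φ≉0       = λ i k → factorˡ (factorˡ (entry≉0 i k))
          ; γ≉0       = λ i k → factorˡ (factorʳ (factorˡ (entry≉0 i k)))
          ; separated = λ {i} {k} {j} {l} ik≢jl eq →
              ∏ₑ-factor (separation i k j) w
                (∏ₑ-factor (λ j → ∏ₑ (separation i k j)) w (factorʳ (entry≉0 i k)) j) l
                (trans (reflexive (separation-value ik≢jl)) eq)
          }
        ; ψ≉0      = λ i k → factorʳ (factorʳ (factorˡ (entry≉0 i k)))
        ; triple≉0 = λ i eq → factorˡ (∏ₑ-factor blocks w P≉0 i)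
            (trans (reflexive (evaluate-∑ₑ (tripleTerm i) w)) eq)
        }
        where
        entry≉0 : ∀ i k → evaluate (nonzeros i k) w * evaluate (separations i k) w ≉ 0#
        entry≉0 i = ∏ₑ-factor (entries i) w (factorʳ (∏ₑ-factor blocks w P≉0 i))

  -- With γ = 1 and ψ = φ², the triple products are Vandermonde determinants.
  module Witness (r : ℕ) where

    -- Built directly in lowest terms, so that injectivity is read off the numerator.
    natural : ℕ → ℚ
    natural n = ℚ.mkℚ (+ n) 0 (Coprimality.sym (Coprimality.1-coprimeTo n))

    natural-injective : ∀ {m n} → natural m ≡ natural n → m ≡ n
    natural-injective eq = ℤ.+-injective (cong ℚ.numerator eq)

    -- The values are 1, ..., 3r; the successor keeps zero out.
    t : Fin r → Fin 3 → Carrier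
    t i k = scalar (natural (suc (toℕ (combine i k))))

    t≉0 : ∀ i k → t i k ≉ 0#
    t≉0 i k t≈0 with () ← natural-injective {n = 0} (scalar-injective (trans t≈0 (sym scalar-0)))

    t-distinct : ∀ {i k j l} → (i , k) ≢ (j , l) → t i k + - t j l ≉ 0#
    t-distinct {i} {k} {j} {l} ik≢jl eq = ik≢jl (≡.cong₂ _,_ (proj₁ same) (proj₂ same))
      where
      t≈ : t i k ≈ t j l
      t≈ = begin
        t i k                       ≈⟨ solve 2 (λ x y → x := (x :- y) :+ y) refl (t i k) (t j l) ⟩
        t i k + - t j l + t j l     ≈⟨ +-congʳ eq ⟩
        0# + t j l                  ≈⟨ +-identityˡ (t j l) ⟩
        t j l                       ∎
      same : i ≡ j × k ≡ l
      same =
        combine-injective i k j l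
            (toℕ-injective (ℕ.suc-injective (natural-injective (scalar-injective t≈))))

    nondegenerate : Nondegenerate t (λ _ _ → 1#) (λ i k → t i k * t i k)
    nondegenerate = record
      { generic  = record
        { φ≉0       = t≉0
        ; γ≉0       = λ _ _ → 1≉0
        ; separated = λ {i} {k} {j} {l} ik≢jl eq → t-distinct ik≢jl
            (trans (sym (+-cong (*-identityʳ (t i k)) (-‿cong (*-identityʳ (t j l))))) eq)
        }
      ; ψ≉0      = λ i k → *-nonzero (t≉0 i k) (t≉0 i k)
      ; triple≉0 = λ i eq → *-nonzero (*-nonzero
          (t-distinct {i} {1F} {i} {0F} λ ()) (t-distinct {i} {1F} {i} {2F} λ ()))
              (t-distinct {i} {2F} {i} {0F} λ ())
          (trans (vandermonde (t i 0F) (t i 1F) (t i 2F)) eq)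
      }
      where
      vandermonde : ∀ x y z → (y + - x) * (y + - z) * (z + - x) ≈
        x * x * (y * 1# + - (z * 1#)) +
            (y * y * (z * 1# + - (x * 1#)) + (z * z * (x * 1# + - (y * 1#)) + 0#))
      vandermonde = solve 3 (λ x y z → (y :- x) :* (y :- z) :* (z :- x) :=
        x :* x :* (y :* con (+ 1) :- z :* con (+ 1)) :+ (y :* y :* (z :* con (+ 1) :- x :* con (+ 1))
          :+ (z :* z :* (x :* con (+ 1) :- y :* con (+ 1)) :+ con (+ 0)))) refl

-- Transfer along a field embedding

record Embedding (K L : ScalarField) : Set where
  private
    module K = ScalarField K
    module L = ScalarField L
  field
    ι           : K.Carrier → L.Carrier
    ι-cong      : ∀ {x y} → x K.≈ y → ι x L.≈ ι y
    ι-injective : ∀ {x y} → ι x L.≈ ι y → x K.≈ y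
    ι-+         : ∀ x y → ι (x K.+ y) L.≈ ι x L.+ ι y
    ι-*         : ∀ x y → ι (x K.* y) L.≈ ι x L.* ι y
    ι--         : ∀ x → ι (K.- x) L.≈ L.- ι x
    ι-0         : ι K.0# L.≈ L.0#
    ι-1         : ι K.1# L.≈ L.1#
    ι-scalar    : ∀ q → ι (K.scalar q) L.≈ L.scalar q

module Transfer (em : ExcludedMiddle 0ℓ) (K L : ScalarField) (embedding : Embedding K L) where

  open Embedding embedding
  module K = Genericity em K
  module L = Genericity em L

  mapVect : ∀ {n} → K.Vect n → L.Vect n
  mapVect v i = ι (v i)

  mapTensor : ∀ {n} → K.Tensor n → L.Tensor n
  mapTensor S i j k = ι (S i j k)

  ι-≉0 : ∀ {x} → x K.≉ K.0# → ι x L.≉ L.0#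
  ι-≉0 x≉0 ιx≈0 = x≉0 (ι-injective (L.trans ιx≈0 (L.sym ι-0)))

  ι-sum : ∀ {n} (f : Fin n → K.Carrier) → ι (K.sum f) L.≈ L.sum (ι ∘ f)
  ι-sum {zero}  f = ι-0
  ι-sum {suc n} f = L.trans (ι-+ _ _) (L.+-congˡ (ι-sum (f ∘ suc)))

  ι-unit : ∀ {n} (i j : Fin n) → ι (K.unit i j) L.≈ L.unit i j
  ι-unit i j with j ≟ i
  ... | yes _ = ι-1
  ... | no  _ = ι-0

  ι-pairing : ∀ {n} (u v : K.Vect n) → ι (K.pairing u v) L.≈ L.pairing (mapVect u) (mapVect v)
  ι-pairing u v = L.trans (ι-sum (λ i → u i K.* v i)) (L.sum-cong-≋ λ i → ι-* (u i) (v i))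

  ι-symProduct : ∀ {n} (v : Fin 3 → K.Vect n) → mapTensor (K.symProduct v) L.≋ L.symProduct (mapVect ∘ v)
  ι-symProduct v p q r = L.trans (ι-* _ _) (L.*-cong (ι-scalar _)
    (plus (plus (plus (plus (plus (term 0F 1F 2F) (term 0F 2F 1F)) (term 1F 0F 2F)) (term 1F 2F 0F))
        (term 2F 0F 1F)) (term 2F 1F 0F)))
    where
    plus : ∀ {x y x′ y′} → ι x L.≈ x′ → ι y L.≈ y′ → ι (x K.+ y) L.≈ x′ L.+ y′
    plus x≈ y≈ = L.trans (ι-+ _ _) (L.+-cong x≈ y≈)
    term : ∀ a b c → ι (v a p K.* v b q K.* v c r) L.≈ ι (v a p) L.* ι (v b q) L.* ι (v c r)
    term a b c = L.trans (ι-* _ _) (L.*-congʳ (ι-* _ _))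

  ι-∑ₜ : ∀ {n r} {T : K.Tensor n} (a : Fin r → Fin 3 → K.Vect n) → T K.≋ K.∑ₜ (λ i → K.symProduct (a i)) →
         mapTensor T L.≋ L.∑ₜ (λ i → L.symProduct (mapVect ∘ a i))
  ι-∑ₜ a T≋∑ p q s = L.trans (ι-cong (T≋∑ p q s))
    (L.trans (ι-sum (λ i → K.symProduct (a i) p q s)) (L.sum-cong-≋ λ i → ι-symProduct (a i) p q s))

  map-biorthogonal : ∀ {m n} {v : Fin m → K.Vect n} → K.BiorthogonalBasis v →
    L.BiorthogonalBasis (mapVect ∘ v)
  map-biorthogonal {v = v} basis = record
    { b          = mapVect ∘ b
    ; dual       = λ p q → L.trans (L.sym (ι-pairing (v p) (b q)))
        (L.trans (ι-cong (dual p q)) (ι-unit p q))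
    ; resolution = λ j i → L.trans (L.sym (ι-unit j i)) (L.trans (ι-cong (resolution j i))
        (L.trans (ι-sum (λ p → b p j K.* v p i)) (L.sum-cong-≋ λ p → ι-* (b p j) (v p i))))
    }
    where open K.BiorthogonalBasis basis

  ι-cross : ∀ {x y z w x′ y′ z′ w′} → ι x L.≈ x′ → ι y L.≈ y′ → ι z L.≈ z′ → ι w L.≈ w′ →
            ι (x K.* y K.+ K.- (z K.* w)) L.≈ x′ L.* y′ L.+ L.- (z′ L.* w′)
  ι-cross x≈ y≈ z≈ w≈ = L.trans (ι-+ _ _) (L.+-cong
    (L.trans (ι-* _ _) (L.*-cong x≈ y≈))
    (L.trans (ι-- _) (L.-‿cong (L.trans (ι-* _ _) (L.*-cong z≈ w≈)))))

  -- The target values need only be equivalent to the images. This absorbs the passage from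
  -- evaluated polynomials to pairings, and with the identity embedding it also rewrites such values
  -- within one field.
  map-nondegenerate : ∀ {r} {φ γ ψ : Fin r → Fin 3 → K.Carrier} {φ′ γ′ ψ′ : Fin r → Fin 3 → L.Carrier} →
    (∀ i k → ι (φ i k) L.≈ φ′ i k) → (∀ i k → ι (γ i k) L.≈ γ′ i k) → (∀ i k → ι (ψ i k) L.≈ ψ′ i k) →
    K.Nondegenerate φ γ ψ → L.Nondegenerate φ′ γ′ ψ′
  map-nondegenerate {φ = φ} {γ} {ψ} φ≈ γ≈ ψ≈ nondegenerate = record
    { generic  = record
      { φ≉0       = λ i k → transfer (φ≈ i k) (φ≉0 i k)
      ; γ≉0       = λ i k → transfer (γ≈ i k) (γ≉0 i k)
      ; separated = λ {i} {k} {j} {l} ik≢jl →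
          transfer (ι-cross (φ≈ i k) (γ≈ j l) (φ≈ j l) (γ≈ i k)) (separated ik≢jl)
      }
    ; ψ≉0      = λ i k → transfer (ψ≈ i k) (ψ≉0 i k)
    ; triple≉0 = λ i → transfer
        (L.trans (ι-sum (λ m →
          ψ i m K.* (φ i (next m) K.* γ i (prev m) K.+ K.- (φ i (prev m) K.* γ i (next m)))))
          (L.sum-cong-≋ λ m → L.trans (ι-* _ _) (L.*-cong (ψ≈ i m)
            (ι-cross (φ≈ i (next m)) (γ≈ i (prev m)) (φ≈ i (prev m)) (γ≈ i (next m))))))
        (triple≉0 i)
    }
    where
    open K.Nondegenerate nondegenerate
    transfer : ∀ {x x′} → ι x L.≈ x′ → x K.≉ K.0# → x′ L.≉ L.0#
    transfer x≈ x≉0 x′≈0 = ι-≉0 x≉0 (L.trans x≈ x′≈0)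

identity : ∀ K → Embedding K K
identity K = record
  { ι           = id
  ; ι-cong      = id
  ; ι-injective = id
  ; ι-+         = λ _ _ → refl
  ; ι-*         = λ _ _ → refl
  ; ι--         = λ _ → refl
  ; ι-0         = refl
  ; ι-1         = refl
  ; ι-scalar    = λ _ → refl
  }
  where open ScalarField K using (refl)

module Main (em : ExcludedMiddle 0ℓ) (K L : ScalarField) (embedding : Embedding K L) where

  open Embedding embedding using (ι-cong)
  open Transfer em K L embedding
  open Zariski (ScalarField.rawRing K) using (Generic₃; evaluate)

  algorithm-correct : ∀ n r → n ≡ 3 ℕ.* r → (T : K.Tensor n) (a : Fin r → Fin 3 → K.Vect n) →
    K.LinearlyIndependent (concat a) → T K.≋ K.∑ₜ (λ i → K.symProduct (a i)) →
    Generic₃ (λ f g ℓ → Algorithm.Produces (ScalarField.rawRing L) (ScalarField.scalar L) r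
      (mapTensor T) (mapVect f) (mapVect g) (mapVect ℓ) L.⟪ (λ i → mapTensor (K.symProduct (a i))) ⟫)
  algorithm-correct n r n≡3r T a independent T≋∑ =
      (λ w → evaluate discriminant w K.≈ K.0#)
    -- The closed set is a hypersurface: a single equation over the base field, indexed by a
    -- one-element type.
    , (⊤ , (λ _ → discriminant) , (λ w≈0 _ → w≈0) , (λ w≈0 → w≈0 tt))
    , (f* ++ g* ++ ℓ* , nondegenerate⇒discriminant≉0 (f* ++ g* ++ ℓ*) witness)
    , λ f g ℓ w≉0 → let nondegenerate = nondegenerate-over-L f g ℓ w≉0 in
        Correctness.produces em L (λ i k → mapVect (a i k)) (L.dualBasis _ (map-biorthogonal basis))
          (mapTensor T) (ι-∑ₜ a T≋∑) (mapVect f) (mapVect g) (mapVect ℓ)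
          (L.Nondegenerate.generic nondegenerate) (L.Nondegenerate.ψ≉0 nondegenerate)
              (L.Nondegenerate.triple≉0 nondegenerate) (λ i → ι-symProduct (a i))
    where
    open K.Discriminant a
    basis : K.BiorthogonalBasis (concat a)
    basis = K.biorthogonalBasis (≡.trans (ℕ.*-comm r 3) (≡.sym n≡3r)) (concat a) independent
    open K.Witness r using (t; nondegenerate)
    -- The dual basis turns a table of coordinates into a vector of the base field, so the generic
    -- point can be specified by its φ, γ and ψ.
    prescribed : (Fin r → Fin 3 → K.Carrier) → K.Vect n
    prescribed c = K.combination (λ p → uncurry c (remQuot 3 p)) (K.BiorthogonalBasis.b basis)
    prescribed-value : ∀ c i k → K.pairing (a i k) (prescribed c) K.≈ c i k
    prescribed-value c i k = K.trans
      (K.reflexive (cong (λ u → K.pairing u (prescribed c)) (≡.sym (K.concat-combine a i k))))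
      (K.trans (K.pairing-sumʳ (concat a (combine i k)) (λ p →
        uncurry c (remQuot 3 p)) (K.BiorthogonalBasis.b basis))
      (K.trans (K.sum-single (combine i k) (λ p p≢ik → K.*-zeroʳ-≈ (uncurry c (remQuot 3 p))
        (K.trans (K.BiorthogonalBasis.dual basis (combine i k) p) (K.unit-other p≢ik))))
      (K.trans (K.*-cong (K.reflexive (cong (uncurry c) (remQuot-combine i k)))
        (K.trans (K.BiorthogonalBasis.dual basis (combine i k) (combine i k))
            (K.unit-same (combine i k))))
        (K.*-identityʳ (c i k)))))
    f* g* ℓ* : K.Vect n
    f* = prescribed t
    g* = prescribed (λ _ _ → K.1#)
    ℓ* = prescribed (λ i k → t i k K.* t i k)
    -- Transfer along the identity replaces the prescribed values by the evaluations of the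
    -- polynomials.
    witness : K.Nondegenerate (φ (f* ++ g* ++ ℓ*)) (γ (f* ++ g* ++ ℓ*)) (ψ (f* ++ g* ++ ℓ*))
    witness = Transfer.map-nondegenerate em K K (identity K)
      (λ i k → K.sym (K.trans (evaluate-Φ f* g* ℓ* i k) (prescribed-value t i k)))
      (λ i k → K.sym (K.trans (evaluate-Γ f* g* ℓ* i k) (prescribed-value (λ _ _ → K.1#) i k)))
      (λ i k → K.sym (K.trans (evaluate-Ψ f* g* ℓ* i k) (prescribed-value (λ i k → t i k K.* t i k) i k)))
      nondegenerate
    nondegenerate-over-L : ∀ f g ℓ → evaluate discriminant (f ++ g ++ ℓ) K.≉ K.0# →
      L.Nondegenerate (λ i k → L.pairing (mapVect (a i k)) (mapVect f))
          (λ i k → L.pairing (mapVect (a i k)) (mapVect g))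
             (λ i k → L.pairing (mapVect (a i k)) (mapVect ℓ))
    nondegenerate-over-L f g ℓ w≉0 = map-nondegenerate
      (λ i k → L.trans (ι-cong (evaluate-Φ f g ℓ i k)) (ι-pairing (a i k) f))
      (λ i k → L.trans (ι-cong (evaluate-Γ f g ℓ i k)) (ι-pairing (a i k) g))
      (λ i k → L.trans (ι-cong (evaluate-Ψ f g ℓ i k)) (ι-pairing (a i k) ℓ))
      (discriminant≉0⇒nondegenerate (f ++ g ++ ℓ) w≉0)

-- Real and complex scalars

-- The operations are those of the given raw ring, so results about the bundled ring apply to the
-- definitions of the statement by computation alone. Commutativity supplies the other half of each
-- two-sided law.
mkCommutativeRing : (R : RawRing 0ℓ 0ℓ) → let open RawRing R in
  IsEquivalence _≈_ →
  (∀ {x y u v} → x ≈ y → u ≈ v → (x + u) ≈ (y + v)) →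
  (∀ {x y u v} → x ≈ y → u ≈ v → (x * u) ≈ (y * v)) →
  (∀ {x y} → x ≈ y → (- x) ≈ (- y)) →
  (∀ x y z → ((x + y) + z) ≈ (x + (y + z))) → (∀ x y → (x + y) ≈ (y + x)) →
  (∀ x → (0# + x) ≈ x) → (∀ x → ((- x) + x) ≈ 0#) →
  (∀ x y z → ((x * y) * z) ≈ (x * (y * z))) → (∀ x y → (x * y) ≈ (y * x)) →
  (∀ x → (1# * x) ≈ x) → (∀ x y z → (x * (y + z)) ≈ ((x * y) + (x * z))) →
  CommutativeRing 0ℓ 0ℓ
mkCommutativeRing R equiv +-cong *-cong neg-cong +-assoc +-comm +-idˡ neg-invˡ
  *-assoc *-comm *-idˡ distribˡ = record
  { Carrier = Carrier
  ; _≈_     = _≈_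
  ; _+_     = _+_
  ; _*_     = _*_
  ; -_      = -_
  ; 0#      = 0#
  ; 1#      = 1#
  ; isCommutativeRing = record
    { isRing = record
      { +-isAbelianGroup = record
        { isGroup = record
          { isMonoid = record
            { isSemigroup = record
              { isMagma = record { isEquivalence = equiv ; ∙-cong = +-cong }
              ; assoc   = +-assoc
              }
            ; identity = +-idˡ , λ x → trans (+-comm x 0#) (+-idˡ x)
            }
          ; inverse = neg-invˡ , λ x → trans (+-comm x (- x)) (neg-invˡ x)
          ; ⁻¹-cong = neg-cong
          }
        ; comm = +-comm
        }
      ; *-cong     = *-cong
      ; *-assoc    = *-assoc
      ; *-identity = *-idˡ , λ x → trans (*-comm x 1#) (*-idˡ x)
      ; distrib    = distribˡ , λ x y z → trans (*-comm (y + z) x)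
          (trans (distribˡ x y z) (+-cong (*-comm x y) (*-comm x z)))
      }
    ; *-comm = *-comm
    }
  }
  where
  open RawRing R
  open IsEquivalence equiv

-- The commutative ring of Cauchy reals

open ℝ

≈ε-sym : ∀ a b {ε} → a ≈[ ε ] b → b ≈[ ε ] a
≈ε-sym a b {ε} = subst (ℚ._< ε) (≡.trans (≡.sym (ℚ.∣-p∣≡∣p∣ (a ℚ.- b)))
  (cong ℚ.∣_∣ (solve 2 (λ a b → :- (a :- b) := b :- a) ≡.refl a b)))
  where open +-*-Solver

≈ε-trans : ∀ a b c {ε} → a ≈[ ½ ℚ.* ε ] b → b ≈[ ½ ℚ.* ε ] c → a ≈[ ε ] c
≈ε-trans a b c {ε} p q = subst (λ d → ℚ.∣ d ∣ ℚ.< ε)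
  (solve 3 (λ a b c → (a :+ b) :- (b :+ c) := a :- c) ≡.refl a b c)
  (+-close a b b c p q)
  where open +-*-Solver

-- The ring laws hold at every index of the representing sequences. The law of the inverse holds
-- only from the index on where the sequence stays away from zero.
eventually-≡ : ∀ {x y} N → (∀ n → N ℕ.≤ n → seq x n ≡ seq y n) → x ≈ℝ y
eventually-≡ {x} N eq ε 0<ε = N , λ n N≤n → subst (seq x n ≈[ ε ]_) (eq n N≤n) (self-close (seq x n) 0<ε)

pointwise : ∀ {x y} → (∀ n → seq x n ≡ seq y n) → x ≈ℝ y
pointwise {x} {y} eq = eventually-≡ {x} {y} 0 (λ n _ → eq n)

≈ℝ-isEquivalence : IsEquivalence _≈ℝ_
≈ℝ-isEquivalence = record
  { refl  = λ {x} → pointwise {x} {x} (λ _ → ≡.refl)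
  ; sym   = λ {x} {y} x≈y ε 0<ε → let N , close = x≈y ε 0<ε in
      N , λ n N≤n → ≈ε-sym (seq x n) (seq y n) (close n N≤n)
  ; trans = λ {x} {y} {z} x≈y y≈z ε 0<ε →
      let M , close₁ = x≈y (½ ℚ.* ε) (half-pos 0<ε)
          N , close₂ = y≈z (½ ℚ.* ε) (half-pos 0<ε)
      in M ℕ.⊔ N , λ n n≥ → ≈ε-trans (seq x n) (seq y n) (seq z n)
           (close₁ n (⊔₁ n≥)) (close₂ n (⊔₂ {M} n≥))
  }

+ℝ-cong : ∀ {x y u v} → x ≈ℝ y → u ≈ℝ v → (x +ℝ u) ≈ℝ (y +ℝ v)
+ℝ-cong {x} {y} {u} {v} x≈y u≈v ε 0<ε =
  let M , close₁ = x≈y (½ ℚ.* ε) (half-pos 0<ε)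
      N , close₂ = u≈v (½ ℚ.* ε) (half-pos 0<ε)
  in M ℕ.⊔ N , λ n n≥ → +-close (seq x n) (seq y n) (seq u n) (seq v n)
       (close₁ n (⊔₁ n≥)) (close₂ n (⊔₂ {M} n≥))

*ℝ-cong : ∀ {x y u v} → x ≈ℝ y → u ≈ℝ v → (x *ℝ u) ≈ℝ (y *ℝ v)
*ℝ-cong {x} {y} {u} {v} x≈y u≈v ε 0<ε =
  -- Bounds are needed for `x` and `v`, the factors that remain in xu - yv = x(u - v) + (x - y)v.
  let B , 0<B , (K , x≤B) , (L , v≤B) =
        common-bound {seq x} {seq v} (cauchy⇒bounded {seq x} (cauchy x))
            (cauchy⇒bounded {seq v} (cauchy v))
      δ , 0<δ , total = shrink B ε 0<B 0<ε
      M , close₁ = x≈y δ 0<δ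
      N , close₂ = u≈v δ 0<δ
  in (K ℕ.⊔ L) ℕ.⊔ (M ℕ.⊔ N) , λ n n≥ →
       subst (λ η → (seq x n ℚ.* seq u n) ≈[ η ] (seq y n ℚ.* seq v n)) total
         (*-close (seq x n) (seq y n) (seq u n) (seq v n) 0<B
           (x≤B n (⊔₁ (⊔₁ n≥))) (v≤B n (⊔₂ {K} (⊔₁ n≥)))
           (close₁ n (⊔₁ (⊔₂ {K ℕ.⊔ L} n≥))) (close₂ n (⊔₂ {M} (⊔₂ {K ℕ.⊔ L} n≥))))

-ℝ-cong : ∀ {x y} → x ≈ℝ y → (-ℝ x) ≈ℝ (-ℝ y)
-ℝ-cong {x} {y} x≈y ε 0<ε = let N , close = x≈y ε 0<ε in
  N , λ n N≤n → neg-close (seq x n) (seq y n) (close n N≤n)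

ℝ-commutativeRing : CommutativeRing 0ℓ 0ℓ
ℝ-commutativeRing = mkCommutativeRing ℝ-rawRing ≈ℝ-isEquivalence
  (λ {x} {y} {u} {v} → +ℝ-cong {x} {y} {u} {v})
  (λ {x} {y} {u} {v} → *ℝ-cong {x} {y} {u} {v})
  (λ {x} {y} → -ℝ-cong {x} {y})
  (λ x y z → pointwise {(x +ℝ y) +ℝ z} {x +ℝ (y +ℝ z)} λ n → ℚ.+-assoc (seq x n) (seq y n) (seq z n))
  (λ x y → pointwise {x +ℝ y} {y +ℝ x} λ n → ℚ.+-comm (seq x n) (seq y n))
  (λ x → pointwise {fromℚℝ 0ℚ +ℝ x} {x} λ n → ℚ.+-identityˡ (seq x n))
  (λ x → pointwise {(-ℝ x) +ℝ x} {fromℚℝ 0ℚ} λ n → ℚ.+-inverseˡ (seq x n))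
  (λ x y z → pointwise {(x *ℝ y) *ℝ z} {x *ℝ (y *ℝ z)} λ n → ℚ.*-assoc (seq x n) (seq y n) (seq z n))
  (λ x y → pointwise {x *ℝ y} {y *ℝ x} λ n → ℚ.*-comm (seq x n) (seq y n))
  (λ x → pointwise {fromℚℝ 1ℚ *ℝ x} {x} λ n → ℚ.*-identityˡ (seq x n))
  (λ x y z → pointwise {x *ℝ (y +ℝ z)} {(x *ℝ y) +ℝ (x *ℝ z)} λ n →
    ℚ.*-distribˡ-+ (seq x n) (seq y n) (seq z n))

-- Inverses of Cauchy sequences and sums of squares

p-0≡p : ∀ p → p ℚ.- 0ℚ ≡ p
p-0≡p = solve 1 (λ p → p :- con 0ℚ := p) ≡.refl
  where open +-*-Solver

-- Tested at ε = |p - q|: two distinct constants would be strictly closer than their own distance.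
fromℚℝ-injective : ∀ {p q} → fromℚℝ p ≈ℝ fromℚℝ q → p ≡ q
fromℚℝ-injective {p} {q} p≈q = decidable-stable (p ℚ.≟ q) λ p≢q →
  let 0<d = ℚ.≰⇒> λ d≤0 → p≢q (equal (ℚ.∣p∣≡0⇒p≡0 (p ℚ.- q) (ℚ.≤-antisym d≤0 (ℚ.0≤∣p∣ (p ℚ.- q)))))
      N , close = p≈q ℚ.∣ p ℚ.- q ∣ 0<d
  in ℚ.<-irrefl ≡.refl (close N ℕ.≤-refl)
  where
  open +-*-Solver
  equal : p ℚ.- q ≡ 0ℚ → p ≡ q
  equal eq = ≡.trans (solve 2 (λ p q → p := (p :- q) :+ q) ≡.refl p q)
    (≡.trans (cong (ℚ._+ q) eq) (ℚ.+-identityˡ q))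

-- Total inverse, with the junk value inv 0 = 0.
inv : ℚ → ℚ
inv q with q ℚ.≟ 0ℚ
... | yes _  = 0ℚ
... | no q≢0 = ℚ.1/_ q {{ℚ.≢-nonZero q≢0}}

inv-inverseʳ : ∀ {q} → q ≢ 0ℚ → q ℚ.* inv q ≡ 1ℚ
inv-inverseʳ {q} q≢0 with q ℚ.≟ 0ℚ
... | yes q≡0  = contradiction q≡0 q≢0
... | no  q≢0′ = ℚ.*-inverseʳ q {{ℚ.≢-nonZero q≢0′}}

AwayFromZero : (ℕ → ℚ) → Set
AwayFromZero s = Σ[ δ ∈ ℚ ] (0ℚ ℚ.< δ × Σ[ N ∈ ℕ ] (∀ n → N ℕ.≤ n → δ ℚ.≤ ℚ.∣ s n ∣))

away⇒≢0 : ∀ {q δ} → 0ℚ ℚ.< δ → δ ℚ.≤ ℚ.∣ q ∣ → q ≢ 0ℚ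
away⇒≢0 0<δ δ≤∣q∣ ≡.refl = ℚ.<-irrefl ≡.refl (ℚ.<-≤-trans 0<δ δ≤∣q∣)

-- ab (1/a - 1/b) = b - a, with |a| and |b| at least δ
inv-close : ∀ {a b δ ε} → 0ℚ ℚ.< δ → 0ℚ ℚ.< ε → δ ℚ.≤ ℚ.∣ a ∣ → δ ℚ.≤ ℚ.∣ b ∣ →
            b ≈[ δ ℚ.* δ ℚ.* ε ] a → inv a ≈[ ε ] inv b
inv-close {a} {b} {δ} {ε} 0<δ 0<ε δ≤a δ≤b close = ℚ.≰⇒> λ ε≤d → ℚ.<-irrefl ≡.refl (begin-strict
  ℚ.∣ b ℚ.- a ∣                         <⟨ close ⟩
  δ ℚ.* δ ℚ.* ε                         ≤⟨ ℚ.*-monoˡ-≤-nonNeg (δ ℚ.* δ) ε≤d ⟩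
  δ ℚ.* δ ℚ.* d                         ≤⟨ ℚ.*-monoʳ-≤-nonNeg d
      (ℚ.≤-trans (ℚ.*-monoˡ-≤-nonNeg δ δ≤b) (ℚ.*-monoʳ-≤-nonNeg ℚ.∣ b ∣ δ≤a)) ⟩
  ℚ.∣ a ∣ ℚ.* ℚ.∣ b ∣ ℚ.* d             ≡⟨ ≡.trans (ℚ.∣p*q∣≡∣p∣*∣q∣ (a ℚ.* b) (inv a ℚ.- inv b))
      (cong (ℚ._* d) (ℚ.∣p*q∣≡∣p∣*∣q∣ a b)) ⟨
  ℚ.∣ a ℚ.* b ℚ.* (inv a ℚ.- inv b) ∣   ≡⟨ cong ℚ.∣_∣ difference ⟩
  ℚ.∣ b ℚ.- a ∣                         ∎)
  where
  open ℚ.≤-Reasoning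
  open +-*-Solver
  d : ℚ
  d = ℚ.∣ inv a ℚ.- inv b ∣
  instance
    d-nonNeg : ℚ.NonNegative d
    d-nonNeg = ℚ.∣-∣-nonNeg (inv a ℚ.- inv b)
    b-nonNeg : ℚ.NonNegative ℚ.∣ b ∣
    b-nonNeg = ℚ.∣-∣-nonNeg b
    δ-pos : ℚ.Positive δ
    δ-pos = ℚ.positive 0<δ
    δ-nonNeg : ℚ.NonNegative δ
    δ-nonNeg = ℚ.pos⇒nonNeg δ
    δδ-nonNeg : ℚ.NonNegative (δ ℚ.* δ)
    δδ-nonNeg = ℚ.nonNeg*nonNeg⇒nonNeg δ δ
  difference : a ℚ.* b ℚ.* (inv a ℚ.- inv b) ≡ b ℚ.- a
  difference = ≡.trans
    (solve 4 (λ a b x y → a :* b :* (x :- y)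
           := (a :* x) :* b :- (b :* y) :* a) ≡.refl a b (inv a) (inv b))
    (≡.trans (cong₂ (λ s t →
      s ℚ.* b ℚ.- t ℚ.* a) (inv-inverseʳ (away⇒≢0 0<δ δ≤a)) (inv-inverseʳ (away⇒≢0 0<δ δ≤b)))
      (cong₂ ℚ._-_ (ℚ.*-identityˡ b) (ℚ.*-identityˡ a)))

abstract

  inv-cauchy : ∀ {s} → IsCauchy s → AwayFromZero s → IsCauchy (inv ∘ s)
  inv-cauchy {s} c (δ , 0<δ , M , away) ε 0<ε =
    let N , close = c (δ ℚ.* δ ℚ.* ε) (ℚ.positive⁻¹ _ {{ℚ.pos*pos⇒pos (δ ℚ.* δ) ε}})
    in M ℕ.⊔ N , λ m n m≥ n≥ → inv-close 0<δ 0<ε (away m (⊔₁ m≥)) (away n (⊔₁ n≥))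
         (close n m (⊔₂ {M} n≥) (⊔₂ {M} m≥))
    where
    instance
      δ-pos : ℚ.Positive δ
      δ-pos = ℚ.positive 0<δ
      ε-pos : ℚ.Positive ε
      ε-pos = ℚ.positive 0<ε
      δδ-pos : ℚ.Positive (δ ℚ.* δ)
      δδ-pos = ℚ.pos*pos⇒pos δ δ

∣p∣*∣p∣≡p*p : ∀ p → ℚ.∣ p ∣ ℚ.* ℚ.∣ p ∣ ≡ p ℚ.* p
∣p∣*∣p∣≡p*p p with ℚ.∣p∣≡p∨∣p∣≡-p p
... | inj₁ eq = cong₂ ℚ._*_ eq eq
... | inj₂ eq = ≡.trans (cong₂ ℚ._*_ eq eq) (solve 1 (λ p → (:- p) :* (:- p) := p :* p) ≡.refl p)
  where open +-*-Solver

0≤p*p : ∀ p → 0ℚ ℚ.≤ p ℚ.* p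
0≤p*p p = subst (0ℚ ℚ.≤_) (≡.trans (ℚ.∣p*q∣≡∣p∣*∣q∣ p p) (∣p∣*∣p∣≡p*p p)) (ℚ.0≤∣p∣ (p ℚ.* p))

-- Since x² is at most x² + y², tolerance ε² for the sum yields ε for x. This is what makes the norm
-- of a nonzero complex number nonzero.
sum-of-squares : ∀ x y → ((x *ℝ x) +ℝ (y *ℝ y)) ≈ℝ fromℚℝ 0ℚ → x ≈ℝ fromℚℝ 0ℚ
sum-of-squares x y x²+y²≈0 ε 0<ε =
  let N , close = x²+y²≈0 (ε ℚ.* ε) (ℚ.positive⁻¹ _ {{ℚ.pos*pos⇒pos ε ε}})
  in N , λ n N≤n → bound (seq x n) (seq y n) (close n N≤n)
  where
  open ℚ.≤-Reasoning
  instance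
    ε-pos : ℚ.Positive ε
    ε-pos = ℚ.positive 0<ε
    ε-nonNeg : ℚ.NonNegative ε
    ε-nonNeg = ℚ.pos⇒nonNeg ε
  bound : ∀ p q → (p ℚ.* p ℚ.+ q ℚ.* q) ≈[ ε ℚ.* ε ] 0ℚ → p ≈[ ε ] 0ℚ
  bound p q close = subst (λ t → ℚ.∣ t ∣ ℚ.< ε) (≡.sym (p-0≡p p)) (ℚ.≰⇒> λ ε≤∣p∣ →
    ℚ.<-irrefl ≡.refl (begin-strict
      ε ℚ.* ε                             ≤⟨ ℚ.*-monoˡ-≤-nonNeg ε ε≤∣p∣ ⟩
      ε ℚ.* ℚ.∣ p ∣                       ≤⟨ ℚ.*-monoʳ-≤-nonNeg ℚ.∣ p ∣ {{ℚ.∣-∣-nonNeg p}} ε≤∣p∣ ⟩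
      ℚ.∣ p ∣ ℚ.* ℚ.∣ p ∣                 ≡⟨ ∣p∣*∣p∣≡p*p p ⟩
      p ℚ.* p                             ≡⟨ ℚ.+-identityʳ _ ⟨
      p ℚ.* p ℚ.+ 0ℚ                      ≤⟨ ℚ.+-monoʳ-≤ (p ℚ.* p) (0≤p*p q) ⟩
      p ℚ.* p ℚ.+ q ℚ.* q                 ≡⟨ ℚ.0≤p⇒∣p∣≡p
          (ℚ.≤-trans (0≤p*p p)
              (subst (ℚ._≤ p ℚ.* p ℚ.+ q ℚ.* q) (ℚ.+-identityʳ (p ℚ.* p))
                  (ℚ.+-monoʳ-≤ (p ℚ.* p) (0≤p*p q)))) ⟨
      ℚ.∣ p ℚ.* p ℚ.+ q ℚ.* q ∣           ≡⟨ cong ℚ.∣_∣ (p-0≡p _) ⟨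
      ℚ.∣ (p ℚ.* p ℚ.+ q ℚ.* q) ℚ.- 0ℚ ∣  <⟨ close ⟩
      ε ℚ.* ε                             ∎))

-- Complex arithmetic as polynomial identities in real and imaginary parts

module ComplexIdentities (R : CommutativeRing 0ℓ 0ℓ) where

  open CommutativeRing R
  open IntegerSolver R

  re-assoc : ∀ a b c d e f → (a * c + - (b * d)) * e + - ((a * d + b * c) * f)
                           ≈ a * (c * e + - (d * f)) + - (b * (c * f + d * e))
  re-assoc = solve 6 (λ a b c d e f → (a :* c :- b :* d) :* e :- (a :* d :+ b :* c) :* f
                   := a :* (c :* e :- d :* f) :- b :* (c :* f :+ d :* e)) refl

  im-assoc : ∀ a b c d e f → (a * c + - (b * d)) * f + (a * d + b * c) * e
                           ≈ a * (c * f + d * e) + b * (c * e + - (d * f))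
  im-assoc = solve 6 (λ a b c d e f → (a :* c :- b :* d) :* f :+ (a :* d :+ b :* c) :* e
                   := a :* (c :* f :+ d :* e) :+ b :* (c :* e :- d :* f)) refl

  re-comm : ∀ a b c d → a * c + - (b * d) ≈ c * a + - (d * b)
  re-comm = solve 4 (λ a b c d → a :* c :- b :* d := c :* a :- d :* b) refl

  im-comm : ∀ a b c d → a * d + b * c ≈ c * b + d * a
  im-comm = solve 4 (λ a b c d → a :* d :+ b :* c := c :* b :+ d :* a) refl

  re-identity : ∀ a b → 1# * a + - (0# * b) ≈ a
  re-identity = solve 2 (λ a b → con (+ 1) :* a :- con (+ 0) :* b := a) refl

  im-identity : ∀ a b → 1# * b + 0# * a ≈ b
  im-identity = solve 2 (λ a b → con (+ 1) :* b :+ con (+ 0) :* a := b) refl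

  re-distrib : ∀ a b c d e f → a * (c + e) + - (b * (d + f)) ≈ (a * c + - (b * d)) + (a * e + - (b * f))
  re-distrib = solve 6 (λ a b c d e f → a :* (c :+ e) :- b :* (d :+ f)
         := (a :* c :- b :* d) :+ (a :* e :- b :* f)) refl

  im-distrib : ∀ a b c d e f → a * (d + f) + b * (c + e) ≈ (a * d + b * c) + (a * f + b * e)
  im-distrib = solve 6 (λ a b c d e f → a :* (d :+ f) :+ b :* (c :+ e)
         := (a :* d :+ b :* c) :+ (a :* f :+ b :* e)) refl

  re-real : ∀ x y → x * y ≈ x * y + - (0# * 0#)
  re-real = solve 2 (λ x y → x :* y := x :* y :- con (+ 0) :* con (+ 0)) refl

  im-real : ∀ x y → 0# ≈ x * 0# + 0# * y
  im-real = solve 2 (λ x y → con (+ 0) := x :* con (+ 0) :+ con (+ 0) :* y) refl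

  re-inverse : ∀ a b w → a * (a * w) + - (b * (- (b * w))) ≈ (a * a + b * b) * w
  re-inverse = solve 3 (λ a b w → a :* (a :* w) :- b :* (:- (b :* w)) := (a :* a :+ b :* b) :* w) refl

  im-inverse : ∀ a b w → a * (- (b * w)) + b * (a * w) ≈ 0#
  im-inverse = solve 3 (λ a b w → a :* (:- (b :* w)) :+ b :* (a :* w) := con (+ 0)) refl

module Scalars (em : ExcludedMiddle 0ℓ) where

  -- By contradiction: beyond a Cauchy index for ε / 2, a single term of size at least ε would keep
  -- all later terms at size at least ε / 2. If no such bound exists, all these terms are below ε,
  -- and the sequence tends to zero.
  away : ∀ x → ¬ (x ≈ℝ fromℚℝ 0ℚ) → AwayFromZero (seq x)
  away x x≉0 = decidable-stable em λ none → x≉0 λ ε 0<ε →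
    let N , close = cauchy x (½ ℚ.* ε) (half-pos 0<ε)
    in N , λ n N≤n → decidable-stable (_ ℚ.<? _) λ far → none
      (½ ℚ.* ε , half-pos 0<ε , N , λ m N≤m → ℚ.≮⇒≥ λ near →
        far (≈ε-trans (seq x n) (seq x m) 0ℚ (close n m N≤n N≤m)
          (subst (λ t → ℚ.∣ t ∣ ℚ.< ½ ℚ.* ε) (≡.sym (p-0≡p (seq x m))) near)))

  ℝ-inverse : ∀ x → ¬ (x ≈ℝ fromℚℝ 0ℚ) → ∃ λ y → (x *ℝ y) ≈ℝ fromℚℝ 1ℚ
  ℝ-inverse x x≉0 =
    let δ , 0<δ , N , δ≤ = away x x≉0
        y = real (inv ∘ seq x) (inv-cauchy {seq x} (cauchy x) (away x x≉0))
    in y , eventually-≡ {x *ℝ y} {fromℚℝ 1ℚ} N λ n N≤n → inv-inverseʳ (away⇒≢0 0<δ (δ≤ n N≤n))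

  ℝ-field : ScalarField
  ℝ-field = record
    { commutativeRing  = ℝ-commutativeRing
    ; 1≉0              = λ 1≈0 → contradiction (fromℚℝ-injective {1ℚ} {0ℚ} 1≈0) λ ()
    ; inverse          = ℝ-inverse
    ; scalar           = fromℚ reals
    ; scalar-injective = fromℚℝ-injective
    ; scalar-0         = pointwise {fromℚℝ 0ℚ} {fromℚℝ 0ℚ} λ _ → ≡.refl
    ; six-sixths       = pointwise {six *ℝ fromℚℝ (+ 1 ℚ./ 6)} {1ᴿ} λ _ → ≡.refl
    }
    where
    1ᴿ six : ℝ
    1ᴿ = fromℚℝ 1ℚ
    six = ((((1ᴿ +ℝ 1ᴿ) +ℝ 1ᴿ) +ℝ 1ᴿ) +ℝ 1ᴿ) +ℝ 1ᴿ

  module _ where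

    open ScalarField ℝ-field hiding (commutativeRing; inverse; rawRing)
    open ComplexIdentities ℝ-commutativeRing
    open ℂ

    ℂ-commutativeRing : CommutativeRing 0ℓ 0ℓ
    ℂ-commutativeRing = mkCommutativeRing ℂ-rawRing
      (record
        { refl  = λ {z} → refl {re z} , refl {im z}
        ; sym   = λ {z} {w} (p , q) → sym {re z} {re w} p , sym {im z} {im w} q
        ; trans = λ {z} {w} {v} (p , q)
            (p′ , q′) → trans {re z} {re w} {re v} p p′ , trans {im z} {im w} {im v} q q′
        })
      (λ {z} {w} {u} {v} (p , q) (p′ , q′) →
        +-cong {re z} {re w} {re u} {re v} p p′ , +-cong {im z} {im w} {im u} {im v} q q′)
      (λ {z} {w} {u} {v} (p , q) (p′ , q′) →
          +-cong {re z * re u} {re w * re v} { - (im z * im u)} { - (im w * im v)}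
              (*-cong {re z} {re w} {re u} {re v} p p′)
            (-‿cong {im z * im u} {im w * im v} (*-cong {im z} {im w} {im u} {im v} q q′))
        , +-cong {re z * im u} {re w * im v} {im z * re u} {im w * re v}
            (*-cong {re z} {re w} {im u} {im v} p q′)
            (*-cong {im z} {im w} {re u} {re v} q p′))
      (λ {z} {w} (p , q) → -‿cong {re z} {re w} p , -‿cong {im z} {im w} q)
      (λ z w v → +-assoc (re z) (re w) (re v) , +-assoc (im z) (im w) (im v))
      (λ z w → +-comm (re z) (re w) , +-comm (im z) (im w))
      (λ z → +-identityˡ (re z) , +-identityˡ (im z))
      (λ z → -‿inverseˡ (re z) , -‿inverseˡ (im z))
      (λ z w v → re-assoc (re z) (im z) (re w) (im w) (re v) (im v) , im-assoc (re z) (im z) (re w)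
          (im w) (re v) (im v))
      (λ z w → re-comm (re z) (im z) (re w) (im w) , im-comm (re z) (im z) (re w) (im w))
      (λ z → re-identity (re z) (im z) , im-identity (re z) (im z))
      (λ z w v → re-distrib (re z) (im z) (re w) (im w) (re v) (im v) , im-distrib (re z) (im z) (re w)
          (im w) (re v) (im v))

    -- The conjugate divided by the norm a² + b²; were the norm zero, `sum-of-squares`, applied in
    -- both orders, would annihilate both parts.
    ℂ-inverse : ∀ z → ¬ (CommutativeRing._≈_ ℂ-commutativeRing z (CommutativeRing.0# ℂ-commutativeRing)) →
      ∃ λ w → CommutativeRing._≈_ ℂ-commutativeRing (CommutativeRing._*_ ℂ-commutativeRing z w)
          (CommutativeRing.1# ℂ-commutativeRing)
    ℂ-inverse z z≉0 =
      let a = re z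
          b = im z
          N≉0 = λ N≈0 → z≉0 (sum-of-squares a b N≈0 ,
            sum-of-squares b a (trans {b * b + a * a} {a * a + b * b} {0#} (+-comm (b * b) (a * a)) N≈0))
          w , Nw≈1 = ℝ-inverse (a * a + b * b) N≉0
      in (a * w) +i (- (b * w)) ,
         ( trans {a * (a * w) + - (b * - (b * w))} {(a * a + b * b) * w} {1#}
             (re-inverse a b w) Nw≈1
         , im-inverse a b w)

  ℂ-field : ScalarField
  ℂ-field = record
    { commutativeRing  = ℂ-commutativeRing
    ; 1≉0              = λ (1≈0 , _) → contradiction (fromℚℝ-injective {1ℚ} {0ℚ} 1≈0) λ ()
    ; inverse          = ℂ-inverse
    ; scalar           = fromℚ complexes
    ; scalar-injective = λ (p≈q , _) → fromℚℝ-injective p≈q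
    ; scalar-0         = CommutativeRing.refl ℂ-commutativeRing {fromℚ complexes 0ℚ}
    ; six-sixths       = pointwise {ℂ.re six-sixth} {fromℚℝ 1ℚ} (λ _ → ≡.refl)
                       , pointwise {ℂ.im six-sixth} {fromℚℝ 0ℚ} (λ _ → ≡.refl)
    }
    where
    open CommutativeRing ℂ-commutativeRing using (_+_; _*_; 1#)
    six-sixth : ℂ
    six-sixth = (1# + 1# + 1# + 1# + 1# + 1#) * fromℚ complexes (+ 1 ℚ./ 6)

module Fields (em : ExcludedMiddle 0ℓ) where

  open Scalars em
  private
    module R = ScalarField ℝ-field

  ℝ↪ℂ : Embedding ℝ-field ℂ-field
  ℝ↪ℂ = record
    { ι           = fromℝ
    ; ι-cong      = λ x≈y → x≈y , R.refl {fromℚℝ 0ℚ}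
    ; ι-injective = proj₁
    ; ι-+         = λ x y → R.refl {x +ℝ y} , R.sym {fromℚℝ 0ℚ +ℝ fromℚℝ 0ℚ} {fromℚℝ 0ℚ}
        (R.+-identityˡ (fromℚℝ 0ℚ))
    ; ι-*         = λ x y → real-part x y , imaginary-part x y
    ; ι--         = λ x → R.refl { -ℝ x} , R.sym { -ℝ (fromℚℝ 0ℚ)} {fromℚℝ 0ℚ}
        (pointwise { -ℝ (fromℚℝ 0ℚ)} {fromℚℝ 0ℚ} λ _ → ≡.refl)
    ; ι-0         = ScalarField.refl ℂ-field {fromℝ (fromℚℝ 0ℚ)}
    ; ι-1         = ScalarField.refl ℂ-field {fromℝ (fromℚℝ 1ℚ)}
    ; ι-scalar    = λ q → ScalarField.refl ℂ-field {fromℝ (fromℚℝ q)}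
    }
    where
    open ComplexIdentities ℝ-commutativeRing using (re-real; im-real)
    real-part : ∀ x y → x R.* y R.≈ x R.* y R.+ R.- (R.0# R.* R.0#)
    real-part = re-real
    imaginary-part : ∀ x y → R.0# R.≈ x R.* R.0# R.+ R.0# R.* y
    imaginary-part = im-real

open import Data.Nat.Base using (_*_)

theorem2p4 : ExcludedMiddle 0ℓ →
    (𝕂 : BaseField) → let open Over 𝕂 in
    (n r : ℕ) → n ≡ 3 * r →
    (T : Tensor n) → IsSymmetric T →
    (a : Fin r → Fin 3 → Vect n) →
    LinearlyIndependent (concat a) →
    T ≋ ∑ₜ (λ i → symProduct (a i)) →
    Generic₃ (λ f g ℓ →
    ProducesOverℂ r (tensorToℂ T) (vectToℂ f) (vectToℂ g) (vectToℂ ℓ)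
    ℂ-Space.⟪ (λ i → tensorToℂ (symProduct (a i))) ⟫)
theorem2p4 em reals n r n≡3r T _ =
  Main.algorithm-correct em (Scalars.ℝ-field em) (Scalars.ℂ-field em) (Fields.ℝ↪ℂ em) n r n≡3r T
theorem2p4 em complexes n r n≡3r T _ =
  Main.algorithm-correct em (Scalars.ℂ-field em) (Scalars.ℂ-field em) (identity (Scalars.ℂ-field em)) n r n≡3r T
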